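{- Let $n\ge1$, let $\mu=(\mu_1,\ldots,\mu_n)\in\mathbb{Z}_{\ge0}^n$ and let $\lambda$ be the weakly decreasing rearrangement of $\mu$. Then $$E_\mu(1,t,t^2,\ldots,t^{n-1};q,t)=t^{n(\lambda)}\prod_{(r,c)\in\mu}\frac{1-q^ct^{v_\mu(r)}}{1-q^{\mu_r-c+1}t^{v_\mu(r)-u_\mu(r,c)}},$$ where $n(\lambda)=\sum_{i=1}^n(i-1)\lambda_i$ and the product is over the boxes $(r,c)$ of $\mu$, i.e. pairs with $r\in\{1,\ldots,n\}$ and $c\in\{1,\ldots,\mu_r\}$.
   Context: Let $q,t^{1/2}$ be independent indeterminates over $\mathbb{C}$, $t=(t^{1/2})^2$, $K=\mathbb{C}(q,t^{1/2})$, $K[X]=K[x_1^{\pm1},\ldots,x_n^{\pm1}]$. $S_n$ acts on $K[X]$ by permuting variables and on $\mathbb{Z}^n$ by $(w\mu)_{w(i)}=\mu_i$; $s_i=(i,i+1)$. Put $\partial_if=\frac{f-s_if}{x_i-x_{i+1}}$. For $\mu\in\mathbb{Z}^n$, $v_\mu\in S_n$ is the minimal length permutation such that $v_\mu\mu$ is weakly increasing; explicitly $v_\mu(r)=1+\#\{r'<r:\mu_{r'}\le\mu_r\}+\#\{r'>r:\mu_{r'}<\mu_r\}$. For a box $(r,c)$ of $\mu\in\mathbb{Z}^n_{\ge0}$, $$u_\mu(r,c)=\#\{r'\in\{1,\ldots,r-1\}:\mu_{r'}\le c-1\}+\#\{r'\in\{r+1,\ldots,n\}:\mu_{r'}<c-1\}.$$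 The electronic (nonsymmetric) Macdonald polynomials $E_\mu=E_\mu(x_1,\ldots,x_n;q,t)\in K[X]$, $\mu\in\mathbb{Z}^n$, are determined by: (E0) $E_{(0,\ldots,0)}=1$; (E1) $E_{(\mu_n+1,\mu_1,\ldots,\mu_{n-1})}=q^{\mu_n}x_1E_\mu(x_2,\ldots,x_n,q^{ -1}x_1)$; (E2) if $\mu\in\mathbb{Z}_{\ge0}^n$ and $\mu_i>\mu_{i+1}$ then $E_{s_i\mu}=\partial_i(x_iE_\mu)-tx_i\partial_iE_\mu+\frac{(1-t)a}{1-a}E_\mu$ with $a=q^{\mu_i-\mu_{i+1}}t^{v_\mu(i)-v_\mu(i+1)}$; (E3) $E_{(\mu_1-1,\ldots,\mu_n-1)}=x_1^{ -1}\cdots x_n^{ -1}E_\mu$. -}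

module Defs where

open import Algebra.Apartness.Bundles using (HeytingField)
open import Algebra.Bundles using (CommutativeRing)
import Algebra.Apartness.Properties.HeytingCommutativeRing as HeytingProperties
import Algebra.Morphism.Structures as Morphisms
import Algebra.Properties.CommutativeMonoid.Sum as BigOperator
import Algebra.Properties.CommutativeSemiring.Exp as CommExp
import Algebra.Properties.Ring as RingProperties
import Algebra.Properties.Semiring.Exp as Exp
open import Data.Bool.Base using (if_then_else_)
open import Data.Fin.Base as Fin using (Fin; toℕ; inject₁; zero; suc)
import Data.Fin.Properties as Fin
open import Data.Integer.Base as ℤ using (ℤ; +_; -[1+_]; 0ℤ; 1ℤ; -1ℤ)
import Data.Integer.Properties as ℤ
open import Data.List.Base as List using (List; []; _∷_; _++_; [_]; cartesianProductWith)
open import Data.List.Relation.Binary.Permutation.Propositional using (_↭_)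
open import Data.Nat.Base as ℕ using (ℕ; zero; suc)
import Data.Nat.Properties as ℕ
open import Data.Product.Base using (∃; ∃₂; _×_; _,_; proj₁; proj₂; map₁; map₂)
import Data.Product.Properties as Product
open import Data.Vec.Base as Vec using (Vec; []; _∷_; lookup; allFin; count; _[_]≔_)
import Data.Vec.Properties as Vec
open import Level using (Level; _⊔_) renaming (suc to lsuc)
import Relation.Binary.PropositionalEquality as ≡
import Relation.Binary.Reasoning.Setoid as SetoidReasoning
open import Relation.Binary.Definitions using (DecidableEquality)
open import Relation.Nullary.Decidable using (does; dec-true; _×-dec_)

private
  variable
    a : Level
    A : Set a
    n : ℕ

⌜_⌝ : Vec ℕ n → Vec ℤ n
⌜_⌝ = Vec.map +_

swap : Fin n → Vec A (suc n) → Vec A (suc n)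
swap zero    (x ∷ y ∷ xs) = y ∷ x ∷ xs
swap (suc i) (x ∷ xs)     = x ∷ swap i xs

-- v μ is the minimal length permutation sorting μ into weakly increasing order, i.e. v μ r is the
-- position of μᵣ in that order.  Values of v are 1-based, as are the column indices c of u; rows r are 0-based.
v : Vec ℤ n → Fin n → ℕ
v {n} μ r = 1 ℕ.+ count (λ r′ → r′ Fin.<? r ×-dec lookup μ r′ ℤ.≤? lookup μ r) (allFin n)
              ℕ.+ count (λ r′ → r Fin.<? r′ ×-dec lookup μ r′ ℤ.<? lookup μ r) (allFin n)

u : Vec ℕ n → Fin n → ℕ → ℕ
u {n} μ r c = count (λ r′ → r′ Fin.<? r ×-dec lookup μ r′ ℕ.≤? c ℕ.∸ 1) (allFin n)
        ℕ.+ count (λ r′ → r Fin.<? r′ ×-dec lookup μ r′ ℕ.<? c ℕ.∸ 1) (allFin n)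

record _IsDecreasingRearrangementOf_ (ν μ : Vec ℕ n) : Set where
  field
    decreasing  : ∀ {i j} → i Fin.≤ j → lookup ν j ℕ.≤ lookup ν i
    permutation : Vec.toList ν ↭ Vec.toList μ

n⟨_⟩ : Vec ℕ n → ℕ
n⟨ ν ⟩ = Vec.sum (Vec.tabulate λ i → toℕ i ℕ.* lookup ν i)

m>n⇒0<m-n : ∀ {m n} → m ℕ.> n → 0ℤ ℤ.< + m ℤ.- + n
m>n⇒0<m-n {m} {n} m>n
  rewrite ℤ.[+m]-[+n]≡m⊖n m n | ℤ.⊖-≥ (ℕ.<⇒≤ m>n) = ℤ.+<+ (ℕ.m<n⇒0<n∸m m>n)

c≤m⇒0<m-c+1 : ∀ {m c} → c ℕ.≤ m → 0ℤ ℤ.< + m ℤ.- + c ℤ.+ 1ℤ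
c≤m⇒0<m-c+1 c≤m = ℤ.+-mono-≤-< (ℤ.i≤j⇒0≤j-i (ℤ.+≤+ c≤m)) (ℤ.+<+ (ℕ.s≤s ℕ.z≤n))

-- Elements of the monoid algebra R[M] are lists of terms (coefficient, exponent), in no
-- particular order and possibly with repeated exponents.  They are to be compared by `coeff`.
module Terms {c ℓ m} (R : CommutativeRing c ℓ) {M : Set m} (_≟_ : DecidableEquality M) where
  open CommutativeRing R

  TermList : Set (c ⊔ m)
  TermList = List (Carrier × M)

  coeff : TermList → M → Carrier
  coeff []            α = 0#
  coeff ((c , β) ∷ f) α = (if does (β ≟ α) then c else 0#) + coeff f α

-- Polynomials in two indeterminates over k, and their values at (q , t½) in a ring K over k.
-- The exponent (a , b) stands for qᵃ t½ᵇ.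
module Bivariate {c ℓ₁ ℓ₂ c′ ℓ′} (k : HeytingField c ℓ₁ ℓ₂) (K : CommutativeRing c′ ℓ′) where
  private module k = HeytingField k
  open CommutativeRing K
  open Exp semiring using (_^_)

  constants : CommutativeRing c ℓ₁
  constants = record { isCommutativeRing = k.isCommutativeRing }

  open Terms constants (Product.≡-dec ℕ._≟_ ℕ._≟_) public renaming (TermList to Poly)

  Nonzero : Poly → Set ℓ₂
  Nonzero p = ∃ λ α → coeff p α k.# k.0#

  value : (k.Carrier → Carrier) → (q t½ : Carrier) → Poly → Carrier
  value ι q t½ []                = 0#
  value ι q t½ ((c , a , b) ∷ p) = ι c * (q ^ a * t½ ^ b) + value ι q t½ p

-- A field k(q,t½) of rational functions in two independent indeterminates q, t½ over k: a field
-- extension of k in which q, t½ are algebraically independent over k and which they generate.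
-- Fields are Heyting fields; classically these are all the fields, with x # y meaning x ≠ y.
-- No property of ℂ beyond its being a field enters, so the constant field k is left arbitrary.
record RationalFunctionField {c ℓ₁ ℓ₂} (k : HeytingField c ℓ₁ ℓ₂) c′ ℓ₁′ ℓ₂′
       : Set (c ⊔ ℓ₁ ⊔ ℓ₂ ⊔ lsuc (c′ ⊔ ℓ₁′ ⊔ ℓ₂′)) where
  field
    heytingField : HeytingField c′ ℓ₁′ ℓ₂′

  private
    module k = HeytingField k
    module K = HeytingField heytingField

  commutativeRing : CommutativeRing c′ ℓ₁′
  commutativeRing = record { isCommutativeRing = K.isCommutativeRing }

  private
    module P = Bivariate k commutativeRing

  field
    ι                : k.Carrier → K.Carrier
    ι-isHomomorphism : Morphisms.IsRingHomomorphism
                         (CommutativeRing.rawRing P.constants)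
                         (CommutativeRing.rawRing commutativeRing) ι
    q t½             : K.Carrier
    independent      : ∀ p → P.Nonzero p → P.value ι q t½ p K.# K.0#
    generated        : ∀ z → ∃₂ λ p s → P.Nonzero s × z K.* P.value ι q t½ s K.≈ P.value ι q t½ p

module FieldOperations
  {c ℓ₁ ℓ₂ c′ ℓ₁′ ℓ₂′} {k : HeytingField c ℓ₁ ℓ₂} (K : RationalFunctionField k c′ ℓ₁′ ℓ₂′) where

  open RationalFunctionField K
  open HeytingField heytingField
  open CommutativeRing commutativeRing
    using (semiring; commutativeSemiring; *-commutativeMonoid; ring)
  open Exp semiring using (_^_; ^-homo-*; ^-congˡ)
  open Bivariate k commutativeRing using (Poly; coeff; value)
  private
    module k where
      open HeytingField k public
      open HeytingProperties (HeytingField.heytingCommutativeRing k) public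
  open HeytingProperties (HeytingField.heytingCommutativeRing heytingField)
  open Morphisms.IsRingHomomorphism ι-isHomomorphism using (1#-homo; -‿homo)
  open RingProperties ring using (-‿distribˡ-*)
  open CommExp commutativeSemiring using (^-distrib-*)
  open BigOperator *-commutativeMonoid public using () renaming (sum to prod)
  open SetoidReasoning setoid

  infixl 7 _/_by_
  infixr 8 _^*_ _^ᶻ_

  inverse : ∀ {y} → y # 0# → Carrier
  inverse y#0 = proj₁ (#⇒invertible y#0)

  _/_by_ : Carrier → (y : Carrier) → y # 0# → Carrier
  x / y by y#0 = x * inverse y#0

  K* : Set (c′ ⊔ ℓ₂′)
  K* = ∃ λ x → x # 0#

  _^*_ : K* → ℕ → K*
  (x , x#0) ^* n = x ^ n , power#0 n
    where
    power#0 : ∀ n → x ^ n # 0#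
    power#0 zero    = 1#0
    power#0 (suc n) = x#0y#0→xy#0 x#0 (power#0 n)

  _^ᶻ_ : K* → ℤ → Carrier
  (x , x#0) ^ᶻ (+ n)    = x ^ n
  (x , x#0) ^ᶻ -[1+ n ] = inverse x#0 ^ suc n

  t : Carrier
  t = t½ * t½

  private
    ⟦_⟧ₚ : Poly → Carrier
    ⟦_⟧ₚ = value ι q t½

    monomial : ∀ a b → ⟦ [ k.1# , a , b ] ⟧ₚ ≈ q ^ a * t½ ^ b
    monomial a b = begin
      ι k.1# * (q ^ a * t½ ^ b) + 0#  ≈⟨ +-identityʳ _ ⟩
      ι k.1# * (q ^ a * t½ ^ b)       ≈⟨ *-congʳ 1#-homo ⟩
      1# * (q ^ a * t½ ^ b)           ≈⟨ *-identityˡ _ ⟩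
      q ^ a * t½ ^ b                  ∎

    binomial : ∀ a b a′ b′ → ⟦ (k.1# , a , b) ∷ (k.- k.1# , a′ , b′) ∷ [] ⟧ₚ
                             ≈ q ^ a * t½ ^ b - q ^ a′ * t½ ^ b′
    binomial a b a′ b′ = +-cong (trans (*-congʳ 1#-homo) (*-identityˡ _)) (begin
      ι (k.- k.1#) * z + 0#  ≈⟨ +-identityʳ _ ⟩
      ι (k.- k.1#) * z       ≈⟨ *-congʳ (trans (-‿homo k.1#) (-‿cong 1#-homo)) ⟩
      (- 1#) * z             ≈⟨ -‿distribˡ-* 1# z ⟨
      - (1# * z)             ≈⟨ -‿cong (*-identityˡ z) ⟩
      - z                    ∎)
      where z = q ^ a′ * t½ ^ b′

    t^ : ∀ b → t½ ^ (b ℕ.+ b) ≈ t ^ b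
    t^ b = trans (^-homo-* t½ b b) (sym (^-distrib-* t½ t½ b))

    1+0#0 : (k.1# k.+ k.0#) k.# k.0#
    1+0#0 = k.#-congʳ (k.sym (k.+-identityʳ k.1#)) k.1#0

  q#0 : q # 0#
  q#0 = #-congʳ (trans (monomial 1 0) (trans (*-identityʳ _) (*-identityʳ q)))
          (independent [ k.1# , 1 , 0 ] ((1 , 0) , 1+0#0))

  t#0 : t # 0#
  t#0 = #-congʳ (trans (monomial 0 2) (trans (*-identityˡ _) (*-congˡ (*-identityʳ t½))))
          (independent [ k.1# , 0 , 2 ] ((0 , 2) , 1+0#0))

  q* t* : K*
  q* = q , q#0
  t* = t , t#0

  qt : ℤ → ℤ → Carrier
  qt a b = q* ^ᶻ a * t* ^ᶻ b

  private
    t·t⁻ : t * inverse t#0 ≈ 1#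
    t·t⁻ = trans (*-congʳ (sym (x-0≈x t))) (proj₂ (proj₂ (#⇒invertible t#0)))

    1^ : ∀ b → 1# ^ b ≈ 1#
    1^ zero    = refl
    1^ (suc b) = trans (*-identityˡ _) (1^ b)

    t^·t^- : ∀ b → t ^ b * inverse t#0 ^ b ≈ 1#
    t^·t^- b = begin
      t ^ b * inverse t#0 ^ b  ≈⟨ ^-distrib-* t (inverse t#0) b ⟨
      (t * inverse t#0) ^ b    ≈⟨ ^-congˡ b t·t⁻ ⟩
      1# ^ b                   ≈⟨ 1^ b ⟩
      1#                       ∎

    1+0+0#0 : (k.1# k.+ (k.0# k.+ k.0#)) k.# k.0#
    1+0+0#0 = k.#-congʳ (k.sym (k.trans (k.+-congˡ (k.+-identityʳ k.0#)) (k.+-identityʳ k.1#))) k.1#0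

  -- The fractions of the theory all have denominators 1 - qᵃtᵇ with a > 0.
  1-qt#0 : ∀ {a} b → 0ℤ ℤ.< a → 1# - qt a b # 0#
  1-qt#0 {+ suc a} (+ b) (ℤ.+<+ _) = #-congʳ eq (independent p ((0 , 0) , 1+0+0#0))
    where
    p : Poly
    p = (k.1# , 0 , 0) ∷ (k.- k.1# , suc a , b ℕ.+ b) ∷ []
    eq : ⟦ p ⟧ₚ ≈ 1# - qt (+ suc a) (+ b)
    eq = trans (binomial 0 0 (suc a) (b ℕ.+ b))
               (+-cong (*-identityˡ 1#) (-‿cong (*-congˡ (t^ b))))
  1-qt#0 {+ suc a} -[1+ b ] (ℤ.+<+ _) =
    #-congʳ eq (x#0y#0→xy#0 (independent p ((0 , d) , p≠0)) (proj₂ ((t⁻ , t⁻#0) ^* suc b)))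
    where
    d = suc b ℕ.+ suc b
    p : Poly
    p = (k.1# , 0 , d) ∷ (k.- k.1# , suc a , 0) ∷ []
    t⁻ = inverse t#0
    p≠0 : coeff p (0 , d) k.# k.0#
    p≠0 rewrite dec-true (Product.≡-dec ℕ._≟_ ℕ._≟_ (0 , d) (0 , d)) ≡.refl = 1+0+0#0
    t⁻#0 : t⁻ # 0#
    t⁻#0 = invertibleˡ⇒# (t , trans (*-congˡ (x-0≈x t⁻)) t·t⁻)
    eq : ⟦ p ⟧ₚ * t⁻ ^ suc b ≈ 1# - qt (+ suc a) -[1+ b ]
    eq = begin
      ⟦ p ⟧ₚ * t⁻ ^ suc b
        ≈⟨ *-congʳ (binomial 0 d (suc a) 0) ⟩
      (1# * t½ ^ d - q ^ suc a * 1#) * t⁻ ^ suc b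
        ≈⟨ *-congʳ (+-cong (trans (*-identityˡ _) (t^ (suc b))) (-‿cong (*-identityʳ _))) ⟩
      (t ^ suc b - q ^ suc a) * t⁻ ^ suc b
        ≈⟨ distribʳ _ _ _ ⟩
      t ^ suc b * t⁻ ^ suc b + (- (q ^ suc a)) * t⁻ ^ suc b
        ≈⟨ +-cong (t^·t^- (suc b)) (sym (-‿distribˡ-* _ _)) ⟩
      1# - q ^ suc a * t⁻ ^ suc b ∎

-- The number of variables is n = suc m.
module Macdonald
  {c ℓ₁ ℓ₂ c′ ℓ₁′ ℓ₂′} {k : HeytingField c ℓ₁ ℓ₂} (K : RationalFunctionField k c′ ℓ₁′ ℓ₂′)
  (m : ℕ) where

  open RationalFunctionField K using (heytingField; commutativeRing; q)
  open HeytingField heytingField using (Carrier; _≈_; _#_; _+_; _*_; _-_; -_; 0#; 1#) public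
  open CommutativeRing commutativeRing using (semiring)
  open Exp semiring using (_^_) public
  open FieldOperations K public

  open Terms commutativeRing (Vec.≡-dec {n = suc m} ℤ._≟_) public
    renaming (TermList to Laurent)

  infix  4 _≈ᴸ_
  infixl 6 _+ᴸ_ _-ᴸ_
  infixl 7 _*ᴸ_
  infixr 7 _·_

  _≈ᴸ_ : Laurent → Laurent → Set ℓ₁′
  f ≈ᴸ g = ∀ α → coeff f α ≈ coeff g α

  _·_ : Carrier → Laurent → Laurent
  c · f = List.map (map₁ (c *_)) f

  _+ᴸ_ _-ᴸ_ _*ᴸ_ : Laurent → Laurent → Laurent
  f +ᴸ g = f ++ g
  f -ᴸ g = f ++ (- 1#) · g
  f *ᴸ g = cartesianProductWith (λ (c , α) (d , β) → c * d , Vec.zipWith ℤ._+_ α β) f g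

  x^_ : Vec ℤ (suc m) → Laurent
  x^ α = [ 1# , α ]

  x : Fin (suc m) → Laurent
  x i = x^ (Vec.replicate (suc m) 0ℤ [ i ]≔ 1ℤ)

  -- An index i ∈ {1,…,n-1} is given 0-based as i : Fin m; the positions i and i + 1 among the n
  -- variables are then `inject₁ i` and `suc i`.
  s : Fin m → Laurent → Laurent
  s i = List.map (map₂ (swap i))

  -- f(x₂,…,xₙ,q⁻¹x₁): the monomial x^α becomes x₂^α₁ ⋯ xₙ^αₙ₋₁ (q⁻¹x₁)^αₙ.
  rotate : Laurent → Laurent
  rotate = List.map λ (c , α) → c * q* ^ᶻ (ℤ.- Vec.last α) , Vec.last α ∷ Vec.init α

  -- g is the quotient ∂ᵢf = (f - sᵢf) / (xᵢ - xᵢ₊₁) in K[X]; it exists for every f, and is unique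
  -- because xᵢ - xᵢ₊₁ is not a zero divisor.
  _is-∂[_]_ : Laurent → Fin m → Laurent → Set ℓ₁′
  g is-∂[ i ] f = (x (inject₁ i) -ᴸ x (suc i)) *ᴸ g ≈ᴸ f -ᴸ s i f

  evaluate : (Fin (suc m) → K*) → Laurent → Carrier
  evaluate y []            = 0#
  evaluate y ((c , α) ∷ f) = c * prod (λ i → y i ^ᶻ lookup α i) + evaluate y f

  -- In E2 the two quotients ∂ᵢ(xᵢE) and ∂ᵢE are the (unique) ∂xE and ∂E.
  record IsMacdonaldFamily (E : Vec ℤ (suc m) → Laurent) : Set (c′ ⊔ ℓ₁′) where
    field
      E0 : E (Vec.replicate _ 0ℤ) ≈ᴸ x^ Vec.replicate _ 0ℤ
      E1 : ∀ μ → E (Vec.last μ ℤ.+ 1ℤ ∷ Vec.init μ)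
                   ≈ᴸ q* ^ᶻ Vec.last μ · (x zero *ᴸ rotate (E μ))
      E2 : ∀ (μ : Vec ℕ (suc m)) i (μᵢ>μᵢ₊₁ : lookup μ (inject₁ i) ℕ.> lookup μ (suc i)) →
           let μᵢ    = lookup μ (inject₁ i)
               μᵢ₊₁  = lookup μ (suc i)
               e     = + v ⌜ μ ⌝ (inject₁ i) ℤ.- + v ⌜ μ ⌝ (suc i)
               a     = qt (+ μᵢ ℤ.- + μᵢ₊₁) e
           in ∃₂ λ ∂xE ∂E →
                ∂xE is-∂[ i ] (x (inject₁ i) *ᴸ E ⌜ μ ⌝)
              × ∂E  is-∂[ i ] E ⌜ μ ⌝
              × E (swap i ⌜ μ ⌝)
                  ≈ᴸ ∂xE -ᴸ t · (x (inject₁ i) *ᴸ ∂E)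
                     +ᴸ ((1# - t) * a / (1# - a) by 1-qt#0 e (m>n⇒0<m-n μᵢ>μᵢ₊₁)) · E ⌜ μ ⌝
      E3 : ∀ μ → E (Vec.map (ℤ._- 1ℤ) μ) ≈ᴸ x^ Vec.replicate _ -1ℤ *ᴸ E μ

  ∏□ : (μ : Vec ℕ (suc m)) → (∀ r c → c ℕ.≤ lookup μ r → Carrier) → Carrier
  ∏□ μ f = prod λ r → prod {lookup μ r} λ j → f r (suc (toℕ j)) (Fin.toℕ<n j)

{-# OPTIONS --safe #-}

-- Functions are evaluated at the points with coordinates q⁻ᵃtᵇ and pairwise distinct b.  There act
-- the Demazure–Lusztig operators Tᵢ, the rotation g, and the Cherednik operators
--   Yᵢ = Tᵢ₋₁ ⋯ T₁ g Sₙ₋₁ ⋯ Sᵢ,   Sᵢ = t Tᵢ⁻¹.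
-- E1 and E2 build E_μ from 1 by τ = x₁g and by the intertwiners Tᵢ + const, so by induction
-- Yᵢ E_μ = q^(-μᵢ) t^(n - v_μ(i)) E_μ for all i.  At ρ = (1, t, …, tⁿ⁻¹) every Tᵢ drops out, and the
-- equation for Yₙ = Tₙ₋₁ ⋯ T₁ g becomes E_μ(gρ) = q^(-μₙ) t^(n - v_μ(n)) E_μ(ρ).  Hence E1 multiplies
-- the value at ρ by t^#{r : μᵣ > μₙ}, while E2 multiplies it by (1 - ta)/(1 - a).  The product
-- formula obeys the same two recursions, n(λ) being the sum of min(μᵣ, μₛ) over the pairs r < s.

module Submission where

open import Defs
open import Algebra.Apartness.Bundles using (HeytingField)
import Algebra.Apartness.Properties.HeytingCommutativeRing as HeytingProperties
open import Algebra.Bundles using (CommutativeRing)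
import Algebra.Morphism.Structures as Morphisms
import Algebra.Properties.AbelianGroup as AbelianGroupProperties
import Algebra.Properties.CommutativeMonoid.Sum as BigOperator
import Algebra.Properties.CommutativeSemiring.Exp as CommExp
import Algebra.Properties.Group as GroupProperties
import Algebra.Properties.Ring as RingProperties
import Algebra.Properties.Semiring.Exp as Exp
import Algebra.Properties.Semiring.Mult as Mult
import Algebra.Solver.Ring as RingSolver
open import Algebra.Solver.Ring.AlmostCommutativeRing using (fromCommutativeRing; _-Raw-AlmostCommutative⟶_)
open import Data.Bool.Base using (Bool; true; false; if_then_else_; _∧_)
open import Data.Fin.Base as Fin using (Fin; zero; suc; toℕ; inject₁; fromℕ)
import Data.Fin.Induction as Fin
import Data.Fin.Properties as Fin
open import Data.Integer.Base as ℤ using (ℤ; +_; -[1+_]; _⊖_; 0ℤ; 1ℤ)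
import Data.Integer.Properties as ℤ
open import Data.Integer.Solver using () renaming (module +-*-Solver to ℤ-Solver)
open import Data.List.Base as List using (List; []; _∷_; _++_; foldr)
import Data.List.Properties as List
open import Data.List.Relation.Binary.Permutation.Propositional as Permutation using (_↭_)
import Data.List.Relation.Binary.Permutation.Propositional.Properties as ↭
open import Data.List.Relation.Unary.All as ListAll using (All; []; _∷_)
import Data.List.Relation.Unary.All.Properties as ListAll
open import Data.Maybe.Base using (Maybe; just; nothing)
open import Data.Nat.Base as ℕ using (ℕ; zero; suc; s≤s; z≤n)
open import Data.Nat.ListAction using (sum)
open import Data.Nat.ListAction.Properties using (sum-↭)
import Data.Nat.Properties as ℕ
open import Data.Nat.Solver using () renaming (module +-*-Solver to ℕ-Solver)
open import Data.Product.Base using (∃; _×_; _,_; proj₁; proj₂)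
import Data.Product.Properties as Product
open import Data.Sum.Base using (inj₁; inj₂)
open import Data.Vec.Base as Vec using (Vec; []; _∷_; _∷ʳ_; lookup; tabulate; count; _[_]≔_)
import Data.Vec.Properties as Vec
open import Data.Vec.Relation.Unary.All as VecAll using () renaming (All to Allᵛ; [] to []ᵃ; _∷_ to _∷ᵃ_)
open import Data.Vec.Relation.Unary.AllPairs using (AllPairs; []; _∷_)
import Data.Vec.Relation.Unary.AllPairs.Properties as AllPairs
open import Function.Base using (_∘_)
open import Level using (_⊔_) renaming (suc to lsuc)
open import Relation.Binary.Bundles using (Setoid)
open import Relation.Binary.Core using (Rel)
open import Relation.Binary.Definitions using (Symmetric; tri<; tri≈; tri>)
open import Relation.Binary.PropositionalEquality as ≡ using (_≡_; _≢_)
import Relation.Binary.Reasoning.Setoid as SetoidReasoning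
open import Relation.Nullary.Decidable using (Dec; yes; no; does; dec-true; dec-false; _×-dec_)
open import Relation.Nullary.Negation using (contradiction)
open import Relation.Unary using (Pred; Decidable)

-- The operators divide by xᵢ - xᵢ₊₁. For Laurent polynomials E2 only asserts that the quotients
-- exist; for functions the division takes place in the field, pointwise, as long as the coordinates
-- of a point stay apart. This dictates the points: they must include ρ and be stable under
-- exchanges and under x₁ ↦ q⁻¹x₁, and two coordinates with different exponents of t have an
-- invertible difference however often either has been divided by q. An identity of functions on
-- these points contains the value at ρ, which is all that is asked for. The value at ρ cannot be
-- followed through E1 by itself, since E1 leads to the other point gρ; hence the induction carries
-- eigenvalue equations as well. It carries all of them because E1 shifts and E2 exchanges their
-- indices. Using Sᵢ in place of Tᵢ⁻¹ keeps division by t out, so that the Hecke relations become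
-- polynomial identities in the coefficients of the Tᵢ.

-- Identities with integer coefficients in a commutative ring

module IntegerRingSolver {c ℓ} (R : CommutativeRing c ℓ) where
  open CommutativeRing R
  open RingProperties ring using (-‿distribˡ-*; -‿distribʳ-*; -‿involutive; -0#≈0#)
  open GroupProperties +-group using (x≈y⇒x∙y⁻¹≈ε)
  open AbelianGroupProperties +-abelianGroup using (⁻¹-∙-comm)
  open Mult semiring renaming (_×_ to _×ₘ_) using (×-homo-+; ×1-homo-*)
  open SetoidReasoning setoid

  ⟦_⟧ℤ : ℤ → Carrier
  ⟦ + n      ⟧ℤ = n ×ₘ 1#
  ⟦ -[1+ n ] ⟧ℤ = - (suc n ×ₘ 1#)

  ⊖-homo : ∀ m n → ⟦ m ⊖ n ⟧ℤ ≈ m ×ₘ 1# - n ×ₘ 1#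
  ⊖-homo zero    zero    = sym (-‿inverseʳ 0#)
  ⊖-homo zero    (suc n) = sym (+-identityˡ _)
  ⊖-homo (suc m) zero    = sym (trans (+-congˡ -0#≈0#) (+-identityʳ _))
  ⊖-homo (suc m) (suc n) rewrite ℤ.[1+m]⊖[1+n]≡m⊖n m n = begin
    ⟦ m ⊖ n ⟧ℤ                            ≈⟨ ⊖-homo m n ⟩
    m ×ₘ 1# - n ×ₘ 1#                       ≈⟨ +-identityˡ _ ⟨
    0# + (m ×ₘ 1# - n ×ₘ 1#)                ≈⟨ +-congʳ (-‿inverseʳ 1#) ⟨
    1# - 1# + (m ×ₘ 1# - n ×ₘ 1#)           ≈⟨ +-assoc _ _ _ ⟩
    1# + (- 1# + (m ×ₘ 1# - n ×ₘ 1#))       ≈⟨ +-congˡ (+-comm _ _) ⟩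
    1# + (m ×ₘ 1# - n ×ₘ 1# - 1#)           ≈⟨ +-congˡ (+-assoc _ _ _) ⟩
    1# + (m ×ₘ 1# + (- (n ×ₘ 1#) - 1#))     ≈⟨ +-congˡ (+-congˡ (+-comm _ _)) ⟩
    1# + (m ×ₘ 1# + (- 1# - n ×ₘ 1#))       ≈⟨ +-congˡ (+-congˡ (⁻¹-∙-comm 1# (n ×ₘ 1#))) ⟩
    1# + (m ×ₘ 1# - (1# + n ×ₘ 1#))         ≈⟨ +-assoc _ _ _ ⟨
    1# + m ×ₘ 1# - (1# + n ×ₘ 1#)           ∎

  -ℤ-homo : ∀ i → ⟦ ℤ.- i ⟧ℤ ≈ - ⟦ i ⟧ℤ
  -ℤ-homo (+ zero)  = sym -0#≈0#
  -ℤ-homo (+ suc n) = refl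
  -ℤ-homo -[1+ n ]  = sym (-‿involutive _)

  +ℤ-homo : ∀ i j → ⟦ i ℤ.+ j ⟧ℤ ≈ ⟦ i ⟧ℤ + ⟦ j ⟧ℤ
  +ℤ-homo (+ m)    (+ n)    = ×-homo-+ 1# m n
  +ℤ-homo (+ m)    -[1+ n ] = ⊖-homo m (suc n)
  +ℤ-homo -[1+ m ] (+ n)    = trans (⊖-homo n (suc m)) (+-comm _ _)
  +ℤ-homo -[1+ m ] -[1+ n ] = begin
    - (suc (suc (m ℕ.+ n)) ×ₘ 1#)       ≡⟨ ≡.cong (λ k → - (suc k ×ₘ 1#)) (ℕ.+-suc m n) ⟨
    - ((suc m ℕ.+ suc n) ×ₘ 1#)         ≈⟨ -‿cong (×-homo-+ 1# (suc m) (suc n)) ⟩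
    - (suc m ×ₘ 1# + suc n ×ₘ 1#)        ≈⟨ ⁻¹-∙-comm _ _ ⟨
    - (suc m ×ₘ 1#) - (suc n ×ₘ 1#)      ∎

  *ℤ-homo⁺ : ∀ m j → ⟦ + m ℤ.* j ⟧ℤ ≈ m ×ₘ 1# * ⟦ j ⟧ℤ
  *ℤ-homo⁺ m (+ n)    rewrite ≡.sym (ℤ.pos-* m n) = ×1-homo-* m n
  *ℤ-homo⁺ m -[1+ n ] rewrite ≡.sym (ℤ.neg-distribʳ-* (+ m) (+ suc n)) | ≡.sym (ℤ.pos-* m (suc n)) = begin
    ⟦ ℤ.- + (m ℕ.* suc n) ⟧ℤ       ≈⟨ -ℤ-homo (+ (m ℕ.* suc n)) ⟩
    - ((m ℕ.* suc n) ×ₘ 1#)         ≈⟨ -‿cong (×1-homo-* m (suc n)) ⟩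
    - (m ×ₘ 1# * (suc n ×ₘ 1#))      ≈⟨ -‿distribʳ-* _ _ ⟩
    m ×ₘ 1# * - (suc n ×ₘ 1#)        ∎

  *ℤ-homo : ∀ i j → ⟦ i ℤ.* j ⟧ℤ ≈ ⟦ i ⟧ℤ * ⟦ j ⟧ℤ
  *ℤ-homo (+ m)    j = *ℤ-homo⁺ m j
  *ℤ-homo -[1+ m ] j rewrite ≡.sym (ℤ.neg-distribˡ-* (+ suc m) j) = begin
    ⟦ ℤ.- (+ suc m ℤ.* j) ⟧ℤ   ≈⟨ -ℤ-homo (+ suc m ℤ.* j) ⟩
    - ⟦ + suc m ℤ.* j ⟧ℤ       ≈⟨ -‿cong (*ℤ-homo⁺ (suc m) j) ⟩
    - (suc m ×ₘ 1# * ⟦ j ⟧ℤ)    ≈⟨ -‿distribˡ-* _ _ ⟩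
    - (suc m ×ₘ 1#) * ⟦ j ⟧ℤ    ∎

  -- `⟦ + 1 ⟧ℤ` unfolds to `1# + 0#`. The separate clause makes the constant 1 denote `1#` itself,
  -- so that solved equations match goals in which `1#` occurs.
  embed : ℤ → Carrier
  embed (+ 1) = 1#
  embed i     = ⟦ i ⟧ℤ

  embed≈⟦⟧ℤ : ∀ i → embed i ≈ ⟦ i ⟧ℤ
  embed≈⟦⟧ℤ (+ 0)           = refl
  embed≈⟦⟧ℤ (+ 1)           = sym (+-identityʳ 1#)
  embed≈⟦⟧ℤ (+ suc (suc n)) = refl
  embed≈⟦⟧ℤ -[1+ n ]        = refl

  ℤ-morphism : ℤ.+-*-rawRing -Raw-AlmostCommutative⟶ fromCommutativeRing R
  ℤ-morphism = record
    { ⟦_⟧    = embed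
    ; +-homo = λ i j → trans (embed≈⟦⟧ℤ (i ℤ.+ j)) (trans (+ℤ-homo i j) (sym (+-cong (embed≈⟦⟧ℤ i) (embed≈⟦⟧ℤ j))))
    ; *-homo = λ i j → trans (embed≈⟦⟧ℤ (i ℤ.* j)) (trans (*ℤ-homo i j) (sym (*-cong (embed≈⟦⟧ℤ i) (embed≈⟦⟧ℤ j))))
    ; -‿homo = λ i → trans (embed≈⟦⟧ℤ (ℤ.- i)) (trans (-ℤ-homo i) (sym (-‿cong (embed≈⟦⟧ℤ i))))
    ; 0-homo = refl
    ; 1-homo = refl
    }

  _≟ℤ_ : ∀ i j → Maybe (embed i ≈ embed j)
  i ≟ℤ j with i ℤ.≟ j
  ... | yes ≡.refl = just refl
  ... | no _       = nothing

  open RingSolver ℤ.+-*-rawRing (fromCommutativeRing R) ℤ-morphism _≟ℤ_ public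
    using (solve; _:=_; _:+_; _:-_; _:*_; :-_; con; Polynomial)

  1: 0: : ∀ {n} → Polynomial n
  1: = con (+ 1)
  0: = con (+ 0)

  -- The solver proves unconditional identities only. A hypothesis enters through a cofactor `a`:
  -- nested uses of `modulo`, in the order of the added terms, certify that x - y lies in the ideal
  -- generated by the hypotheses.
  modulo : ∀ {x y u u′} → u ≈ u′ → ∀ {a} → x ≈ y + a * (u - u′) → x ≈ y
  modulo {y = y} u≈u′ eq =
    trans eq (trans (+-congˡ (trans (*-congˡ (x≈y⇒x∙y⁻¹≈ε u≈u′)) (zeroʳ _))) (+-identityʳ y))

-- Data for a Hecke action on functions of points

record HeckeData {c ℓ} (R : CommutativeRing c ℓ) : Set (c ⊔ ℓ ⊔ lsuc Level.zero) where
  open CommutativeRing R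
  field
    Point   : Set
    _⊥_     : Rel Point Level.zero
    ⊥-sym   : Symmetric _⊥_
    shift   : Point → Point
    shift-⊥ : ∀ {a b} → a ⊥ b → a ⊥ shift b
    val     : Point → Carrier
    t q⁻¹   : Carrier
    -- The intended value is σ a / (a - b) for coordinates a and b, the coefficient of the identity
    -- in the Demazure-Lusztig operator.
    A       : Point → Point → Carrier

  σ : Carrier
  σ = 1# - t

  field
    val-shift : ∀ a → val (shift a) ≈ q⁻¹ * val a
    -- `A-swap` yields the quadratic relation, `A-val` the commutation with the variables,
    -- `A-triple` together with `A-swap` the braid relation, and `A-shift`, homogeneity of degree 0,
    -- the compatibility with the rotation.
    A-swap    : ∀ {a b} → a ⊥ b → A a b + A b a ≈ σ
    A-val     : ∀ {a b} → a ⊥ b → A a b * (val a - val b) ≈ σ * val a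
    A-triple  : ∀ {a b c} → a ⊥ b → b ⊥ c → a ⊥ c → A a b * A b c ≈ A a c * (A a b + A b c - σ)
    A-shift   : ∀ {a b} → a ⊥ b → A (shift a) (shift b) ≈ A a b

-- Demazure-Lusztig operators and their relations

module Hecke {c ℓ} (R : CommutativeRing c ℓ) (D : HeckeData R) where
  open CommutativeRing R hiding (zero)
  open HeckeData D
  open IntegerRingSolver R
  open Exp semiring using (_^_)

  private
    variable
      n : ℕ

  V : ℕ → Set c
  V n = Vec Point n → Carrier

  Distinct : Vec Point n → Set
  Distinct = AllPairs _⊥_

  infix 4 _≋_ _≗_

  -- Linearity and commutation of distant operators hold at every point, while relations that depend
  -- on the values of `A` hold at distinct points only. Hence two equalities.
  _≗_ _≋_ : V n → V n → Set ℓ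
  F ≗ G = ∀ y → F y ≈ G y
  F ≋ G = ∀ {y} → Distinct y → F y ≈ G y

  V-setoid : ℕ → Setoid c ℓ
  V-setoid n = record
    { Carrier = V n
    ; _≈_ = _≋_
    ; isEquivalence = record
      { refl = λ _ → refl ; sym = λ e d → sym (e d) ; trans = λ e e′ d → trans (e d) (e′ d) }
    }

  swap-all : ∀ {p} {P : Point → Set p} i {y : Vec Point (suc n)} → Allᵛ P y → Allᵛ P (swap i y)
  swap-all zero    (px ∷ᵃ py ∷ᵃ ps) = py ∷ᵃ px ∷ᵃ ps
  swap-all (suc i) (px ∷ᵃ ps)       = px ∷ᵃ swap-all i ps

  swap-distinct : ∀ i {y : Vec Point (suc n)} → Distinct y → Distinct (swap i y)
  swap-distinct zero    ((x⊥y ∷ᵃ x⊥) ∷ y⊥ ∷ ds) = (⊥-sym x⊥y ∷ᵃ y⊥) ∷ x⊥ ∷ ds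
  swap-distinct (suc i) (x⊥ ∷ ds)               = swap-all i x⊥ ∷ swap-distinct i ds

  coef : Fin n → V (suc n)
  coef zero    (a ∷ b ∷ _) = A a b
  coef (suc i) (_ ∷ y)     = coef i y

  -- `H e` is `T` - e. Facts valid for every e, or for every e with e² = eσ, serve `T` and `S` at
  -- once.
  H : Carrier → Fin n → V (suc n) → V (suc n)
  H e i F y = (coef i y - e) * F y + (1# - coef i y) * F (swap i y)

  T S : Fin n → V (suc n) → V (suc n)
  T = H 0#
  S = H σ

  infixl 6 _⊕_
  infixr 7 _⊛_

  _⊕_ : V n → V n → V n
  (F ⊕ G) y = F y + G y

  _⊛_ : Carrier → V n → V n
  (e ⊛ F) y = e * F y

  H-cong : ∀ e i {F G : V (suc n)} → F ≋ G → H e i F ≋ H e i G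
  H-cong e i F≋G d = +-cong (*-congˡ (F≋G d)) (*-congˡ (F≋G (swap-distinct i d)))

  H-cong′ : ∀ e i {F G : V (suc n)} → F ≗ G → H e i F ≗ H e i G
  H-cong′ e i F≗G y = +-cong (*-congˡ (F≗G y)) (*-congˡ (F≗G (swap i y)))

  H-linear : ∀ e i a (F G : V (suc n)) → H e i (F ⊕ a ⊛ G) ≗ H e i F ⊕ a ⊛ H e i G
  H-linear e i a F G y = solve 7 (λ p p′ a f f′ g g′ →
    p :* (f :+ a :* g) :+ p′ :* (f′ :+ a :* g′)
      := p :* f :+ p′ :* f′ :+ a :* (p :* g :+ p′ :* g′))
    refl (coef i y - e) (1# - coef i y) a (F y) (F (swap i y)) (G y) (G (swap i y))

  H-scale : ∀ e i a (F : V (suc n)) → H e i (a ⊛ F) ≗ a ⊛ H e i F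
  H-scale e i a F y = solve 5 (λ p p′ a f f′ →
    p :* (a :* f) :+ p′ :* (a :* f′) := a :* (p :* f :+ p′ :* f′))
    refl (coef i y - e) (1# - coef i y) a (F y) (F (swap i y))

  word-cong : ∀ e (w : List (Fin n)) {F G : V (suc n)} → F ≋ G → foldr (H e) F w ≋ foldr (H e) G w
  word-cong e []      F≋G = F≋G
  word-cong e (i ∷ w) F≋G = H-cong e i (word-cong e w F≋G)

  word-cong′ : ∀ e (w : List (Fin n)) {F G : V (suc n)} → F ≗ G → foldr (H e) F w ≗ foldr (H e) G w
  word-cong′ e []      F≗G = F≗G
  word-cong′ e (i ∷ w) F≗G = H-cong′ e i (word-cong′ e w F≗G)

  word-linear : ∀ e (w : List (Fin n)) a (F G : V (suc n)) →
                foldr (H e) (F ⊕ a ⊛ G) w ≗ foldr (H e) F w ⊕ a ⊛ foldr (H e) G w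
  word-linear e []      a F G y = refl
  word-linear e (i ∷ w) a F G y = trans (H-cong′ e i (word-linear e w a F G) y)
    (H-linear e i a (foldr (H e) F w) (foldr (H e) G w) y)

  word-scale : ∀ e (w : List (Fin n)) a (F : V (suc n)) →
               foldr (H e) (a ⊛ F) w ≗ a ⊛ foldr (H e) F w
  word-scale e []      a F y = refl
  word-scale e (i ∷ w) a F y = trans (H-cong′ e i (word-scale e w a F) y) (H-scale e i a (foldr (H e) F w) y)

  -- Shifted letters leave the first coordinate alone, so it can be frozen. This is how inductions
  -- on the number of variables descend.
  word-suc : ∀ e (w : List (Fin n)) F x (y : Vec Point (suc n)) →
             foldr (H e) F (List.map suc w) (x ∷ y) ≈ foldr (H e) (F ∘ (x ∷_)) w y
  word-suc e []      F x y = refl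
  word-suc e (i ∷ w) F x y = H-cong′ e i (word-suc e w F x) y

  commute : ∀ e e′ (i j : Fin n) (F : V (suc n)) → suc (toℕ i) ℕ.< toℕ j →
            H e i (H e′ j F) ≗ H e′ j (H e i F)
  commute e e′ zero (suc zero) F (s≤s ()) _
  commute e e′ zero (suc (suc j)) F _ (a ∷ b ∷ y) = solve 9 (λ p e r e′ f₁ f₂ f₃ f₄ x →
    (p :- e) :* ((r :- e′) :* f₁ :+ (x :- r) :* f₂) :+ (x :- p) :* ((r :- e′) :* f₃ :+ (x :- r) :* f₄)
      := (r :- e′) :* ((p :- e) :* f₁ :+ (x :- p) :* f₃) :+ (x :- r) :* ((p :- e) :* f₂ :+ (x :- p) :* f₄))
    refl (A a b) e (coef j y) e′ (F (a ∷ b ∷ y)) (F (a ∷ b ∷ swap j y)) (F (b ∷ a ∷ y)) (F (b ∷ a ∷ swap j y)) 1#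
  commute e e′ (suc i) (suc j) F (s≤s i<j) (x ∷ y) = commute e e′ i j (F ∘ (x ∷_)) i<j y

  word-commute-above : ∀ e e′ (i : Fin n) w (F : V (suc n)) → All (λ j → suc (toℕ i) ℕ.< toℕ j) w →
                       foldr (H e) (H e′ i F) w ≗ H e′ i (foldr (H e) F w)
  word-commute-above e e′ i []      F []         y = refl
  word-commute-above e e′ i (j ∷ w) F (i<j ∷ ps) y =
    trans (H-cong′ e j (word-commute-above e e′ i w F ps) y)
      (sym (commute e′ e i j (foldr (H e) F w) i<j y))

  word-commute-below : ∀ e e′ (i : Fin n) w (F : V (suc n)) → All (λ j → suc (toℕ j) ℕ.< toℕ i) w →
                       foldr (H e) (H e′ i F) w ≗ H e′ i (foldr (H e) F w)
  word-commute-below e e′ i []      F []         y = refl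
  word-commute-below e e′ i (j ∷ w) F (j<i ∷ ps) y =
    trans (H-cong′ e j (word-commute-below e e′ i w F ps) y)
      (commute e e′ j i (foldr (H e) F w) j<i y)

  -- T satisfies T² = σT + t, so S = T - σ is t times its inverse.
  ST : ∀ (i : Fin n) F → S i (T i F) ≋ t ⊛ F
  ST zero F {a ∷ b ∷ y} ((a⊥b ∷ᵃ _) ∷ _) = modulo (A-swap a⊥b)
    (solve 5 (λ p p′ t f f′ →
      (p :- (1: :- t)) :* ((p :- 0:) :* f :+ (1: :- p) :* f′)
          :+ (1: :- p) :* ((p′ :- 0:) :* f′ :+ (1: :- p′) :* f)
        := t :* f :+ (1: :- p) :* (f′ :- f) :* (p :+ p′ :- (1: :- t)))
      refl (A a b) (A b a) t (F (a ∷ b ∷ y)) (F (b ∷ a ∷ y)))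
  ST (suc i) F {x ∷ y} (_ ∷ d) = ST i (F ∘ (x ∷_)) d

  TS : ∀ (i : Fin n) F → T i (S i F) ≋ t ⊛ F
  TS zero F {a ∷ b ∷ y} ((a⊥b ∷ᵃ _) ∷ _) = modulo (A-swap a⊥b)
    (solve 5 (λ p p′ t f f′ →
      (p :- 0:) :* ((p :- (1: :- t)) :* f :+ (1: :- p) :* f′)
          :+ (1: :- p) :* ((p′ :- (1: :- t)) :* f′ :+ (1: :- p′) :* f)
        := t :* f :+ (1: :- p) :* (f′ :- f) :* (p :+ p′ :- (1: :- t)))
      refl (A a b) (A b a) t (F (a ∷ b ∷ y)) (F (b ∷ a ∷ y)))
  TS (suc i) F {x ∷ y} (_ ∷ d) = TS i (F ∘ (x ∷_)) d

  T≗S : ∀ (i : Fin n) F → T i F ≗ S i F ⊕ σ ⊛ F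
  T≗S i F y = solve 4 (λ p s f f′ → (p :- 0:) :* f :+ (1: :- p) :* f′
    := (p :- s) :* f :+ (1: :- p) :* f′ :+ s :* f) refl (coef i y) σ (F y) (F (swap i y))

  -- Expand with `H e` = `T` - e: after the braid relation for `T` and T² = σT + t, the two sides
  -- differ by e² - eσ times `T (suc zero)` - `T zero`. The value e = 0 is the ordinary braid
  -- relation; e = σ is the version in which two of the operators are inverted.
  braid : ∀ e → e * e ≈ e * σ → ∀ (F : V (suc (suc (suc n)))) →
          H e (suc zero) (H e zero (T (suc zero) F)) ≋ T zero (H e (suc zero) (H e zero F))
  braid e e² F {a ∷ b ∷ c ∷ y} ((a⊥b ∷ᵃ a⊥c ∷ᵃ _) ∷ (b⊥c ∷ᵃ _) ∷ _) =
    modulo (A-swap a⊥b) (modulo (A-swap b⊥c) (modulo (A-triple a⊥b b⊥c a⊥c) (modulo e²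
      (solve 13 (λ p q r p′ q′ s e abc bac acb bca cab cba →
        (q :- e) :* ((p :- e) :* ((q :- 0:) :* abc :+ (1: :- q) :* acb)
                      :+ (1: :- p) :* ((r :- 0:) :* bac :+ (1: :- r) :* bca))
          :+ (1: :- q) :* ((r :- e) :* ((q′ :- 0:) :* acb :+ (1: :- q′) :* abc)
                      :+ (1: :- r) :* ((p :- 0:) :* cab :+ (1: :- p) :* cba))
        := (p :- 0:) :* ((q :- e) :* ((p :- e) :* abc :+ (1: :- p) :* bac)
                      :+ (1: :- q) :* ((r :- e) :* acb :+ (1: :- r) :* cab))
          :+ (1: :- p) :* ((r :- e) :* ((p′ :- e) :* bac :+ (1: :- p′) :* abc)
                      :+ (1: :- r) :* ((q :- e) :* bca :+ (1: :- q) :* cba))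
          :+ (:- ((1: :- p) :* (r :- e) :* (bac :- abc))) :* (p :+ p′ :- s)
          :+ (1: :- q) :* (r :- e) :* (acb :- abc) :* (q :+ q′ :- s)
          :+ (:- ((p :- q) :* abc :+ (1: :- p) :* bac :- (1: :- q) :* acb)) :* (p :* q :- r :* (p :+ q :- s))
          :+ (q :* abc :+ (1: :- q) :* acb :- (p :* abc :+ (1: :- p) :* bac)) :* (e :* e :- e :* s))
        refl (A a b) (A b c) (A a c) (A b a) (A c b) σ e (F (a ∷ b ∷ c ∷ y)) (F (b ∷ a ∷ c ∷ y))
          (F (a ∷ c ∷ b ∷ y)) (F (b ∷ c ∷ a ∷ y)) (F (c ∷ a ∷ b ∷ y)) (F (c ∷ b ∷ a ∷ y))))))

  -- Words of the Cherednik operators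

  -- `down i` is i - 1, ..., 0 and `up i` is n - 1, ..., i. Under `foldr` the last letter acts
  -- first, so a final `zero` splits off as the innermost operator and the shifted rest acts on the
  -- tail of the point.
  down up : Fin (suc n) → List (Fin n)
  down             zero    = []
  down {n = suc n} (suc i) = List.map suc (down i) ++ zero ∷ []
  up {n = zero}  zero    = []
  up {n = suc n} zero    = List.map suc (up zero) ++ zero ∷ []
  up {n = suc n} (suc i) = List.map suc (up i)

  -- With `up-inject₁`: the words of neighbouring indices differ by an outermost letter of `down`
  -- and an innermost letter of `up`. The common remainder becomes the operator `W` of the
  -- intertwining relations.
  down-suc : ∀ (j : Fin n) → down (suc j) ≡.≡ j ∷ down (inject₁ j)
  down-suc zero    = ≡.refl
  down-suc (suc j) = ≡.cong (λ w → List.map suc w ++ zero ∷ []) (down-suc j)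

  up-inject₁ : ∀ (j : Fin n) → up (inject₁ j) ≡.≡ up (suc j) ++ j ∷ []
  up-inject₁ zero    = ≡.refl
  up-inject₁ (suc j) = ≡.trans (≡.cong (List.map suc) (up-inject₁ j)) (List.map-++ suc (up (suc j)) (j ∷ []))

  down-below : ∀ (i : Fin (suc n)) → All (λ j → toℕ j ℕ.< toℕ i) (down i)
  down-below zero                = []
  down-below {n = suc n} (suc i) = ListAll.++⁺ (ListAll.map⁺ (ListAll.map s≤s (down-below i))) (s≤s z≤n ∷ [])

  up-above : ∀ (i : Fin (suc n)) → All (λ j → toℕ i ℕ.≤ toℕ j) (up i)
  up-above i@zero              = ListAll.universal (λ _ → z≤n) (up i)
  up-above {n = suc n} (suc i) = ListAll.map⁺ (ListAll.map s≤s (up-above i))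

  up-fromℕ : ∀ n → up (fromℕ n) ≡.≡ []
  up-fromℕ zero    = ≡.refl
  up-fromℕ (suc n) = ≡.cong (List.map suc) (up-fromℕ n)

  length-up : ∀ (i : Fin (suc n)) → toℕ i ℕ.+ List.length (up i) ≡.≡ n
  length-up {n = zero}  zero    = ≡.refl
  length-up {n = suc n} zero    = ≡.trans (List.length-++ (List.map suc (up {n} zero)))
    (≡.trans (ℕ.+-comm _ 1) (≡.cong suc (≡.trans (List.length-map suc (up {n} zero)) (length-up {n} zero))))
  length-up {n = suc n} (suc i) = ≡.cong suc (≡.trans (≡.cong (toℕ i ℕ.+_) (List.length-map suc (up i)))
    (length-up i))

  -- Moving outwards, the operator of index j + 1 commutes with the letters below j, is turned into
  -- that of index j by the braid relation at the letters j + 1, j, and then commutes with the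
  -- letters above j + 1.
  down-braid : ∀ (i : Fin (suc (suc n))) (j : Fin n) F → suc (toℕ j) ℕ.< toℕ i →
               foldr T (T (suc j) F) (down i) ≋ T (inject₁ j) (foldr T F (down i))
  down-braid (suc zero) j F (s≤s ())
  down-braid (suc (suc i)) zero F _ {x ∷ y} d = begin
    foldr T (T 1F F) (down (suc (suc i))) (x ∷ y)
      ≡⟨ ≡.cong (λ G → G (x ∷ y)) (unfold (T 1F F)) ⟩
    foldr T (T 1F (T 0F (T 1F F))) (List.map suc (List.map suc (down i))) (x ∷ y)
      ≈⟨ word-cong 0# (List.map suc (List.map suc (down i))) (braid 0# (trans (zeroˡ _) (sym (zeroˡ _))) F) d ⟩
    foldr T (T 0F (T 1F (T 0F F))) (List.map suc (List.map suc (down i))) (x ∷ y)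
      ≈⟨ word-commute-above 0# 0# 0F _ (T 1F (T 0F F))
           (ListAll.map⁺ (ListAll.map⁺ (ListAll.universal (λ _ → s≤s (s≤s z≤n)) (down i)))) (x ∷ y) ⟩
    T 0F (foldr T (T 1F (T 0F F)) (List.map suc (List.map suc (down i)))) (x ∷ y)
      ≡⟨ ≡.cong (λ G → T 0F G (x ∷ y)) (unfold F) ⟨
    T 0F (foldr T F (down (suc (suc i)))) (x ∷ y) ∎
    where
    open SetoidReasoning setoid
    0F = zero
    1F = suc zero
    unfold : ∀ F → foldr T F (down (suc (suc i))) ≡.≡ foldr T (T 1F (T 0F F))
      (List.map suc (List.map suc (down i)))
    unfold F = ≡.trans (List.foldr-∷ʳ T F zero (List.map suc (down (suc i))))
      (≡.trans (≡.cong (foldr T (T 0F F)) (List.map-++ suc (List.map suc (down i)) (zero ∷ [])))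
        (List.foldr-∷ʳ T (T 0F F) 1F (List.map suc (List.map suc (down i)))))
  down-braid {n = suc n} (suc i) (suc j) F (s≤s j<i) {x ∷ y} d@(_ ∷ d′) = begin
    foldr T (T (suc (suc j)) F) (down (suc i)) (x ∷ y)
      ≡⟨ ≡.cong (λ G → G (x ∷ y)) (List.foldr-∷ʳ T (T (suc (suc j)) F) zero (List.map suc (down i))) ⟩
    foldr T (T zero (T (suc (suc j)) F)) (List.map suc (down i)) (x ∷ y)
      ≈⟨ word-cong′ 0# (List.map suc (down i)) (commute 0# 0# zero (suc (suc j)) F (s≤s (s≤s z≤n))) (x ∷ y) ⟩
    foldr T (T (suc (suc j)) (T zero F)) (List.map suc (down i)) (x ∷ y)
      ≈⟨ word-suc 0# (down i) (T (suc (suc j)) (T zero F)) x y ⟩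
    foldr T (T (suc j) (T zero F ∘ (x ∷_))) (down i) y
      ≈⟨ down-braid i j (T zero F ∘ (x ∷_)) j<i d′ ⟩
    T (inject₁ j) (foldr T (T zero F ∘ (x ∷_)) (down i)) y
      ≈⟨ H-cong′ 0# (inject₁ j) (word-suc 0# (down i) (T zero F) x) y ⟨
    T (inject₁ (suc j)) (foldr T (T zero F) (List.map suc (down i))) (x ∷ y)
      ≡⟨ ≡.cong (λ G → T (inject₁ (suc j)) G (x ∷ y)) (List.foldr-∷ʳ T F zero (List.map suc (down i))) ⟨
    T (inject₁ (suc j)) (foldr T F (down (suc i))) (x ∷ y) ∎
    where open SetoidReasoning setoid

  -- The mechanism of `down-braid`, with a `T` passing through letters `S`; here `braid` is taken at
  -- e = σ.
  up-braid : ∀ (i : Fin (suc (suc n))) (j : Fin n) F → toℕ i ℕ.≤ toℕ j →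
             foldr S (T (suc j) F) (up i) ≋ T (inject₁ j) (foldr S F (up i))
  up-braid {n = suc n} zero zero F _ {x ∷ y} d = begin
    foldr S (T 1F F) (up zero) (x ∷ y)
      ≡⟨ ≡.cong (λ G → G (x ∷ y)) (unfold (T 1F F)) ⟩
    foldr S (S 1F (S 0F (T 1F F))) w (x ∷ y)
      ≈⟨ word-cong σ w (braid σ refl F) d ⟩
    foldr S (T 0F (S 1F (S 0F F))) w (x ∷ y)
      ≈⟨ word-commute-above σ 0# 0F _ (S 1F (S 0F F))
           (ListAll.map⁺ (ListAll.map⁺ (ListAll.universal (λ _ → s≤s (s≤s z≤n)) (up {n} zero)))) (x ∷ y) ⟩
    T 0F (foldr S (S 1F (S 0F F)) w) (x ∷ y)
      ≡⟨ ≡.cong (λ G → T 0F G (x ∷ y)) (unfold F) ⟨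
    T 0F (foldr S F (up zero)) (x ∷ y) ∎
    where
    open SetoidReasoning setoid
    w = List.map suc (List.map suc (up {n} zero))
    0F = zero
    1F = suc zero
    unfold : ∀ F → foldr S F (up zero) ≡.≡ foldr S (S 1F (S 0F F)) w
    unfold F = ≡.trans (List.foldr-∷ʳ S F zero (List.map suc (up {suc n} zero)))
      (≡.trans (≡.cong (foldr S (S 0F F)) (List.map-++ suc (List.map suc (up {n} zero)) (zero ∷ [])))
        (List.foldr-∷ʳ S (S 0F F) 1F w))
  up-braid {n = suc n} zero (suc j) F _ {x ∷ y} d@(_ ∷ d′) = begin
    foldr S (T (suc (suc j)) F) (up zero) (x ∷ y)
      ≡⟨ ≡.cong (λ G → G (x ∷ y)) (List.foldr-∷ʳ S (T (suc (suc j)) F) zero w) ⟩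
    foldr S (S zero (T (suc (suc j)) F)) w (x ∷ y)
      ≈⟨ word-cong′ σ w (commute σ 0# zero (suc (suc j)) F (s≤s (s≤s z≤n))) (x ∷ y) ⟩
    foldr S (T (suc (suc j)) (S zero F)) w (x ∷ y)
      ≈⟨ word-suc σ (up zero) (T (suc (suc j)) (S zero F)) x y ⟩
    foldr S (T (suc j) (S zero F ∘ (x ∷_))) (up zero) y
      ≈⟨ up-braid zero j (S zero F ∘ (x ∷_)) z≤n d′ ⟩
    T (inject₁ j) (foldr S (S zero F ∘ (x ∷_)) (up zero)) y
      ≈⟨ H-cong′ 0# (inject₁ j) (word-suc σ (up zero) (S zero F) x) y ⟨
    T (inject₁ (suc j)) (foldr S (S zero F) w) (x ∷ y)
      ≡⟨ ≡.cong (λ G → T (inject₁ (suc j)) G (x ∷ y)) (List.foldr-∷ʳ S F zero w) ⟨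
    T (inject₁ (suc j)) (foldr S F (up zero)) (x ∷ y) ∎
    where
    open SetoidReasoning setoid
    w = List.map suc (up {suc n} zero)
  up-braid {n = suc n} (suc i) (suc j) F (s≤s i≤j) {x ∷ y} (_ ∷ d) = begin
    foldr S (T (suc (suc j)) F) (up (suc i)) (x ∷ y)
      ≈⟨ word-suc σ (up i) (T (suc (suc j)) F) x y ⟩
    foldr S (T (suc j) (F ∘ (x ∷_))) (up i) y
      ≈⟨ up-braid i j (F ∘ (x ∷_)) i≤j d ⟩
    T (inject₁ j) (foldr S (F ∘ (x ∷_)) (up i)) y
      ≈⟨ H-cong′ 0# (inject₁ j) (word-suc σ (up i) F x) y ⟨
    T (inject₁ (suc j)) (foldr S F (up (suc i))) (x ∷ y) ∎
    where open SetoidReasoning setoid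

  -- Rotation of the variables

  rotatePoint : Vec Point (suc n) → Vec Point (suc n)
  rotatePoint (x ∷ y) = y ∷ʳ shift x

  ∷ʳ-all : ∀ {p} {P : Point → Set p} {y : Vec Point n} {z} → Allᵛ P y → P z → Allᵛ P (y ∷ʳ z)
  ∷ʳ-all []ᵃ        pz = pz ∷ᵃ []ᵃ
  ∷ʳ-all (py ∷ᵃ ps) pz = py ∷ᵃ ∷ʳ-all ps pz

  ∷ʳ-distinct : ∀ {y : Vec Point n} {z} → Distinct y → Allᵛ (_⊥ z) y → Distinct (y ∷ʳ z)
  ∷ʳ-distinct []       []ᵃ        = []ᵃ ∷ []
  ∷ʳ-distinct (x⊥ ∷ d) (x⊥z ∷ᵃ y⊥z) = ∷ʳ-all x⊥ x⊥z ∷ ∷ʳ-distinct d y⊥z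

  rotate-distinct : {y : Vec Point (suc n)} → Distinct y → Distinct (rotatePoint y)
  rotate-distinct {y = x ∷ y} (x⊥ ∷ d) = ∷ʳ-distinct d (VecAll.map (shift-⊥ ∘ ⊥-sym) x⊥)

  g τ : V (suc n) → V (suc n)
  g F y = F (rotatePoint y)
  τ F y = val (Vec.head y) * g F y

  g-cong : {F G : V (suc n)} → F ≋ G → g F ≋ g G
  g-cong F≋G d = F≋G (rotate-distinct d)

  τ-cong : {F G : V (suc n)} → F ≋ G → τ F ≋ τ G
  τ-cong F≋G d = *-congˡ (g-cong F≋G d)

  H-inject₁ : ∀ e (i : Fin n) F y z → H e (inject₁ i) F (y ∷ʳ z) ≈ H e i (F ∘ (_∷ʳ z)) y
  H-inject₁ e zero    F (a ∷ b ∷ y) z = refl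
  H-inject₁ e (suc i) F (x ∷ y)     z = H-inject₁ e i (F ∘ (x ∷_)) y z

  H-last : ∀ e F (y : Vec Point n) a b → H e (fromℕ n) F (y ∷ʳ a ∷ʳ b) ≈
           (A a b - e) * F (y ∷ʳ a ∷ʳ b) + (1# - A a b) * F (y ∷ʳ b ∷ʳ a)
  H-last e F []      a b = refl
  H-last e F (x ∷ y) a b = H-last e (F ∘ (x ∷_)) y a b

  word-inject₁ : ∀ e (w : List (Fin n)) F y z →
                 foldr (H e) F (List.map inject₁ w) (y ∷ʳ z) ≈ foldr (H e) (F ∘ (_∷ʳ z)) w y
  word-inject₁ e []      F y z = refl
  word-inject₁ e (i ∷ w) F y z = trans
    (H-inject₁ e i (foldr (H e) F (List.map inject₁ w)) y z) (H-cong′ e i (λ y → word-inject₁ e w F y z) y)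

  -- Tⱼ₊₁ g = g Tⱼ: the coordinate that g moves from the front to the back is touched neither by
  -- shifted letters before the move nor by `inject₁` letters after it.
  word-g : ∀ e (w : List (Fin n)) F →
           foldr (H e) (g F) (List.map suc w) ≗ g (foldr (H e) F (List.map inject₁ w))
  word-g e w F (x ∷ y) = trans (word-suc e w (g F) x y) (sym (word-inject₁ e w F y (shift x)))

  word-τ : ∀ e (w : List (Fin n)) F →
           foldr (H e) (τ F) (List.map suc w) ≗ τ (foldr (H e) F (List.map inject₁ w))
  word-τ e w F (x ∷ y) = begin
    foldr (H e) (τ F) (List.map suc w) (x ∷ y)          ≈⟨ word-suc e w (τ F) x y ⟩
    foldr (H e) (val x ⊛ (F ∘ (_∷ʳ shift x))) w y       ≈⟨ word-scale e w (val x) (F ∘ (_∷ʳ shift x)) y ⟩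
    val x * foldr (H e) (F ∘ (_∷ʳ shift x)) w y         ≈⟨ *-congˡ (word-inject₁ e w F y (shift x)) ⟨
    τ (foldr (H e) F (List.map inject₁ w)) (x ∷ y)      ∎
    where open SetoidReasoning setoid

  -- Two facts in one: T₁x₂ = x₁S₁, which is `A-val`, and S₁g² = g²Sₙ₋₁ for n variables, where
  -- `A-shift` compares the coefficients before and after both coordinates are shifted.
  T-g-τ : ∀ (F : V (suc (suc n))) → T zero (g (τ F)) ≋ τ (g (S (fromℕ n) F))
  T-g-τ {n = n} F {a ∷ b ∷ y} ((a⊥b ∷ᵃ _) ∷ _) = begin
    (A a b - 0#) * (val b * f₁) + (1# - A a b) * (val a * f₂)
      ≈⟨ modulo (A-val a⊥b) (solve 6 (λ p s v w f₁ f₂ →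
           (p :- 0:) :* (w :* f₁) :+ (1: :- p) :* (v :* f₂)
             := v :* ((p :- s) :* f₁ :+ (1: :- p) :* f₂) :+ (:- f₁) :* (p :* (v :- w) :- s :* v))
           refl (A a b) σ (val a) (val b) f₁ f₂) ⟩
    val a * ((A a b - σ) * f₁ + (1# - A a b) * f₂)
      ≈⟨ *-congˡ (+-cong (*-congʳ (+-congʳ (A-shift a⊥b))) (*-congʳ (+-congˡ (-‿cong (A-shift a⊥b))))) ⟨
    val a * ((A (shift a) (shift b) - σ) * f₁ + (1# - A (shift a) (shift b)) * f₂)
      ≈⟨ *-congˡ (H-last σ F y (shift a) (shift b)) ⟨
    τ (g (S (fromℕ n) F)) (a ∷ b ∷ y) ∎
    where
    open SetoidReasoning setoid
    f₁ = F (y ∷ʳ shift a ∷ʳ shift b)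
    f₂ = F (y ∷ʳ shift b ∷ʳ shift a)

  valLast : V (suc n)
  valLast (x ∷ [])    = val x
  valLast (_ ∷ x ∷ y) = valLast (x ∷ y)

  valLast-∷ʳ : ∀ (y : Vec Point n) z → valLast (y ∷ʳ z) ≈ val z
  valLast-∷ʳ []          z = refl
  valLast-∷ʳ (_ ∷ [])    z = refl
  valLast-∷ʳ (_ ∷ x ∷ y) z = valLast-∷ʳ (x ∷ y) z

  -- Passing S through x₁ moves it to x₂ and turns S into T, so up zero carries x₁ to xₙ.
  up-val : ∀ (F : V (suc n)) → foldr S (λ y → val (Vec.head y) * F y) (up zero)
                                 ≋ λ y → valLast y * foldr T F (down (fromℕ n)) y
  up-val {n = zero}  F {x ∷ []} _ = refl
  up-val {n = suc n} F {x ∷ y@(y₀ ∷ _)} d@(_ ∷ d′) = begin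
    foldr S (λ y → val (Vec.head y) * F y) (up zero) (x ∷ y)
      ≡⟨ ≡.cong (λ G → G (x ∷ y)) (List.foldr-∷ʳ S (λ y → val (Vec.head y) * F y) zero w) ⟩
    foldr S (S zero (λ y → val (Vec.head y) * F y)) w (x ∷ y)
      ≈⟨ word-cong σ w first d ⟩
    foldr S (λ y → val (Vec.head (Vec.tail y)) * T zero F y) w (x ∷ y)
      ≈⟨ word-suc σ (up zero) (λ y → val (Vec.head (Vec.tail y)) * T zero F y) x y ⟩
    foldr S (λ y → val (Vec.head y) * T zero F (x ∷ y)) (up zero) y
      ≈⟨ up-val (T zero F ∘ (x ∷_)) d′ ⟩
    valLast y * foldr T (T zero F ∘ (x ∷_)) (down (fromℕ n)) y
      ≈⟨ *-congˡ (word-suc 0# (down (fromℕ n)) (T zero F) x y) ⟨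
    valLast y * foldr T (T zero F) (List.map suc (down (fromℕ n))) (x ∷ y)
      ≡⟨ ≡.cong (λ G → valLast y * G (x ∷ y)) (List.foldr-∷ʳ T F zero (List.map suc (down (fromℕ n)))) ⟨
    valLast y * foldr T F (down (fromℕ (suc n))) (x ∷ y) ∎
    where
    open SetoidReasoning setoid
    w = List.map suc (up {n} zero)
    first : S zero (λ y → val (Vec.head y) * F y) ≋ λ y → val (Vec.head (Vec.tail y)) * T zero F y
    first {a ∷ b ∷ y} ((a⊥b ∷ᵃ _) ∷ _) = modulo (A-val a⊥b) (solve 6 (λ p s v w f₁ f₂ →
      (p :- s) :* (v :* f₁) :+ (1: :- p) :* (w :* f₂)
        := w :* ((p :- 0:) :* f₁ :+ (1: :- p) :* f₂) :+ f₁ :* (p :* (v :- w) :- s :* v))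
      refl (A a b) σ (val a) (val b) (F (a ∷ b ∷ y)) (F (b ∷ a ∷ y)))

  -- Cherednik operators

  Y : Fin (suc n) → V (suc n) → V (suc n)
  Y i F = foldr T (g (foldr S F (up i))) (down i)

  Y-linear : ∀ (i : Fin (suc n)) a F G → Y i (F ⊕ a ⊛ G) ≗ Y i F ⊕ a ⊛ Y i G
  Y-linear i a F G y = trans
    (word-cong′ 0# (down i) (λ y → word-linear σ (up i) a F G (rotatePoint y)) y)
    (word-linear 0# (down i) a (g (foldr S F (up i))) (g (foldr S G (up i))) y)

  Y-scale : ∀ (i : Fin (suc n)) a F → Y i (a ⊛ F) ≗ a ⊛ Y i F
  Y-scale i a F y = trans
    (word-cong′ 0# (down i) (λ y → word-scale σ (up i) a F (rotatePoint y)) y)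
    (word-scale 0# (down i) a (g (foldr S F (up i))) y)

  Y-cong : ∀ (i : Fin (suc n)) {F G} → F ≋ G → Y i F ≋ Y i G
  Y-cong i F≋G = word-cong 0# (down i) (g-cong (word-cong σ (up i) F≋G))

  -- The letters of `up i` are too large to interact with Tⱼ; g raises its index by one and
  -- `down-braid` lowers it again.
  Y-T-left : ∀ (i : Fin (suc (suc n))) (j : Fin n) F → suc (toℕ j) ℕ.< toℕ i →
             Y i (T (inject₁ j) F) ≋ T (inject₁ j) (Y i F)
  Y-T-left {n = n} i j F j<i = begin
    Y i (T (inject₁ j) F)
      ≈⟨ word-cong 0# (down i) (g-cong (λ {y} _ → word-commute-above σ 0# (inject₁ j) (up i) F
           (ListAll.map (ℕ.<-≤-trans (≡.subst (λ k → suc k ℕ.< toℕ i) (≡.sym (Fin.toℕ-inject₁ j)) j<i))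
             (up-above i)) y)) ⟩
    foldr T (g (T (inject₁ j) F′)) (down i)
      ≈⟨ word-cong 0# (down i) (λ {y} _ → sym (word-g 0# (j ∷ []) F′ y)) ⟩
    foldr T (T (suc j) (g F′)) (down i)
      ≈⟨ down-braid i j (g F′) j<i ⟩
    T (inject₁ j) (Y i F) ∎
    where
    open SetoidReasoning (V-setoid (suc (suc n)))
    F′ = foldr S F (up i)

  -- `up-braid` lowers the index by one, g restores it, and the letters of `down i` are too small to
  -- interact.
  Y-T-right : ∀ (i : Fin (suc (suc n))) (j : Fin n) F → toℕ i ℕ.≤ toℕ j →
              Y i (T (suc j) F) ≋ T (suc j) (Y i F)
  Y-T-right {n = n} i j F i≤j = begin
    Y i (T (suc j) F)
      ≈⟨ word-cong 0# (down i) (g-cong (up-braid i j F i≤j)) ⟩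
    foldr T (g (T (inject₁ j) F′)) (down i)
      ≈⟨ word-cong 0# (down i) (λ {y} _ → sym (word-g 0# (j ∷ []) F′ y)) ⟩
    foldr T (T (suc j) (g F′)) (down i)
      ≈⟨ (λ {y} _ → word-commute-below 0# 0# (suc j) (down i) (g F′)
           (ListAll.map (λ k<i → s≤s (ℕ.≤-trans k<i i≤j)) (down-below i)) y) ⟩
    T (suc j) (Y i F) ∎
    where
    open SetoidReasoning (V-setoid (suc (suc n)))
    F′ = foldr S F (up i)

  Y-T-far : ∀ (i : Fin (suc n)) (j : Fin n) F → i ≡.≢ inject₁ j → i ≡.≢ suc j → Y i (T j F) ≋ T j (Y i F)
  Y-T-far {n = suc n} i j F i≢ i≢′ with ℕ.<-cmp (toℕ i) (toℕ j)
  Y-T-far {n = suc n} i (suc j) F i≢ i≢′ | tri< (s≤s i≤j) _ _ = Y-T-right i j F i≤j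
  Y-T-far {n = suc n} i j F i≢ i≢′ | tri≈ _ i≡j _ =
    contradiction (Fin.toℕ-injective (≡.trans i≡j (≡.sym (Fin.toℕ-inject₁ j)))) i≢
  Y-T-far {n = suc n} i j F i≢ i≢′ | tri> _ _ j<i with ℕ.m≤n⇒m<n∨m≡n j<i
  ... | inj₂ 1+j≡i = contradiction (Fin.toℕ-injective (≡.sym 1+j≡i)) i≢′
  -- `Y-T-left` expects an index of the form `inject₁`, so j must not be the last one; j + 1 < i
  -- guarantees this.
  ... | inj₁ 1+j<i = ≡.subst (λ j → Y i (T j F) ≋ T j (Y i F)) (Fin.inject₁-lower₁ j n≢j)
    (Y-T-left i (Fin.lower₁ j n≢j) F (≡.subst (λ k → suc k ℕ.< toℕ i) (≡.sym (Fin.toℕ-lower₁ j n≢j)) 1+j<i))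
    where
    n≢j : n ≡.≢ toℕ j
    n≢j = ℕ.>⇒≢ (ℕ.s<s⁻¹ (ℕ.<-≤-trans 1+j<i (Fin.toℕ≤pred[n] i)))

  down-inject₁ : ∀ (i : Fin (suc n)) → down (inject₁ i) ≡.≡ List.map inject₁ (down i)
  down-inject₁ zero                = ≡.refl
  down-inject₁ {n = suc n} (suc i) = ≡.trans
    (≡.cong (λ w → List.map suc w ++ zero ∷ []) (down-inject₁ i))
    (≡.sym (≡.trans (List.map-++ inject₁ (List.map suc (down i)) (zero ∷ []))
      (≡.cong (_++ zero ∷ []) (≡.trans (≡.sym (List.map-∘ (down i))) (List.map-∘ (down i))))))

  up-inject₁-last : ∀ (i : Fin (suc n)) → up (inject₁ i) ≡.≡ fromℕ n ∷ List.map inject₁ (up i)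
  up-inject₁-last {n = zero}  zero    = ≡.refl
  up-inject₁-last {n = suc n} zero    = ≡.trans
    (≡.cong (λ w → List.map suc w ++ zero ∷ []) (up-inject₁-last {n} zero))
    (≡.cong (fromℕ (suc n) ∷_) (≡.sym (≡.trans (List.map-++ inject₁ (List.map suc (up {n} zero)) (zero ∷ []))
      (≡.cong (_++ zero ∷ []) (≡.trans (≡.sym (List.map-∘ (up {n} zero))) (List.map-∘ (up {n} zero)))))))
  up-inject₁-last {n = suc n} (suc i) = ≡.trans
    (≡.cong (List.map suc) (up-inject₁-last i))
    (≡.cong (fromℕ (suc n) ∷_) (≡.trans (≡.sym (List.map-∘ (up i))) (List.map-∘ (up i))))

  -- Lowering the index by one costs `down` its innermost letter T₁ and gives `up` the outermost
  -- letter Sₙ₋₁, for n variables. `T-g-τ` makes exactly this trade.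
  Y-τ-suc : ∀ (i : Fin n) (F : V (suc n)) → Y (suc i) (τ F) ≋ τ (Y (inject₁ i) F)
  Y-τ-suc {n = suc n} i F = begin
    Y (suc i) (τ F)
      ≈⟨ word-cong 0# (down (suc i)) (g-cong (λ {y} _ → word-τ σ (up i) F y)) ⟩
    foldr T (g (τ F′)) (down (suc i))
      ≡⟨ List.foldr-∷ʳ T (g (τ F′)) zero (List.map suc (down i)) ⟩
    foldr T (T zero (g (τ F′))) (List.map suc (down i))
      ≈⟨ word-cong 0# (List.map suc (down i)) (T-g-τ F′) ⟩
    foldr T (τ (g (S (fromℕ n) F′))) (List.map suc (down i))
      ≈⟨ (λ {y} _ → word-τ 0# (down i) (g (S (fromℕ n) F′)) y) ⟩
    τ (foldr T (g (S (fromℕ n) F′)) (List.map inject₁ (down i)))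
      ≡⟨ ≡.cong₂ (λ w w′ → τ (foldr T (g (foldr S F w)) w′)) (up-inject₁-last i) (down-inject₁ i) ⟨
    τ (Y (inject₁ i) F) ∎
    where
    open SetoidReasoning (V-setoid (suc (suc n)))
    F′ = foldr S F (List.map inject₁ (up i))

  -- `up-val` turns the S of Y₁ into the T of Yₙ and x₁ into xₙ; the remaining g makes q⁻¹x₁ of xₙ,
  -- whence the factor q⁻¹.
  Y-τ-zero : ∀ (F : V (suc n)) → Y zero (τ F) ≋ q⁻¹ ⊛ τ (Y (fromℕ n) F)
  Y-τ-zero {n = n} F {x ∷ y} d = begin
    g (foldr S (τ F) (up zero)) (x ∷ y)
      ≈⟨ up-val (g F) (rotate-distinct d) ⟩
    valLast (y ∷ʳ shift x) * G (y ∷ʳ shift x)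
      ≈⟨ *-congʳ (trans (valLast-∷ʳ y (shift x)) (val-shift x)) ⟩
    q⁻¹ * val x * G (y ∷ʳ shift x)
      ≈⟨ *-assoc _ _ _ ⟩
    q⁻¹ * (val x * G (y ∷ʳ shift x))
      ≡⟨ ≡.cong (λ w → q⁻¹ * (val x * foldr T (g (foldr S F w)) (down (fromℕ n)) (y ∷ʳ shift x))) (up-fromℕ n) ⟨
    (q⁻¹ ⊛ τ (Y (fromℕ n) F)) (x ∷ y) ∎
    where
    open SetoidReasoning setoid
    G = foldr T (g F) (down (fromℕ n))

  -- Intertwining relations

  module _ (j : Fin n) (F : V (suc n)) {η η′ e : Carrier} where
    open SetoidReasoning (V-setoid (suc n))

    private
      -- The common core of two neighbours: Yⱼ = W Sⱼ and Yⱼ₊₁ = Tⱼ W. With `ST` this encodes t Yⱼ₊₁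
      -- = Tⱼ Yⱼ Tⱼ.
      W : V (suc n) → V (suc n)
      W G = foldr T (g (foldr S G (up (suc j)))) (down (inject₁ j))

      W-cong : ∀ {G G′} → G ≋ G′ → W G ≋ W G′
      W-cong G≋G′ = word-cong 0# (down (inject₁ j)) (g-cong (word-cong σ (up (suc j)) G≋G′))

      W-linear : ∀ a G G′ → W (G ⊕ a ⊛ G′) ≋ W G ⊕ a ⊛ W G′
      W-linear a G G′ {y} _ = trans
        (word-cong′ 0# (down (inject₁ j)) (λ y → word-linear σ (up (suc j)) a G G′ (rotatePoint y)) y)
        (word-linear 0# (down (inject₁ j)) a (g (foldr S G (up (suc j)))) (g (foldr S G′ (up (suc j)))) y)

      W-scale : ∀ a G → W (a ⊛ G) ≋ a ⊛ W G
      W-scale a G {y} _ = trans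
        (word-cong′ 0# (down (inject₁ j)) (λ y → word-scale σ (up (suc j)) a G (rotatePoint y)) y)
        (word-scale 0# (down (inject₁ j)) a (g (foldr S G (up (suc j)))) y)

      Y≡WS : ∀ G → Y (inject₁ j) G ≡.≡ W (S j G)
      Y≡WS G = ≡.trans
        (≡.cong (λ w → foldr T (g (foldr S G w)) (down (inject₁ j))) (up-inject₁ j))
        (≡.cong (λ G → foldr T (g G) (down (inject₁ j))) (List.foldr-∷ʳ S G j (up (suc j))))

      Y≡TW : ∀ G → Y (suc j) G ≡.≡ T j (W G)
      Y≡TW G = ≡.cong (foldr T (g (foldr S G (up (suc j))))) (down-suc j)

    Y-T-inject₁ : Y (suc j) F ≋ η′ ⊛ F → Y (inject₁ j) (T j F) ≋ η′ ⊛ S j F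
    Y-T-inject₁ YF = begin
      Y (inject₁ j) (T j F)  ≡⟨ Y≡WS (T j F) ⟩
      W (S j (T j F))        ≈⟨ W-cong (ST j F) ⟩
      W (t ⊛ F)              ≈⟨ W-scale t F ⟩
      t ⊛ W F                ≈⟨ ST j (W F) ⟨
      S j (T j (W F))        ≡⟨ ≡.cong (S j) (Y≡TW F) ⟨
      S j (Y (suc j) F)      ≈⟨ H-cong σ j YF ⟩
      S j (η′ ⊛ F)           ≈⟨ (λ {y} _ → H-scale σ j η′ F y) ⟩
      η′ ⊛ S j F             ∎

    Y-T-suc : Y (inject₁ j) F ≋ η ⊛ F → Y (suc j) F ≋ η′ ⊛ F →
              Y (suc j) (T j F) ≋ η ⊛ T j F ⊕ (σ * η′) ⊛ F
    Y-T-suc YF Y′F = begin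
      Y (suc j) (T j F)
        ≡⟨ Y≡TW (T j F) ⟩
      T j (W (T j F))
        ≈⟨ H-cong 0# j (W-cong λ {y} _ → T≗S j F y) ⟩
      T j (W (S j F ⊕ σ ⊛ F))
        ≈⟨ H-cong 0# j (W-linear σ (S j F) F) ⟩
      T j (W (S j F) ⊕ σ ⊛ W F)
        ≡⟨ ≡.cong (λ G → T j (G ⊕ σ ⊛ W F)) (Y≡WS F) ⟨
      T j (Y (inject₁ j) F ⊕ σ ⊛ W F)
        ≈⟨ H-cong 0# j (λ {y} d → +-congʳ {σ * W F y} (YF d)) ⟩
      T j (η ⊛ F ⊕ σ ⊛ W F)
        ≈⟨ (λ {y} _ → H-linear 0# j σ (η ⊛ F) (W F) y) ⟩
      T j (η ⊛ F) ⊕ σ ⊛ T j (W F)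
        ≈⟨ (λ {y} _ → +-congʳ (H-scale 0# j η F y)) ⟩
      η ⊛ T j F ⊕ σ ⊛ T j (W F)
        ≡⟨ ≡.cong (λ G → η ⊛ T j F ⊕ σ ⊛ G) (Y≡TW F) ⟨
      η ⊛ T j F ⊕ σ ⊛ Y (suc j) F
        ≈⟨ (λ d → +-congˡ (trans (*-congˡ (Y′F d)) (sym (*-assoc _ _ _)))) ⟩
      η ⊛ T j F ⊕ (σ * η′) ⊛ F ∎

    module _ (YF : Y (inject₁ j) F ≋ η ⊛ F) (Y′F : Y (suc j) F ≋ η′ ⊛ F) (eq : e * (η - η′) ≈ σ * η′) where

      -- By `Y-T-inject₁` the first summand becomes η′(TⱼF - σF), so F occurs outside η′TⱼF with
      -- coefficient eη - ση′, which must equal eη′. This determines e; `intertwine-suc` leads to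
      -- the same equation.
      intertwine-inject₁ : Y (inject₁ j) (T j F ⊕ e ⊛ F) ≋ η′ ⊛ (T j F ⊕ e ⊛ F)
      intertwine-inject₁ {y} d = trans (Y-linear (inject₁ j) e (T j F) F y) (trans
        (+-cong (Y-T-inject₁ Y′F d) (*-congˡ (YF d)))
        (trans (modulo eq (solve 6 (λ η η′ e s f h → η′ :* h :+ e :* (η :* f)
            := η′ :* (h :+ s :* f :+ e :* f) :+ f :* (e :* (η :- η′) :- s :* η′)) refl η η′ e σ (F y) (S j F y)))
          (*-congˡ (+-congʳ (sym (T≗S j F y))))))

      intertwine-suc : Y (suc j) (T j F ⊕ e ⊛ F) ≋ η ⊛ (T j F ⊕ e ⊛ F)
      intertwine-suc {y} d = trans (Y-linear (suc j) e (T j F) F y) (trans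
        (+-cong (Y-T-suc YF Y′F d) (*-congˡ (Y′F d)))
        (modulo eq (solve 6 (λ η η′ e s f h → η :* h :+ s :* η′ :* f :+ e :* (η′ :* f)
            := η :* (h :+ e :* f) :+ (:- f) :* (e :* (η :- η′) :- s :* η′)) refl η η′ e σ (F y) (T j F y))))

  -- The constant function, and points where T acts trivially

  one : V n
  one _ = 1#

  H-one : ∀ e i → H e i (one {suc n}) ≗ (1# - e) ⊛ one
  H-one e i y = solve 3 (λ p e x → (p :- e) :* x :+ (1: :- p) :* x := (1: :- e) :* x) refl (coef i y) e 1#

  word-one : ∀ {e d} → 1# - e ≈ d → ∀ (w : List (Fin n)) → foldr (H e) one w ≗ (d ^ List.length w) ⊛ one
  word-one          1-e≈d []      y = sym (*-identityˡ 1#)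
  word-one {e = e} {d} 1-e≈d (i ∷ w) y = trans (H-cong′ e i (word-one 1-e≈d w) y)
    (trans (H-scale e i (d ^ List.length w) one y)
    (trans (*-congˡ (trans (H-one e i y) (*-congʳ 1-e≈d)))
      (solve 3 (λ a b c → a :* (b :* c) := b :* a :* c) refl _ _ _)))

  1^n≈1 : ∀ n → 1# ^ n ≈ 1#
  1^n≈1 zero    = refl
  1^n≈1 (suc n) = trans (*-identityˡ _) (1^n≈1 n)

  -- Each S contributes 1 - σ = t, each T contributes 1.
  Y-one : ∀ (i : Fin (suc n)) → Y i one ≋ (t ^ List.length (up i)) ⊛ one
  Y-one i {y} _ = trans
    (word-cong′ 0# (down i) (λ y → word-one {e = σ} {t} (solve 1 (λ t → 1: :- (1: :- t) := t) refl t) (up i)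
      (rotatePoint y)) y)
    (trans (word-scale 0# (down i) (t ^ List.length (up i)) one y)
      (*-congˡ (trans (word-one {e = 0#} {1#} (solve 0 (1: :- 0: := 1:) refl) (down i) y)
        (trans (*-congʳ (1^n≈1 (List.length (down i)))) (*-identityˡ 1#)))))

  -- At points with A yᵢ yᵢ₊₁ = 1 the operator Tᵢ drops out, e.g. at (1, t, t², …).
  word-T-invariant : ∀ {y : Vec Point (suc n)} → (∀ i → coef i y ≈ 1#) →
                     ∀ w F → foldr T F w y ≈ F y
  word-T-invariant coef≈1 []      F = refl
  word-T-invariant {y = y} coef≈1 (i ∷ w) F = trans (modulo (coef≈1 i)
    (solve 3 (λ p f f′ → (p :- 0:) :* f :+ (1: :- p) :* f′ := f :+ (f :- f′) :* (p :- 1:)) refl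
      (coef i y) (foldr T F w y) (foldr T F w (swap i y))))
    (word-T-invariant coef≈1 w F)

-- Arithmetic in the field and the evaluation points

module FieldLemmas
  {c ℓ₁ ℓ₂ c′ ℓ₁′ ℓ₂′} {k : HeytingField c ℓ₁ ℓ₂} (K : RationalFunctionField k c′ ℓ₁′ ℓ₂′) where

  open RationalFunctionField K
  open HeytingField heytingField using (_#_; #⇒invertible)
  open CommutativeRing commutativeRing hiding (zero)
  open FieldOperations K
  open Exp semiring using (_^_; ^-homo-*; ^-congˡ)
  open CommExp commutativeSemiring using (^-distrib-*)
  open RingProperties ring using (-‿distribˡ-*)
  open HeytingProperties (HeytingField.heytingCommutativeRing heytingField)
  open IntegerRingSolver commutativeRing
  open SetoidReasoning setoid
  private
    module k where
      open HeytingField k public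
      open HeytingProperties (HeytingField.heytingCommutativeRing k) public
    open Morphisms.IsRingHomomorphism ι-isHomomorphism using (1#-homo; -‿homo)
    open Bivariate k commutativeRing using (Poly; coeff; value)

  *-inverseˡ : ∀ {x} (x#0 : x # 0#) → inverse x#0 * x ≈ 1#
  *-inverseˡ {x} x#0 = trans (*-congˡ (sym (x-0≈x x))) (proj₁ (proj₂ (#⇒invertible x#0)))

  *-inverseʳ : ∀ {x} (x#0 : x # 0#) → x * inverse x#0 ≈ 1#
  *-inverseʳ x#0 = trans (*-comm _ _) (*-inverseˡ x#0)

  *-cancelˡ : ∀ {x} → x # 0# → ∀ {y z} → x * y ≈ x * z → y ≈ z
  *-cancelˡ {x} x#0 {y} {z} xy≈xz = begin
    y                       ≈⟨ *-identityˡ y ⟨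
    1# * y                  ≈⟨ *-congʳ (*-inverseˡ x#0) ⟨
    inverse x#0 * x * y     ≈⟨ *-assoc _ _ _ ⟩
    inverse x#0 * (x * y)   ≈⟨ *-congˡ xy≈xz ⟩
    inverse x#0 * (x * z)   ≈⟨ *-assoc _ _ _ ⟨
    inverse x#0 * x * z     ≈⟨ *-congʳ (*-inverseˡ x#0) ⟩
    1# * z                  ≈⟨ *-identityˡ z ⟩
    z                       ∎

  inverse-unique : ∀ {x y} (x#0 : x # 0#) → y * x ≈ 1# → y ≈ inverse x#0
  inverse-unique x#0 yx≈1 = *-cancelˡ x#0 (trans (*-comm _ _) (trans yx≈1 (sym (*-inverseʳ x#0))))

  inverse-cong : ∀ {x y} (x#0 : x # 0#) (y#0 : y # 0#) → x ≈ y → inverse x#0 ≈ inverse y#0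
  inverse-cong x#0 y#0 x≈y = inverse-unique y#0 (trans (*-congˡ (sym x≈y)) (*-inverseˡ x#0))

  xy#0⇒y#0 : ∀ {x y} → x * y # 0# → y # 0#
  xy#0⇒y#0 {x} {y} xy#0 = invertibleˡ⇒# (inverse xy#0 * x ,
    trans (*-congˡ (x-0≈x y)) (trans (*-assoc _ _ _) (*-inverseˡ xy#0)))

  inverse#0 : ∀ {x} (x#0 : x # 0#) → inverse x#0 # 0#
  inverse#0 {x} x#0 = xy#0⇒y#0 (#-congʳ (sym (*-inverseʳ x#0)) 1#0)

  ^-inverse : ∀ {x} (x#0 : x # 0#) n → x ^ n * inverse x#0 ^ n ≈ 1#
  ^-inverse x#0 zero    = *-identityˡ 1#
  ^-inverse {x} x#0 (suc n) = begin
    x * x ^ n * (inverse x#0 * inverse x#0 ^ n)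
      ≈⟨ solve 4 (λ a b c d → a :* b :* (c :* d) := a :* c :* (b :* d)) refl _ _ _ _ ⟩
    x * inverse x#0 * (x ^ n * inverse x#0 ^ n)
      ≈⟨ *-cong (*-inverseʳ x#0) (^-inverse x#0 n) ⟩
    1# * 1#
      ≈⟨ *-identityˡ 1# ⟩
    1# ∎

  ^ᶻ-⊖ : ∀ (y : K*) m n → y ^ᶻ (m ⊖ n) ≈ proj₁ y ^ m * inverse (proj₂ y) ^ n
  ^ᶻ-⊖ y zero    zero    = sym (*-identityˡ 1#)
  ^ᶻ-⊖ y zero    (suc n) = sym (*-identityˡ _)
  ^ᶻ-⊖ y (suc m) zero    = sym (*-identityʳ _)
  ^ᶻ-⊖ y@(x , x#0) (suc m) (suc n) rewrite ℤ.[1+m]⊖[1+n]≡m⊖n m n = begin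
    y ^ᶻ (m ⊖ n)
      ≈⟨ ^ᶻ-⊖ y m n ⟩
    x ^ m * inverse x#0 ^ n
      ≈⟨ *-identityˡ _ ⟨
    1# * (x ^ m * inverse x#0 ^ n)
      ≈⟨ *-congʳ (*-inverseʳ x#0) ⟨
    x * inverse x#0 * (x ^ m * inverse x#0 ^ n)
      ≈⟨ solve 4 (λ a b c d → a :* b :* (c :* d) := a :* c :* (b :* d)) refl _ _ _ _ ⟩
    x ^ suc m * inverse x#0 ^ suc n ∎

  ^ᶻ-homo-+ : ∀ (y : K*) i j → y ^ᶻ (i ℤ.+ j) ≈ y ^ᶻ i * y ^ᶻ j
  ^ᶻ-homo-+ (x , _)   (+ m)    (+ n)    = ^-homo-* x m n
  ^ᶻ-homo-+ y         (+ m)    -[1+ n ] = ^ᶻ-⊖ y m (suc n)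
  ^ᶻ-homo-+ y         -[1+ m ] (+ n)    = trans (^ᶻ-⊖ y n (suc m)) (*-comm _ _)
  ^ᶻ-homo-+ (x , x#0) -[1+ m ] -[1+ n ] = begin
    inverse x#0 ^ suc (suc (m ℕ.+ n))   ≡⟨ ≡.cong (λ l → inverse x#0 ^ suc l) (ℕ.+-suc m n) ⟨
    inverse x#0 ^ (suc m ℕ.+ suc n)     ≈⟨ ^-homo-* (inverse x#0) (suc m) (suc n) ⟩
    inverse x#0 ^ suc m * inverse x#0 ^ suc n ∎

  ^ᶻ-cong : ∀ (y z : K*) → proj₁ y ≈ proj₁ z → ∀ i → y ^ᶻ i ≈ z ^ᶻ i
  ^ᶻ-cong y z y≈z (+ n)    = ^-congˡ n y≈z
  ^ᶻ-cong y z y≈z -[1+ n ] = ^-congˡ (suc n) (inverse-cong (proj₂ y) (proj₂ z) y≈z)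

  -- Used with y = q and z = x₁, where it merges the scalar that `rotate` puts in front of a term
  -- with the power of x₁ into a power of q⁻¹x₁.
  ^ᶻ-mulInverse : ∀ (y z w : K*) → proj₁ w ≈ inverse (proj₂ y) * proj₁ z →
                  ∀ i → y ^ᶻ (ℤ.- i) * z ^ᶻ i ≈ w ^ᶻ i
  ^ᶻ-mulInverse y z w w≈ (+ zero)  = *-identityˡ 1#
  ^ᶻ-mulInverse y z w w≈ (+ suc n) = trans (sym (^-distrib-* _ _ (suc n))) (^-congˡ (suc n) (sym w≈))
  ^ᶻ-mulInverse (y , y#0) (z , z#0) (w , w#0) w≈ -[1+ n ] =
    trans (sym (^-distrib-* _ _ (suc n))) (^-congˡ (suc n) (inverse-unique w#0 (begin
      y * inverse z#0 * w                      ≈⟨ *-congˡ w≈ ⟩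
      y * inverse z#0 * (inverse y#0 * z)
        ≈⟨ solve 4 (λ a b c d → a :* b :* (c :* d) := a :* c :* (b :* d)) refl _ _ _ _ ⟩
      y * inverse y#0 * (inverse z#0 * z)      ≈⟨ *-cong (*-inverseʳ y#0) (*-inverseˡ z#0) ⟩
      1# * 1#                                  ≈⟨ *-identityˡ 1# ⟩
      1#                                       ∎)))

  qt-homo : ∀ a b a′ b′ → qt (a ℤ.+ a′) (b ℤ.+ b′) ≈ qt a b * qt a′ b′
  qt-homo a b a′ b′ = trans (*-cong (^ᶻ-homo-+ q* a a′) (^ᶻ-homo-+ t* b b′))
    (solve 4 (λ a b c d → a :* b :* (c :* d) := a :* c :* (b :* d)) refl _ _ _ _)

  -- (a , b) stands for q⁻ᵃtᵇ.
  Point : Set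
  Point = ℕ × ℕ

  q⁻¹ : Carrier
  q⁻¹ = inverse q#0

  val : Point → Carrier
  val (a , b) = q⁻¹ ^ a * t ^ b

  val#0 : ∀ x → val x # 0#
  val#0 (a , b) = x#0y#0→xy#0 (proj₂ ((q⁻¹ , inverse#0 q#0) ^* a)) (proj₂ (t* ^* b))

  point : Point → K*
  point x = val x , val#0 x

  shift : Point → Point
  shift (a , b) = suc a , b

  infix 4 _⊥_
  _⊥_ : Point → Point → Set
  (_ , b) ⊥ (_ , b′) = b ≡.≢ b′

  -- Multiplication by qᵃqᵃ′ turns the difference into the polynomial qᵃ′tᵇ - qᵃtᵇ′. Its two
  -- monomials are distinct because b ≠ b′, whatever a and a′ are, so the independence of q and t½
  -- applies. Exponents are doubled because t is the square of t½.
  separated : ∀ {x y} → x ⊥ y → val x - val y # 0#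
  separated {a , b} {a′ , b′} b≢b′ = xy#0⇒y#0 (#-congʳ clear (independent p ((a′ , b ℕ.+ b) , p≠0)))
    where
    p : Poly
    p = (k.1# , a′ , b ℕ.+ b) ∷ (k.- k.1# , a , b′ ℕ.+ b′) ∷ []
    _≟₂_ = Product.≡-dec ℕ._≟_ ℕ._≟_
    double-injective : ∀ {m n} → m ℕ.+ m ≡.≡ n ℕ.+ n → m ≡.≡ n
    double-injective {m} {n} eq = ℕ.*-cancelˡ-≡ m n 2
      (≡.trans (≡.cong (m ℕ.+_) (ℕ.+-identityʳ m)) (≡.trans eq (≡.cong (n ℕ.+_) (≡.sym (ℕ.+-identityʳ n)))))
    p≠0 : coeff p (a′ , b ℕ.+ b) k.# k.0#
    p≠0 rewrite dec-true ((a′ , b ℕ.+ b) ≟₂ (a′ , b ℕ.+ b)) ≡.refl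
              | dec-false ((a , b′ ℕ.+ b′) ≟₂ (a′ , b ℕ.+ b)) (b≢b′ ∘ double-injective ∘ ≡.sym ∘ ≡.cong proj₂) =
      k.#-congʳ (k.sym (k.trans (k.+-congˡ (k.+-identityʳ k.0#)) (k.+-identityʳ k.1#))) k.1#0
    t^ : ∀ b → t½ ^ (b ℕ.+ b) ≈ t ^ b
    t^ b = trans (^-homo-* t½ b b) (sym (^-distrib-* t½ t½ b))
    ι-1 : ι (k.- k.1#) ≈ - 1#
    ι-1 = trans (-‿homo k.1#) (-‿cong 1#-homo)
    clear : value ι q t½ p ≈ q ^ a * q ^ a′ * (val (a , b) - val (a′ , b′))
    clear = begin
      ι k.1# * (q ^ a′ * t½ ^ (b ℕ.+ b)) + (ι (k.- k.1#) * (q ^ a * t½ ^ (b′ ℕ.+ b′)) + 0#)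
        ≈⟨ +-cong (*-cong 1#-homo (*-congˡ (t^ b))) (+-congʳ (*-cong ι-1 (*-congˡ (t^ b′)))) ⟩
      1# * (q ^ a′ * t ^ b) + (- 1# * (q ^ a * t ^ b′) + 0#)
        ≈⟨ modulo (^-inverse q#0 a) (modulo (^-inverse q#0 a′)
             (solve 6 (λ x y u v x⁻ y⁻ → 1: :* (y :* u) :+ (:- 1: :* (x :* v) :+ 0:)
                := x :* y :* (x⁻ :* u :- y⁻ :* v) :+ (:- (y :* u)) :* (x :* x⁻ :- 1:)
                     :+ x :* v :* (y :* y⁻ :- 1:))
               refl (q ^ a) (q ^ a′) (t ^ b) (t ^ b′) (q⁻¹ ^ a) (q⁻¹ ^ a′))) ⟩
      q ^ a * q ^ a′ * (val (a , b) - val (a′ , b′)) ∎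

  σ : Carrier
  σ = 1# - t

  -- The case distinction makes the operators total. The value 0 at equal exponents of t is a
  -- default that cannot be seen at distinct points. The decision is an argument so that proofs can
  -- split on it.
  A-dec : ∀ x y → Dec (proj₂ x ≡.≡ proj₂ y) → Carrier
  A-dec x y (yes _)  = 0#
  A-dec x y (no x⊥y) = σ * val x * inverse (separated {x} {y} x⊥y)

  A : Point → Point → Carrier
  A x y = A-dec x y (proj₂ x ℕ.≟ proj₂ y)

  A-val : ∀ {x y} → x ⊥ y → A x y * (val x - val y) ≈ σ * val x
  A-val {x} {y} x⊥y = A-dec-val (proj₂ x ℕ.≟ proj₂ y)
    where
    A-dec-val : ∀ d → A-dec x y d * (val x - val y) ≈ σ * val x
    A-dec-val (yes eq) = contradiction eq x⊥y
    A-dec-val (no _)   = trans (*-assoc _ _ _) (trans (*-congˡ (*-inverseˡ _)) (*-identityʳ _))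

  heckeData : HeckeData commutativeRing
  heckeData = record
    { Point     = Point
    ; _⊥_       = _⊥_
    ; ⊥-sym     = ≡.≢-sym
    ; shift     = shift
    ; shift-⊥   = λ x⊥y → x⊥y
    ; val       = val
    ; t         = t
    ; q⁻¹       = q⁻¹
    ; A         = A
    ; val-shift = λ _ → *-assoc _ _ _
    ; A-swap    = λ {x} {y} → A-swap {x} {y}
    ; A-val     = λ {x} {y} → A-val {x} {y}
    ; A-triple  = λ {x} {y} {z} → A-triple {x} {y} {z}
    ; A-shift   = λ {x} {y} → A-shift {x} {y}
    }
    where
    A-swap : ∀ {x y} → x ⊥ y → A x y + A y x ≈ σ
    A-swap {x} {y} x⊥y = *-cancelˡ (separated {x} {y} x⊥y)
      (modulo (A-val {x} {y} x⊥y) (modulo (A-val {y} {x} (≡.≢-sym x⊥y))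
        (solve 5 (λ p p′ s x y → (x :- y) :* (p :+ p′)
          := (x :- y) :* s :+ 1: :* (p :* (x :- y) :- s :* x) :+ (:- 1:) :* (p′ :* (y :- x) :- s :* y))
          refl (A x y) (A y x) σ (val x) (val y))))

    A-shift : ∀ {x y} → x ⊥ y → A (shift x) (shift y) ≈ A x y
    A-shift {x} {y} x⊥y = *-cancelˡ (separated {shift x} {shift y} x⊥y)
      (modulo (A-val {shift x} {shift y} x⊥y) (modulo (A-val {x} {y} x⊥y)
        (modulo {u = val (shift x)} {u′ = q⁻¹ * val x} (*-assoc _ _ _)
          (modulo {u = val (shift y)} {u′ = q⁻¹ * val y} (*-assoc _ _ _)
        (solve 8 (λ p p′ s q x y x′ y′ → (x′ :- y′) :* p′
          := (x′ :- y′) :* p :+ 1: :* (p′ :* (x′ :- y′) :- s :* x′) :+ (:- q) :* (p :* (x :- y) :- s :* x)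
               :+ (s :- p) :* (x′ :- q :* x) :+ p :* (y′ :- q :* y))
          refl (A x y) (A (shift x) (shift y)) σ q⁻¹ (val x) (val y) (val (shift x)) (val (shift y)))))))

    -- Cleared of denominators, and with σx for A x y (x - y) and likewise for the other pairs, this
    -- is σ²x times y(x - z) = x(y - z) + y(x - y) - (x - y)(y - z).
    A-triple : ∀ {x y z} → x ⊥ y → y ⊥ z → x ⊥ z → A x y * A y z ≈ A x z * (A x y + A y z - σ)
    A-triple {x} {y} {z} x⊥y y⊥z x⊥z =
      *-cancelˡ (x#0y#0→xy#0 (separated {x} {y} x⊥y) (x#0y#0→xy#0 (separated {y} {z} y⊥z) (separated {x} {z} x⊥z)))
        (trans (trans (solve 6 (λ p q r x y z → (x :- y) :* ((y :- z) :* (x :- z)) :* (p :* q)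
            := p :* (x :- y) :* (q :* (y :- z)) :* (x :- z)) refl (A x y) (A y z) (A x z) (val x) (val y) (val z))
          (*-congʳ (*-cong (A-val {x} {y} x⊥y) (A-val {y} {z} y⊥z))))
        (trans (solve 4 (λ s x y z → s :* x :* (s :* y) :* (x :- z)
            := s :* x :* (s :* x :* (y :- z) :+ s :* y :* (x :- y) :- s :* (x :- y) :* (y :- z)))
            refl σ (val x) (val y) (val z))
        (trans (*-cong (sym (A-val {x} {z} x⊥z)) (+-congʳ (+-cong
            (*-congʳ (sym (A-val {x} {y} x⊥y))) (*-congʳ (sym (A-val {y} {z} y⊥z))))))
          (solve 7 (λ p q r s x y z → r :* (x :- z) :* (p :* (x :- y) :* (y :- z) :+ q :* (y :- z) :* (x :- y)
              :- s :* (x :- y) :* (y :- z))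
            := (x :- y) :* ((y :- z) :* (x :- z)) :* (r :* (p :+ q :- s)))
            refl (A x y) (A y z) (A x z) σ (val x) (val y) (val z)))))

-- Counting entries of compositions

module CompositionCombinatorics where
  open ≡
  open ≡-Reasoning
  open import Data.Nat.Base using (_*_; _≤_; _<_; _⊓_)
  open Permutation using (prep; ↭-refl; ↭-trans; ↭-reflexive)
  open ℕ-Solver using (solve; _:=_; _:+_)

  private
    variable
      n : ℕ

  map-swap : ∀ {A B : Set} {n} (f : A → B) i (xs : Vec A (suc n)) → Vec.map f (swap i xs) ≡ swap i (Vec.map f xs)
  map-swap f zero    (x ∷ y ∷ xs) = refl
  map-swap f (suc i) (x ∷ xs)     = cong (f x ∷_) (map-swap f i xs)

  lookup-swap-inject₁ : ∀ {A : Set} {n} i (xs : Vec A (suc n)) → lookup (swap i xs) (inject₁ i) ≡ lookup xs (suc i)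
  lookup-swap-inject₁ zero    (x ∷ y ∷ xs) = refl
  lookup-swap-inject₁ (suc i) (x ∷ xs)     = lookup-swap-inject₁ i xs

  lookup-swap-suc : ∀ {A : Set} {n} i (xs : Vec A (suc n)) → lookup (swap i xs) (suc i) ≡ lookup xs (inject₁ i)
  lookup-swap-suc zero    (x ∷ y ∷ xs) = refl
  lookup-swap-suc (suc i) (x ∷ xs)     = lookup-swap-suc i xs

  ⟦_⟧ᵇ : Bool → ℕ
  ⟦ b ⟧ᵇ = if b then 1 else 0

  -- The Iverson bracket [x ≤ z]; since x < z unfolds to suc x ≤ z, le (suc x) z is [x < z].
  le : ℕ → ℕ → ℕ
  le x z = ⟦ does (x ℕ.≤? z) ⟧ᵇ

  le-true : ∀ {x z} → x ≤ z → le x z ≡ 1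
  le-true {x} {z} x≤z = cong ⟦_⟧ᵇ (dec-true (x ℕ.≤? z) x≤z)

  le-false : ∀ {x z} → z < x → le x z ≡ 0
  le-false {x} {z} z<x = cong ⟦_⟧ᵇ (dec-false (x ℕ.≤? z) (ℕ.<⇒≱ z<x))

  le-suc : ∀ x z → le (suc x) (suc z) ≡ le x z
  le-suc zero    z = refl
  le-suc (suc x) z = refl

  #≤ #< : ℕ → Vec ℕ n → ℕ
  #≤ z xs = Vec.sum (Vec.map (λ x → le x z) xs)
  #< z xs = Vec.sum (Vec.map (λ x → le (suc x) z) xs)

  -- v μ r = 1 + rank μᵣ μ r and u μ r c = rank (c - 1) μ r.
  rank : ℕ → Vec ℕ n → Fin n → ℕ
  rank z (x ∷ xs) zero    = #< z xs
  rank z (x ∷ xs) (suc r) = le x z ℕ.+ rank z xs r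

  Σᵇ : (Fin n → Bool) → ℕ
  Σᵇ {zero}  p = 0
  Σᵇ {suc n} p = ⟦ p zero ⟧ᵇ ℕ.+ Σᵇ (p ∘ suc)

  count-tabulate : ∀ {p} {A : Set} {P : Pred A p} (P? : Decidable P) (f : Fin n → A) →
                   count P? (tabulate f) ≡ Σᵇ (does ∘ P? ∘ f)
  count-tabulate {zero}  P? f = refl
  count-tabulate {suc n} P? f with does (P? (f zero))
  ... | true  = cong suc (count-tabulate P? (f ∘ suc))
  ... | false = count-tabulate P? (f ∘ suc)

  Σᵇ-false : ∀ n → Σᵇ {n} (λ _ → false) ≡ 0
  Σᵇ-false zero    = refl
  Σᵇ-false (suc n) = Σᵇ-false n

  Σᵇ-lookup : ∀ (f : ℕ → Bool) (xs : Vec ℕ n) → Σᵇ (f ∘ lookup xs) ≡ Vec.sum (Vec.map (⟦_⟧ᵇ ∘ f) xs)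
  Σᵇ-lookup f []       = refl
  Σᵇ-lookup f (x ∷ xs) = cong (⟦ f x ⟧ᵇ ℕ.+_) (Σᵇ-lookup f xs)

  rank-Σᵇ : ∀ z (μ : Vec ℕ n) r →
    Σᵇ (λ r′ → does (r′ Fin.<? r) ∧ does (lookup μ r′ ℕ.≤? z))
      ℕ.+ Σᵇ (λ r′ → does (r Fin.<? r′) ∧ does (lookup μ r′ ℕ.<? z)) ≡ rank z μ r
  rank-Σᵇ {suc n} z (x ∷ xs) zero = cong₂ ℕ._+_ (Σᵇ-false n) (Σᵇ-lookup (λ x → does (x ℕ.<? z)) xs)
  rank-Σᵇ {suc n} z (x ∷ xs) (suc r) = begin
    le x z ℕ.+ a ℕ.+ b    ≡⟨ ℕ.+-assoc (le x z) a b ⟩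
    le x z ℕ.+ (a ℕ.+ b)  ≡⟨ cong (le x z ℕ.+_) (rank-Σᵇ z xs r) ⟩
    le x z ℕ.+ rank z xs r ∎
    where
    a = Σᵇ (λ r′ → does (r′ Fin.<? r) ∧ does (lookup xs r′ ℕ.≤? z))
    b = Σᵇ (λ r′ → does (r Fin.<? r′) ∧ does (lookup xs r′ ℕ.<? z))

  u-rank : ∀ (μ : Vec ℕ n) r z → u μ r (suc z) ≡ rank z μ r
  u-rank μ r z = trans (cong₂ ℕ._+_
    (count-tabulate (λ r′ → r′ Fin.<? r ×-dec lookup μ r′ ℕ.≤? z) (λ i → i))
    (count-tabulate (λ r′ → r Fin.<? r′ ×-dec lookup μ r′ ℕ.<? z) (λ i → i)))
    (rank-Σᵇ z μ r)

  Σᵇ-cong : ∀ {p p′ : Fin n → Bool} → (∀ i → p i ≡ p′ i) → Σᵇ p ≡ Σᵇ p′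
  Σᵇ-cong {zero}  p≡p′ = refl
  Σᵇ-cong {suc n} p≡p′ = cong₂ ℕ._+_ (cong ⟦_⟧ᵇ (p≡p′ zero)) (Σᵇ-cong (p≡p′ ∘ suc))

  v-rank : ∀ (μ : Vec ℕ n) r → v ⌜ μ ⌝ r ≡ suc (rank (lookup μ r) μ r)
  v-rank μ r = cong suc (trans (cong₂ ℕ._+_
    (trans (count-tabulate (λ r′ → r′ Fin.<? r ×-dec lookup ⌜ μ ⌝ r′ ℤ.≤? lookup ⌜ μ ⌝ r) (λ i → i))
      (Σᵇ-cong λ r′ → cong (does (r′ Fin.<? r) ∧_)
        (cong₂ (λ i j → does (i ℤ.≤? j)) (Vec.lookup-map r′ +_ μ) (Vec.lookup-map r +_ μ))))
    (trans (count-tabulate (λ r′ → r Fin.<? r′ ×-dec lookup ⌜ μ ⌝ r′ ℤ.<? lookup ⌜ μ ⌝ r) (λ i → i))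
      (Σᵇ-cong λ r′ → cong (does (r Fin.<? r′) ∧_)
        (cong₂ (λ i j → does (i ℤ.<? j)) (Vec.lookup-map r′ +_ μ) (Vec.lookup-map r +_ μ)))))
    (rank-Σᵇ (lookup μ r) μ r))

  -- Only the entry `a` changes sides: on the left of a row it counts if a ≤ z, on the right if a <
  -- z. Both corrections are added rather than subtracted, which avoids truncated subtraction.
  rank-swap-inject₁ : ∀ z j (μ : Vec ℕ (suc n)) → let a = lookup μ (inject₁ j) in
                      rank z (swap j μ) (inject₁ j) ℕ.+ le a z ≡ rank z μ (suc j) ℕ.+ le (suc a) z
  rank-swap-inject₁ z zero    (a ∷ b ∷ xs) = solve 3 (λ a⁺ a r → a⁺ :+ r :+ a := a :+ r :+ a⁺) refl
    (le (suc a) z) (le a z) (#< z xs)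
  rank-swap-inject₁ z (suc j) (x ∷ xs)     = trans (ℕ.+-assoc (le x z) _ _)
    (trans (cong (le x z ℕ.+_) (rank-swap-inject₁ z j xs)) (sym (ℕ.+-assoc (le x z) _ _)))

  rank-swap-suc : ∀ z j (μ : Vec ℕ (suc n)) → let b = lookup μ (suc j) in
                  rank z (swap j μ) (suc j) ℕ.+ le (suc b) z ≡ rank z μ (inject₁ j) ℕ.+ le b z
  rank-swap-suc z zero    (a ∷ b ∷ xs) = solve 3 (λ b⁺ b r → b :+ r :+ b⁺ := b⁺ :+ r :+ b) refl (le (suc b) z)
    (le b z) (#< z xs)
  rank-swap-suc z (suc j) (x ∷ xs)     = trans (ℕ.+-assoc (le x z) _ _)
    (trans (cong (le x z ℕ.+_) (rank-swap-suc z j xs)) (sym (ℕ.+-assoc (le x z) _ _)))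

  rank-adjacent : ∀ z j (μ : Vec ℕ (suc n)) →
    rank z μ (suc j) ℕ.+ le (suc (lookup μ (suc j))) z ≡ rank z μ (inject₁ j) ℕ.+ le (lookup μ (inject₁ j)) z
  rank-adjacent z zero    (a ∷ b ∷ xs) = solve 3 (λ b⁺ a r → a :+ r :+ b⁺ := b⁺ :+ r :+ a) refl (le (suc b) z)
    (le a z) (#< z xs)
  rank-adjacent z (suc j) (x ∷ xs)     = trans (ℕ.+-assoc (le x z) _ _)
    (trans (cong (le x z ℕ.+_) (rank-adjacent z j xs)) (sym (ℕ.+-assoc (le x z) _ _)))

  #<-swap : ∀ z j (xs : Vec ℕ (suc n)) → #< z (swap j xs) ≡ #< z xs
  #<-swap z zero    (a ∷ b ∷ xs) = solve 3 (λ a b r → b :+ (a :+ r) := a :+ (b :+ r)) refl (le (suc a) z)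
    (le (suc b) z) (#< z xs)
  #<-swap z (suc j) (x ∷ xs)     = cong (_ ℕ.+_) (#<-swap z j xs)

  rank-swap-other : ∀ z j (μ : Vec ℕ (suc n)) r → r ≢ inject₁ j → r ≢ suc j → rank z (swap j μ) r ≡ rank z μ r
  rank-swap-other z zero    (a ∷ b ∷ xs) zero          r≢ r≢′ with () ← r≢ refl
  rank-swap-other z zero    (a ∷ b ∷ xs) (suc zero)    r≢ r≢′ with () ← r≢′ refl
  rank-swap-other z zero    (a ∷ b ∷ xs) (suc (suc r)) r≢ r≢′ =
    solve 3 (λ a b r → b :+ (a :+ r) := a :+ (b :+ r)) refl (le a z) (le b z) (rank z xs r)
  rank-swap-other z (suc j) (x ∷ xs)     zero          r≢ r≢′ = #<-swap z j xs
  rank-swap-other z (suc j) (x ∷ xs)     (suc r)       r≢ r≢′ =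
    cong (le x z ℕ.+_) (rank-swap-other z j xs r (r≢ ∘ cong suc) (r≢′ ∘ cong suc))

  lookup-swap-other : ∀ j (μ : Vec ℕ (suc n)) r → r ≢ inject₁ j → r ≢ suc j → lookup (swap j μ) r ≡ lookup μ r
  lookup-swap-other zero    (a ∷ b ∷ xs) zero          r≢ r≢′ with () ← r≢ refl
  lookup-swap-other zero    (a ∷ b ∷ xs) (suc zero)    r≢ r≢′ with () ← r≢′ refl
  lookup-swap-other zero    (a ∷ b ∷ xs) (suc (suc r)) r≢ r≢′ = refl
  lookup-swap-other (suc j) (x ∷ xs)     zero          r≢ r≢′ = refl
  lookup-swap-other (suc j) (x ∷ xs)     (suc r)       r≢ r≢′ =
    lookup-swap-other j xs r (r≢ ∘ cong suc) (r≢′ ∘ cong suc)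

  module _ (μ : Vec ℕ (suc n)) (j : Fin n) (μⱼ>μⱼ₊₁ : lookup μ (inject₁ j) ℕ.> lookup μ (suc j)) where
    private
      a = lookup μ (inject₁ j)
      b = lookup μ (suc j)

      cancel : ∀ {x y k l} → x ℕ.+ k ≡ y ℕ.+ l → k ≡ l → x ≡ y
      cancel {x} {y} {k} eq refl = ℕ.+-cancelʳ-≡ k x y eq

    -- An entry above z counts on neither side. This covers every box of the shorter row, and also
    -- its v, since b < a.
    rank-swap-small : ∀ {z} → z < a → rank z (swap j μ) (inject₁ j) ≡ rank z μ (suc j)
    rank-swap-small {z} z<a = cancel (rank-swap-inject₁ z j μ)
      (trans (le-false z<a) (sym (le-false (ℕ.m≤n⇒m≤1+n z<a))))

    -- The tests b ≤ z and b < z disagree only at z = b. So the exchange alters u at a single box of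
    -- the longer row, the one in column b + 1, and there `rank-swap-critical` gives the change.
    rank-swap-large : ∀ {z} → z ≢ b → rank z (swap j μ) (suc j) ≡ rank z μ (inject₁ j)
    rank-swap-large {z} z≢b with ℕ.<-cmp z b
    ... | tri< z<b _ _ = cancel (rank-swap-suc z j μ) (trans (le-false (ℕ.m≤n⇒m≤1+n z<b)) (sym (le-false z<b)))
    ... | tri≈ _ z≡b _ with () ← z≢b z≡b
    ... | tri> _ _ b<z = cancel (rank-swap-suc z j μ) (trans (le-true b<z) (sym (le-true (ℕ.<⇒≤ b<z))))

    rank-swap-critical : rank b (swap j μ) (suc j) ≡ suc (rank b μ (inject₁ j))
    rank-swap-critical = critical (rank-swap-suc b j μ) (le-false {suc b} {b} ℕ.≤-refl) (le-true {b} {b} ℕ.≤-refl)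
      where
      critical : ∀ {x y k l} → x ℕ.+ k ≡ y ℕ.+ l → k ≡ 0 → l ≡ 1 → x ≡ suc y
      critical {x} {y} eq refl refl = trans (sym (ℕ.+-identityʳ x)) (trans eq (ℕ.+-comm y 1))

    -- Neither a nor b itself is strictly below b or to be counted from the left. Hence u of the
    -- exceptional box is v of the shorter row less 1, which is how the exponent of t in E2 gets
    -- into the product.
    rank-critical : rank b μ (suc j) ≡ rank b μ (inject₁ j)
    rank-critical = cancel (rank-adjacent b j μ) (trans (le-false {suc b} {b} ℕ.≤-refl) (sym (le-false μⱼ>μⱼ₊₁)))

  #<-suc : ∀ z (xs : Vec ℕ n) → #< (suc z) xs ≡ #≤ z xs
  #<-suc z []       = refl
  #<-suc z (x ∷ xs) = cong₂ ℕ._+_ (le-suc x z) (#<-suc z xs)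

  #<-zero : ∀ (xs : Vec ℕ n) → #< 0 xs ≡ 0
  #<-zero []       = refl
  #<-zero (x ∷ xs) = #<-zero xs

  #<-∷ʳ : ∀ z (xs : Vec ℕ n) l → #< z (xs ∷ʳ l) ≡ #< z xs ℕ.+ le (suc l) z
  #<-∷ʳ z []       l = ℕ.+-identityʳ _
  #<-∷ʳ z (x ∷ xs) l = trans (cong (_ ℕ.+_) (#<-∷ʳ z xs l)) (sym (ℕ.+-assoc (le (suc x) z) _ _))

  rank-∷ʳ-last : ∀ z (xs : Vec ℕ n) l → rank z (xs ∷ʳ l) (fromℕ n) ≡ #≤ z xs
  rank-∷ʳ-last z []       l = refl
  rank-∷ʳ-last z (x ∷ xs) l = cong (le x z ℕ.+_) (rank-∷ʳ-last z xs l)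

  -- The right-hand side is a rank in `suc l ∷ μ`: an entry l at the right end and an entry l + 1 at
  -- the left end count under the same condition.
  rank-∷ʳ-inject₁ : ∀ z (xs : Vec ℕ n) l r → rank z (xs ∷ʳ l) (inject₁ r) ≡ le (suc l) z ℕ.+ rank z xs r
  rank-∷ʳ-inject₁ z (x ∷ xs) l zero    = trans (#<-∷ʳ z xs l) (ℕ.+-comm _ (le (suc l) z))
  rank-∷ʳ-inject₁ z (x ∷ xs) l (suc r) = trans (cong (le x z ℕ.+_) (rank-∷ʳ-inject₁ z xs l r))
    (solve 3 (λ a b c → a :+ (b :+ c) := b :+ (a :+ c)) refl (le x z) (le (suc l) z) (rank z xs r))

  lookup-∷ʳ-inject₁ : ∀ {A : Set} (xs : Vec A n) l r → lookup (xs ∷ʳ l) (inject₁ r) ≡ lookup xs r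
  lookup-∷ʳ-inject₁ (x ∷ xs) l zero    = refl
  lookup-∷ʳ-inject₁ (x ∷ xs) l (suc r) = lookup-∷ʳ-inject₁ xs l r

  lookup-∷ʳ-last : ∀ {A : Set} (xs : Vec A n) l → lookup (xs ∷ʳ l) (fromℕ n) ≡ l
  lookup-∷ʳ-last []       l = refl
  lookup-∷ʳ-last (x ∷ xs) l = lookup-∷ʳ-last xs l

  rank-replicate : ∀ (r : Fin n) → rank 0 (Vec.replicate n 0) r ≡ toℕ r
  rank-replicate {suc n} zero    = #<-zero (Vec.replicate n 0)
  rank-replicate {suc n} (suc r) = cong suc (rank-replicate r)

  #> : ℕ → Vec ℕ n → ℕ
  #> z xs = Vec.sum (Vec.map (le (suc z)) xs)

  #≤+#> : ∀ z (xs : Vec ℕ n) → #≤ z xs ℕ.+ #> z xs ≡ n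
  #≤+#> z []       = refl
  #≤+#> z (x ∷ xs) = trans (solve 4 (λ a b c d → a :+ b :+ (c :+ d) := (a :+ c) :+ (b :+ d)) refl (le x z) _
    (le (suc z) x) _)
    (cong₂ ℕ._+_ (trichotomy x z) (#≤+#> z xs))
    where
    trichotomy : ∀ x z → le x z ℕ.+ le (suc z) x ≡ 1
    trichotomy x z with ℕ.≤-<-connex x z
    ... | inj₁ x≤z = cong₂ ℕ._+_ (le-true x≤z) (le-false (s≤s x≤z))
    ... | inj₂ z<x = cong₂ ℕ._+_ (le-false z<x) (le-true z<x)

  -- The exponent n(λ)

  minSum : List ℕ → ℕ
  minSum []       = 0
  minSum (x ∷ xs) = sum (List.map (x ⊓_) xs) ℕ.+ minSum xs

  minSum-↭ : ∀ {xs ys} → xs ↭ ys → minSum xs ≡ minSum ys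
  minSum-↭ Permutation.refl = refl
  minSum-↭ (prep x p) = cong₂ ℕ._+_ (sum-↭ (↭.map⁺ (x ⊓_) p)) (minSum-↭ p)
  minSum-↭ (Permutation.swap {xs} {ys} x y p) = begin
    x ⊓ y ℕ.+ sum (List.map (x ⊓_) xs) ℕ.+ (sum (List.map (y ⊓_) xs) ℕ.+ minSum xs)
      ≡⟨ cong₂ (λ i j → i ℕ.+ sum (List.map (x ⊓_) xs) ℕ.+ (sum (List.map (y ⊓_) xs) ℕ.+ j)) (ℕ.⊓-comm x y)
        (minSum-↭ p) ⟩
    y ⊓ x ℕ.+ sum (List.map (x ⊓_) xs) ℕ.+ (sum (List.map (y ⊓_) xs) ℕ.+ minSum ys)
      ≡⟨ cong₂ (λ i j → y ⊓ x ℕ.+ i ℕ.+ (j ℕ.+ minSum ys)) (sum-↭ (↭.map⁺ (x ⊓_) p)) (sum-↭ (↭.map⁺ (y ⊓_) p)) ⟩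
    y ⊓ x ℕ.+ sum (List.map (x ⊓_) ys) ℕ.+ (sum (List.map (y ⊓_) ys) ℕ.+ minSum ys)
      ≡⟨ solve 4 (λ a b c d → a :+ b :+ (c :+ d) := a :+ c :+ (b :+ d)) refl (y ⊓ x) _ _ (minSum ys) ⟩
    y ⊓ x ℕ.+ sum (List.map (y ⊓_) ys) ℕ.+ (sum (List.map (x ⊓_) ys) ℕ.+ minSum ys) ∎
  minSum-↭ (Permutation.trans p p′) = trans (minSum-↭ p) (minSum-↭ p′)

  toList-swap : ∀ j (μ : Vec ℕ (suc n)) → Vec.toList (swap j μ) ↭ Vec.toList μ
  toList-swap zero    (x ∷ y ∷ xs) = Permutation.swap y x ↭-refl
  toList-swap (suc j) (x ∷ xs)     = prep x (toList-swap j xs)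

  -- min(l + 1, x) exceeds min(l, x) by 1 exactly when x > l, and by 0 otherwise.
  minSum-rotate : ∀ (μ : Vec ℕ n) l → minSum (Vec.toList (suc l ∷ μ)) ≡ #> l μ ℕ.+ minSum (Vec.toList (μ ∷ʳ l))
  minSum-rotate μ l = trans (cong (ℕ._+ minSum (Vec.toList μ)) (step μ)) (trans (ℕ.+-assoc (#> l μ) _ _)
    (cong (#> l μ ℕ.+_) (minSum-↭ (↭-trans (↭.∷↭∷ʳ l (Vec.toList μ)) (↭-reflexive (sym (Vec.toList-∷ʳ l μ)))))))
    where
    min-suc : ∀ l x → suc l ⊓ x ≡ le (suc l) x ℕ.+ l ⊓ x
    min-suc l x with ℕ.≤-<-connex x l
    ... | inj₁ x≤l = trans (ℕ.m≥n⇒m⊓n≡n (ℕ.m≤n⇒m≤1+n x≤l))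
      (sym (cong₂ ℕ._+_ (le-false (s≤s x≤l)) (ℕ.m≥n⇒m⊓n≡n x≤l)))
    ... | inj₂ l<x = trans (ℕ.m≤n⇒m⊓n≡m l<x) (sym (cong₂ ℕ._+_ (le-true l<x) (ℕ.m≤n⇒m⊓n≡m (ℕ.<⇒≤ l<x))))
    step : ∀ {n} (μ : Vec ℕ n) → sum (List.map (suc l ⊓_) (Vec.toList μ)) ≡ #> l μ ℕ.+ sum
      (List.map (l ⊓_) (Vec.toList μ))
    step []       = refl
    step (x ∷ xs) = trans (cong₂ ℕ._+_ (min-suc l x) (step xs))
      (solve 4 (λ a b c d → a :+ b :+ (c :+ d) := a :+ c :+ (b :+ d)) refl (le (suc l) x) (l ⊓ x) (#> l xs) _)

  -- In a decreasing sequence the minimum of a pair is its later entry, and the entry of index i,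
  -- counted from 0, is the later one in i pairs.
  n⟨⟩-minSum : ∀ (ν : Vec ℕ n) → (∀ {i j} → i Fin.≤ j → lookup ν j ≤ lookup ν i) → n⟨ ν ⟩ ≡ minSum (Vec.toList ν)
  n⟨⟩-minSum []       decreasing = refl
  n⟨⟩-minSum (x ∷ xs) decreasing = trans (weighted xs) (cong₂ ℕ._+_
    (bounded xs (λ i → decreasing {zero} {suc i} z≤n))
    (n⟨⟩-minSum xs (λ i≤j → decreasing (s≤s i≤j))))
    where
    weighted : ∀ {n} (xs : Vec ℕ n) → Vec.sum (tabulate λ i → suc (toℕ i) * lookup xs i) ≡ Vec.sum xs ℕ.+ n⟨ xs ⟩
    -- The weights are generalised because the recursion replaces `toℕ` by `toℕ ∘ suc`.
    weighted xs = go xs toℕ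
      where
      go : ∀ {n} (xs : Vec ℕ n) (f : Fin n → ℕ) → Vec.sum (tabulate λ i → suc (f i) * lookup xs i)
             ≡ Vec.sum xs ℕ.+ Vec.sum (tabulate λ i → f i * lookup xs i)
      go []       f = refl
      go (x ∷ xs) f = trans (cong (_ ℕ.+_) (go xs (f ∘ suc)))
        (solve 4 (λ x y a b → (x :+ y) :+ (a :+ b) := (x :+ a) :+ (y :+ b)) refl x (f zero * x) (Vec.sum xs) _)
    bounded : ∀ {n} (xs : Vec ℕ n) → (∀ i → lookup xs i ≤ x) → Vec.sum xs ≡ sum (List.map (x ⊓_) (Vec.toList xs))
    bounded []       xs≤x = refl
    bounded (y ∷ xs) xs≤x = cong₂ ℕ._+_ (sym (ℕ.m≥n⇒m⊓n≡n (xs≤x zero))) (bounded xs (xs≤x ∘ suc))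

  swap-involutive : ∀ {A : Set} j (xs : Vec A (suc n)) → swap j (swap j xs) ≡ xs
  swap-involutive zero    (x ∷ y ∷ xs) = refl
  swap-involutive (suc j) (x ∷ xs)     = cong (x ∷_) (swap-involutive j xs)

  sum-swap : ∀ j (μ : Vec ℕ (suc n)) → Vec.sum (swap j μ) ≡ Vec.sum μ
  sum-swap zero    (x ∷ y ∷ xs) = solve 3 (λ x y r → y :+ (x :+ r) := x :+ (y :+ r)) refl x y (Vec.sum xs)
  sum-swap (suc j) (x ∷ xs)     = cong (x ℕ.+_) (sum-swap j xs)

  sum-∷ʳ : ∀ (μ : Vec ℕ n) l → Vec.sum (μ ∷ʳ l) ≡ l ℕ.+ Vec.sum μ
  sum-∷ʳ []       l = refl
  sum-∷ʳ (x ∷ xs) l = trans (cong (x ℕ.+_) (sum-∷ʳ xs l))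
    (solve 3 (λ x l r → x :+ (l :+ r) := l :+ (x :+ r)) refl x l (Vec.sum xs))

  sum≡0⇒replicate : ∀ (μ : Vec ℕ n) → Vec.sum μ ≡ 0 → μ ≡ Vec.replicate n 0
  sum≡0⇒replicate []          _  = refl
  sum≡0⇒replicate (zero ∷ xs) eq = cong (0 ∷_) (sum≡0⇒replicate xs eq)

  sum>0⇒positive : ∀ {s} (μ : Vec ℕ n) → Vec.sum μ ≡ suc s → ∃ λ i → 0 < lookup μ i
  sum>0⇒positive (zero ∷ xs)  eq = let i , xᵢ>0 = sum>0⇒positive xs eq in suc i , xᵢ>0
  sum>0⇒positive (suc _ ∷ xs) eq = zero , s≤s z≤n

  -- A positive entry of μ can be moved to the front by undoing steps that exchange μⱼ > μⱼ₊₁, and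
  -- once it is there a rotation can be undone.
  composition-induction : ∀ {p} (P : Vec ℕ (suc n) → Set p) →
    P (Vec.replicate _ 0) →
    (∀ μ l → P (μ ∷ʳ l) → P (suc l ∷ μ)) →
    (∀ μ j → lookup μ (inject₁ j) ℕ.> lookup μ (suc j) → P μ → P (swap j μ)) →
    ∀ μ → P μ
  composition-induction {n} P base rotate exchange μ = bySize _ μ refl
    where
    bySize : ∀ s μ → Vec.sum μ ≡ s → P μ
    bySize zero    μ eq = subst P (sym (sum≡0⇒replicate μ eq)) base
    bySize (suc s) μ eq with i , μᵢ>0 ← sum>0⇒positive μ eq =
      Fin.<-weakInduction (λ i → ∀ μ → Vec.sum μ ≡ suc s → 0 < lookup μ i → P μ) front move i μ eq μᵢ>0
      where
      front : ∀ μ → Vec.sum μ ≡ suc s → 0 < lookup μ zero → P μ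
      front (suc l ∷ μ) eq _ = rotate μ l (bySize s (μ ∷ʳ l) (trans (sum-∷ʳ μ l) (ℕ.suc-injective eq)))

      move : ∀ j → (∀ μ → Vec.sum μ ≡ suc s → 0 < lookup μ (inject₁ j) → P μ) →
             ∀ μ → Vec.sum μ ≡ suc s → 0 < lookup μ (suc j) → P μ
      move j ih μ eq μⱼ₊₁>0 with ℕ.<-≤-connex (lookup μ (inject₁ j)) (lookup μ (suc j))
      ... | inj₁ μⱼ<μⱼ₊₁ = subst P (swap-involutive j μ) (exchange (swap j μ) j
        (subst₂ _<_ (sym (lookup-swap-suc j μ)) (sym (lookup-swap-inject₁ j μ)) μⱼ<μⱼ₊₁)
        (ih (swap j μ) (trans (sum-swap j μ) eq) (subst (0 <_) (sym (lookup-swap-inject₁ j μ)) μⱼ₊₁>0)))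
      ... | inj₂ μⱼ≥μⱼ₊₁ = ih μ eq (ℕ.<-≤-trans μⱼ₊₁>0 μⱼ≥μⱼ₊₁)

  minSum-replicate : ∀ n → minSum (Vec.toList (Vec.replicate n 0)) ≡ 0
  minSum-replicate zero    = refl
  minSum-replicate (suc n) = cong₂ ℕ._+_ (zeros n) (minSum-replicate n)
    where
    zeros : ∀ n → sum (List.map (0 ⊓_) (Vec.toList (Vec.replicate n 0))) ≡ 0
    zeros zero    = refl
    zeros (suc n) = zeros n

open CompositionCombinatorics

-- Evaluation of Laurent polynomials at the points

module Evaluation
  {c ℓ₁ ℓ₂ c′ ℓ₁′ ℓ₂′} {k : HeytingField c ℓ₁ ℓ₂} (K : RationalFunctionField k c′ ℓ₁′ ℓ₂′) (m : ℕ) where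

  open RationalFunctionField K using (heytingField; commutativeRing; q)
  open CommutativeRing commutativeRing hiding (zero; Carrier; _≈_; _+_; _*_; _-_; -_; 0#; 1#)
  open Macdonald K m
  open RingProperties ring using (-‿distribˡ-*)
  open FieldLemmas K
  open IntegerRingSolver commutativeRing
  open SetoidReasoning setoid
  open BigOperator *-commutativeMonoid using () renaming (sum-cong-≋ to prod-cong)
  open Hecke commutativeRing heckeData

  module _ (y : Fin (suc m) → K*) where

    monomial : Vec ℤ (suc m) → Carrier
    monomial α = prod λ i → y i ^ᶻ lookup α i

    evaluate-++ : ∀ f g → evaluate y (f ++ g) ≈ evaluate y f + evaluate y g
    evaluate-++ []            g = sym (+-identityˡ _)
    evaluate-++ ((a , α) ∷ f) g = trans (+-congˡ (evaluate-++ f g)) (sym (+-assoc _ _ _))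

    evaluate-· : ∀ a f → evaluate y (a · f) ≈ a * evaluate y f
    evaluate-· a []            = sym (zeroʳ a)
    evaluate-· a ((b , β) ∷ f) = trans (+-cong (*-assoc _ _ _) (evaluate-· a f)) (sym (distribˡ a _ _))

    evaluate-minus : ∀ f g → evaluate y (f -ᴸ g) ≈ evaluate y f - evaluate y g
    evaluate-minus f g = trans (evaluate-++ f _) (+-congˡ (trans (evaluate-· (- 1#) g)
      (trans (sym (-‿distribˡ-* _ _)) (-‿cong (*-identityˡ _)))))

    private
      _≟_ = Vec.≡-dec {n = suc m} ℤ._≟_

    coeff-++ : ∀ f g α → coeff (f ++ g) α ≈ coeff f α + coeff g α
    coeff-++ []            g α = sym (+-identityˡ _)
    coeff-++ ((a , β) ∷ f) g α = trans (+-congˡ (coeff-++ f g α)) (sym (+-assoc _ _ _))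

    coeff-· : ∀ a f α → coeff (a · f) α ≈ a * coeff f α
    coeff-· a []            α = sym (zeroʳ a)
    coeff-· a ((b , β) ∷ f) α = trans (+-cong (scale (does (β ≟ α))) (coeff-· a f α)) (sym (distribˡ a _ _))
      where
      scale : ∀ d → (if d then a * b else 0#) ≈ a * (if d then b else 0#)
      scale true  = refl
      scale false = sym (zeroʳ a)

    -- Term lists may repeat exponents in any order, so `evaluate` does not respect `_≈ᴸ_` by a
    -- structural induction. Removing all terms of one exponent at a time provides the induction.
    without : Vec ℤ (suc m) → Laurent → Laurent
    without α []            = []
    without α ((b , β) ∷ f) = if does (β ≟ α) then without α f else (b , β) ∷ without α f

    length-without : ∀ α f → List.length (without α f) ℕ.≤ List.length f
    length-without α []            = z≤n
    length-without α ((b , β) ∷ f) with does (β ≟ α)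
    ... | true  = ℕ.m≤n⇒m≤1+n (length-without α f)
    ... | false = s≤s (length-without α f)

    evaluate-without : ∀ α f → evaluate y f ≈ coeff f α * monomial α + evaluate y (without α f)
    evaluate-without α []            = solve 1 (λ z → 0: := 0: :* z :+ 0:) refl _
    evaluate-without α ((b , β) ∷ f) = trans (+-congˡ (evaluate-without α f)) (split (β ≟ α))
      where
      split : ∀ (d : Dec (β ≡ α)) → b * monomial β + (coeff f α * monomial α + evaluate y (without α f))
        ≈ ((if does d then b else 0#) + coeff f α) * monomial α
            + evaluate y (if does d then without α f else (b , β) ∷ without α f)
      split (yes ≡.refl) = solve 4 (λ b z k w → b :* z :+ (k :* z :+ w) := (b :+ k) :* z :+ w) refl _ _ _ _
      split (no _)       = solve 4 (λ b z k w → b :+ (k :* z :+ w) := (0: :+ k) :* z :+ (b :+ w)) refl _ _ _ _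

    coeff-without-same : ∀ α f → coeff (without α f) α ≈ 0#
    coeff-without-same α []            = refl
    coeff-without-same α ((b , β) ∷ f) = split (β ≟ α)
      where
      split : ∀ (d : Dec (β ≡ α)) → coeff (if does d then without α f else (b , β) ∷ without α f) α ≈ 0#
      split (yes _)   = coeff-without-same α f
      split (no β≢α) rewrite dec-false (β ≟ α) β≢α = trans (+-identityˡ _) (coeff-without-same α f)

    coeff-without-other : ∀ {α γ} → α ≡.≢ γ → ∀ f → coeff (without α f) γ ≈ coeff f γ
    coeff-without-other         α≢γ []            = refl
    coeff-without-other {α} {γ} α≢γ ((b , β) ∷ f) = split (β ≟ α)
      where
      split : ∀ (d : Dec (β ≡ α)) → coeff (if does d then without α f else (b , β) ∷ without α f) γ
                ≈ (if does (β ≟ γ) then b else 0#) + coeff f γ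
      split (yes ≡.refl) rewrite dec-false (β ≟ γ) α≢γ = trans (coeff-without-other α≢γ f) (sym (+-identityˡ _))
      split (no _)       = +-congˡ (coeff-without-other α≢γ f)

    -- `n` bounds the length, since `without β f` is not a subterm of `f`. Each step drops the
    -- exponent of the first term, whose total coefficient vanishes.
    evaluate-null : ∀ n f → List.length f ℕ.≤ n → (∀ α → coeff f α ≈ 0#) → evaluate y f ≈ 0#
    evaluate-null n       []                _         null = refl
    evaluate-null (suc n) f@((b , β) ∷ f′) (s≤s f≤n) null = begin
      evaluate y f                                            ≈⟨ evaluate-without β f ⟩
      coeff f β * monomial β + evaluate y (without β f)
        ≈⟨ +-cong (trans (*-congʳ (null β)) (zeroˡ _)) (evaluate-null n (without β f) shorter null′) ⟩
      0# + 0#                                                 ≈⟨ +-identityˡ 0# ⟩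
      0#                                                      ∎
      where
      shorter : List.length (without β f) ℕ.≤ n
      shorter rewrite dec-true (β ≟ β) ≡.refl = ℕ.≤-trans (length-without β f′) f≤n
      null′ : ∀ α → coeff (without β f) α ≈ 0#
      null′ α with β ≟ α
      ... | yes ≡.refl = coeff-without-same β f
      ... | no β≢α     = trans (coeff-without-other β≢α f) (null α)

    evaluate-cong : ∀ f g → f ≈ᴸ g → evaluate y f ≈ evaluate y g
    evaluate-cong f g f≈g = begin
      evaluate y f
        ≈⟨ solve 2 (λ a b → a := b :+ (a :- b)) refl _ (evaluate y g) ⟩
      evaluate y g + (evaluate y f - evaluate y g)
        ≈⟨ +-congˡ (evaluate-minus f g) ⟨
      evaluate y g + evaluate y (f -ᴸ g)
        ≈⟨ +-congˡ (evaluate-null _ (f -ᴸ g) ℕ.≤-refl λ α → trans (coeff-++ f _ α)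
             (trans (+-cong (f≈g α) (coeff-· (- 1#) g α)) (solve 1 (λ a → a :+ (:- 1:) :* a := 0:) refl _))) ⟩
      evaluate y g + 0#
        ≈⟨ +-identityʳ _ ⟩
      evaluate y g ∎

  evaluate-pointwise : ∀ y z f → (∀ i → proj₁ (y i) ≈ proj₁ (z i)) → evaluate y f ≈ evaluate z f
  evaluate-pointwise y z []            y≈z = refl
  evaluate-pointwise y z ((a , α) ∷ f) y≈z = +-cong
    (*-congˡ (prod-cong λ i → ^ᶻ-cong (y i) (z i) (y≈z i) (lookup α i))) (evaluate-pointwise y z f y≈z)

  monomialAt : ∀ {n} → Vec Point n → Vec ℤ n → Carrier
  monomialAt y α = prod λ i → point (lookup y i) ^ᶻ lookup α i

  monomialAt-+ : ∀ {n} (y : Vec Point n) α β →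
                 monomialAt y (Vec.zipWith ℤ._+_ α β) ≈ monomialAt y α * monomialAt y β
  monomialAt-+ []      []      []      = sym (*-identityˡ 1#)
  monomialAt-+ (x ∷ y) (a ∷ α) (b ∷ β) = trans (*-cong (^ᶻ-homo-+ (point x) a b) (monomialAt-+ y α β))
    (solve 4 (λ a b c d → a :* b :* (c :* d) := a :* c :* (b :* d)) refl _ _ _ _)

  monomialAt-0 : ∀ {n} (y : Vec Point n) → monomialAt y (Vec.replicate n 0ℤ) ≈ 1#
  monomialAt-0 []      = refl
  monomialAt-0 (_ ∷ y) = trans (*-identityˡ _) (monomialAt-0 y)

  monomialAt-x : ∀ {n} (y : Vec Point n) i → monomialAt y (Vec.replicate n 0ℤ [ i ]≔ 1ℤ) ≈ val (lookup y i)
  monomialAt-x (x ∷ y) zero    = trans (*-cong (*-identityʳ _) (monomialAt-0 y)) (*-identityʳ _)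
  monomialAt-x (_ ∷ y) (suc i) = trans (*-identityˡ _) (monomialAt-x y i)

  monomialAt-swap : ∀ {n} i (y : Vec Point (suc n)) α → monomialAt y (swap i α) ≈ monomialAt (swap i y) α
  monomialAt-swap zero    (x ∷ x′ ∷ y) (a ∷ b ∷ α) = solve 3 (λ a b c → a :* (b :* c) := b :* (a :* c)) refl _ _ _
  monomialAt-swap (suc i) (x ∷ y)      (a ∷ α)     = *-congˡ (monomialAt-swap i y α)

  monomialAt-∷ʳ : ∀ {n} (y : Vec Point n) x α a →
                  monomialAt (y ∷ʳ x) (α ∷ʳ a) ≈ point x ^ᶻ a * monomialAt y α
  monomialAt-∷ʳ []       x []      a = refl
  monomialAt-∷ʳ (x′ ∷ y) x (b ∷ α) a = trans (*-congˡ (monomialAt-∷ʳ y x α a))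
    (solve 3 (λ a b c → a :* (b :* c) := b :* (a :* c)) refl _ _ _)

  monomialAt-rotate : ∀ {n} x (y : Vec Point n) α → q* ^ᶻ (ℤ.- Vec.last α) * monomialAt (x ∷ y)
    (Vec.last α ∷ Vec.init α)
                        ≈ monomialAt (y ∷ʳ shift x) α
  monomialAt-rotate x y α = rotated (Vec.init α) (Vec.last α) (proj₂ (proj₂ (Vec.initLast α)))
   where
   rotated : ∀ β a → α ≡ β ∷ʳ a →
             q* ^ᶻ (ℤ.- a) * (point x ^ᶻ a * monomialAt y β) ≈ monomialAt (y ∷ʳ shift x) α
   rotated β a ≡.refl = begin
    q* ^ᶻ (ℤ.- a) * (point x ^ᶻ a * monomialAt y β)
      ≈⟨ *-assoc _ _ _ ⟨
    q* ^ᶻ (ℤ.- a) * point x ^ᶻ a * monomialAt y β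
      ≈⟨ *-congʳ (^ᶻ-mulInverse q* (point x) (point (shift x)) (*-assoc _ _ _) a) ⟩
    point (shift x) ^ᶻ a * monomialAt y β
      ≈⟨ monomialAt-∷ʳ y (shift x) β a ⟨
    monomialAt (y ∷ʳ shift x) (β ∷ʳ a) ∎

  points : Vec Point (suc m) → Fin (suc m) → K*
  points y i = point (lookup y i)

  ev : Laurent → V (suc m)
  ev f y = evaluate (points y) f

  ev-*ᴸ : ∀ f g → ev (f *ᴸ g) ≗ λ y → ev f y * ev g y
  ev-*ᴸ []            g y = sym (zeroˡ _)
  ev-*ᴸ ((a , α) ∷ f) g y = begin
    ev (List.map (term a α) g ++ f *ᴸ g) y                  ≈⟨ evaluate-++ (points y) (List.map (term a α) g)
      (f *ᴸ g) ⟩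
    ev (List.map (term a α) g) y + ev (f *ᴸ g) y            ≈⟨ +-cong (row g) (ev-*ᴸ f g y) ⟩
    a * monomialAt y α * ev g y + ev f y * ev g y           ≈⟨ distribʳ _ _ _ ⟨
    ev ((a , α) ∷ f) y * ev g y                             ∎
    where
    term : Carrier → Vec ℤ (suc m) → Carrier × Vec ℤ (suc m) → Carrier × Vec ℤ (suc m)
    term a α (b , β) = a * b , Vec.zipWith ℤ._+_ α β
    row : ∀ g → ev (List.map (term a α) g) y ≈ a * monomialAt y α * ev g y
    row []            = sym (zeroʳ _)
    row ((b , β) ∷ g) = trans (+-cong (*-congˡ (monomialAt-+ y α β)) (row g))
      (solve 5 (λ a b c d e → a :* b :* (c :* d) :+ a :* c :* e := a :* c :* (b :* d :+ e)) refl _ _ _ _ _)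

  ev-x : ∀ i → ev (x i) ≗ λ y → val (lookup y i)
  ev-x i y = trans (+-identityʳ _) (trans (*-identityˡ _) (monomialAt-x y i))

  ev-s : ∀ i f y → ev (s i f) y ≈ ev f (swap i y)
  ev-s i []            y = refl
  ev-s i ((a , α) ∷ f) y = +-cong (*-congˡ (monomialAt-swap i y α)) (ev-s i f y)

  ev-rotate : ∀ f → ev (rotate f) ≗ g (ev f)
  ev-rotate []            y       = refl
  ev-rotate ((a , α) ∷ f) (x ∷ y) =
    +-cong (trans (*-assoc _ _ _) (*-congˡ (monomialAt-rotate x y α))) (ev-rotate f (x ∷ y))

  coef-lookup : ∀ {n} (i : Fin n) y → coef i y ≡ A (lookup y (inject₁ i)) (lookup y (suc i))
  coef-lookup zero    (a ∷ b ∷ y) = ≡.refl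
  coef-lookup (suc i) (x ∷ y)     = coef-lookup i y

  lookup-distinct : ∀ {n} (i : Fin n) {y} → Distinct y → lookup y (inject₁ i) ⊥ lookup y (suc i)
  lookup-distinct zero    {a ∷ b ∷ y} ((a⊥b ∷ᵃ _) ∷ _) = a⊥b
  lookup-distinct (suc i) {x ∷ y}     (_ ∷ d)          = lookup-distinct i d

  ev-∂ : ∀ i f h → h is-∂[ i ] f → ∀ y →
         (val (lookup y (inject₁ i)) - val (lookup y (suc i))) * ev h y ≈ ev f y - ev f (swap i y)
  ev-∂ i f h is-∂ y = begin
    (val (lookup y (inject₁ i)) - val (lookup y (suc i))) * ev h y
      ≈⟨ *-congʳ (+-cong (ev-x (inject₁ i) y) (-‿cong (ev-x (suc i) y))) ⟨
    (ev (x (inject₁ i)) y - ev (x (suc i)) y) * ev h y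
      ≈⟨ *-congʳ (evaluate-minus (points y) (x (inject₁ i)) (x (suc i))) ⟨
    ev (x (inject₁ i) -ᴸ x (suc i)) y * ev h y
      ≈⟨ ev-*ᴸ (x (inject₁ i) -ᴸ x (suc i)) h y ⟨
    ev ((x (inject₁ i) -ᴸ x (suc i)) *ᴸ h) y
      ≈⟨ evaluate-cong (points y) ((x (inject₁ i) -ᴸ x (suc i)) *ᴸ h) (f -ᴸ s i f) is-∂ ⟩
    ev (f -ᴸ s i f) y
      ≈⟨ evaluate-minus (points y) f (s i f) ⟩
    ev f y - ev (s i f) y
      ≈⟨ +-congˡ (-‿cong (ev-s i f y)) ⟩
    ev f y - ev f (swap i y) ∎

  -- E1 and E2 as identities of operators

  module Family (E : Vec ℤ (suc m) → Laurent) (isFamily : IsMacdonaldFamily E) where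
    open IsMacdonaldFamily isFamily

    F : Vec ℕ (suc m) → V (suc m)
    F μ = ev (E ⌜ μ ⌝)

    F-zero : F (Vec.replicate _ 0) ≗ one
    F-zero y = begin
      ev (E ⌜ Vec.replicate _ 0 ⌝) y     ≡⟨ ≡.cong (λ μ → ev (E μ) y) (Vec.map-replicate +_ 0 (suc m)) ⟩
      ev (E (Vec.replicate _ 0ℤ)) y      ≈⟨ evaluate-cong (points y) (E (Vec.replicate _ 0ℤ))
        (x^ Vec.replicate _ 0ℤ) E0 ⟩
      ev (x^ Vec.replicate _ 0ℤ) y       ≈⟨ trans (+-identityʳ _) (*-identityˡ _) ⟩
      monomialAt y (Vec.replicate _ 0ℤ)  ≈⟨ monomialAt-0 y ⟩
      1#                                 ∎

    F-rotate : ∀ (μ : Vec ℕ m) l → F (suc l ∷ μ) ≗ (q ^ l) ⊛ τ (F (μ ∷ʳ l))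
    F-rotate μ l y@(x₀ ∷ _) = begin
      ev (E ⌜ suc l ∷ μ ⌝) y
        ≡⟨ ≡.cong (λ μ → ev (E μ) y) (exponent (Vec.map-∷ʳ +_ l μ)) ⟩
      ev (E (Vec.last α ℤ.+ 1ℤ ∷ Vec.init α)) y
        ≈⟨ evaluate-cong (points y) (E (Vec.last α ℤ.+ 1ℤ ∷ Vec.init α))
          (q* ^ᶻ Vec.last α · (x zero *ᴸ rotate (E α))) (E1 α) ⟩
      ev (q* ^ᶻ Vec.last α · (x zero *ᴸ rotate (E α))) y
        ≈⟨ evaluate-· (points y) (q* ^ᶻ Vec.last α) (x zero *ᴸ rotate (E α)) ⟩
      q* ^ᶻ Vec.last α * ev (x zero *ᴸ rotate (E α)) y
        ≡⟨ ≡.cong (λ a → q* ^ᶻ a * ev (x zero *ᴸ rotate (E α)) y)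
          (≡.trans (≡.cong Vec.last (Vec.map-∷ʳ +_ l μ)) (Vec.last-∷ʳ (+ l) ⌜ μ ⌝)) ⟩
      q ^ l * ev (x zero *ᴸ rotate (E α)) y
        ≈⟨ *-congˡ (ev-*ᴸ (x zero) (rotate (E α)) y) ⟩
      q ^ l * (ev (x zero) y * ev (rotate (E α)) y)
        ≈⟨ *-congˡ (*-cong (ev-x zero y) (ev-rotate (E α) y)) ⟩
      ((q ^ l) ⊛ τ (F (μ ∷ʳ l))) y ∎
      where
      α = ⌜ μ ∷ʳ l ⌝
      exponent : ∀ {α : Vec ℤ (suc m)} → α ≡ ⌜ μ ⌝ ∷ʳ + l → ⌜ suc l ∷ μ ⌝ ≡ Vec.last α ℤ.+ 1ℤ ∷ Vec.init α
      exponent ≡.refl = ≡.cong₂ _∷_ (≡.trans (≡.cong +_ (ℕ.+-comm 1 l))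
        (≡.cong (ℤ._+ 1ℤ) (≡.sym (Vec.last-∷ʳ (+ l) ⌜ μ ⌝))))
        (≡.sym (Vec.init-∷ʳ (+ l) ⌜ μ ⌝))

    ratio : ∀ (μ : Vec ℕ (suc m)) (i : Fin m) → Carrier
    ratio μ i = qt (+ lookup μ (inject₁ i) ℤ.- + lookup μ (suc i)) (+ v ⌜ μ ⌝ (inject₁ i) ℤ.- + v ⌜ μ ⌝ (suc i))

    module _ (μ : Vec ℕ (suc m)) (i : Fin m) (μᵢ>μᵢ₊₁ : lookup μ (inject₁ i) ℕ.> lookup μ (suc i)) where

      1-ratio#0 : 1# - ratio μ i # 0#
      1-ratio#0 = 1-qt#0 (+ v ⌜ μ ⌝ (inject₁ i) ℤ.- + v ⌜ μ ⌝ (suc i)) (m>n⇒0<m-n μᵢ>μᵢ₊₁)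

      swapCoefficient : Carrier
      swapCoefficient = (1# - t) * ratio μ i / (1# - ratio μ i) by 1-ratio#0

      private
        xE : Laurent
        xE = x (inject₁ i) *ᴸ E ⌜ μ ⌝

      ev-xE : ∀ y → ev xE y ≈ val (lookup y (inject₁ i)) * F μ y
      ev-xE y = trans (ev-*ᴸ (x (inject₁ i)) (E ⌜ μ ⌝) y) (*-congʳ (ev-x (inject₁ i) y))

      -- The origin of `A`: in ∂ᵢ(xᵢF) - t xᵢ∂ᵢF the coefficient of F is (1 - t)xᵢ / (xᵢ - xᵢ₊₁),
      -- and it adds up to 1 with that of the exchanged F. The common denominator is cancelled,
      -- which requires a distinct point.
      ev-T : ∀ ∂xE ∂E → ∂xE is-∂[ i ] xE → ∂E is-∂[ i ] E ⌜ μ ⌝ →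
             (λ y → ev ∂xE y - t * (val (lookup y (inject₁ i)) * ev ∂E y)) ≋ T i (F μ)
      ev-T ∂xE ∂E is-∂xE is-∂E {y} d = *-cancelˡ (separated {lookup y (inject₁ i)} {lookup y (suc i)}
        (lookup-distinct i d))
        (modulo ∂xE≈ (modulo (ev-∂ i (E ⌜ μ ⌝) ∂E is-∂E y) (modulo A-coef
          (solve 8 (λ X Y d₁ d₂ t p f f′ → (X :- Y) :* (d₁ :- t :* (X :* d₂))
              := (X :- Y) :* ((p :- 0:) :* f :+ (1: :- p) :* f′)
                :+ 1: :* ((X :- Y) :* d₁ :- (X :* f :- Y :* f′))
                :+ (:- (t :* X)) :* ((X :- Y) :* d₂ :- (f :- f′))
                :+ (f′ :- f) :* (p :* (X :- Y) :- (1: :- t) :* X))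
            refl X Y′ (ev ∂xE y) (ev ∂E y) t (coef i y) (F μ y) (F μ (swap i y))))))
        where
        X = val (lookup y (inject₁ i))
        Y′ = val (lookup y (suc i))
        A-coef : coef i y * (X - Y′) ≈ (1# - t) * X
        A-coef = trans (*-congʳ (reflexive (coef-lookup i y)))
          (A-val {lookup y (inject₁ i)} {lookup y (suc i)} (lookup-distinct i d))
        ∂xE≈ : (X - Y′) * ev ∂xE y ≈ X * F μ y - Y′ * F μ (swap i y)
        ∂xE≈ = trans (ev-∂ i xE ∂xE is-∂xE y) (+-cong (ev-xE y) (-‿cong (trans (ev-xE (swap i y))
          (*-congʳ (reflexive (≡.cong val (lookup-swap-inject₁ i y)))))))

      F-swap : F (swap i μ) ≋ T i (F μ) ⊕ swapCoefficient ⊛ F μ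
      F-swap {y} d = begin
        ev (E ⌜ swap i μ ⌝) y
          ≡⟨ ≡.cong (λ μ → ev (E μ) y) (map-swap +_ i μ) ⟩
        ev (E (swap i ⌜ μ ⌝)) y
          ≈⟨ evaluate-cong (points y) (E (swap i ⌜ μ ⌝)) (∂xE -ᴸ t · x∂E +ᴸ swapCoefficient · E ⌜ μ ⌝)
               (proj₂ (proj₂ (proj₂ (proj₂ e2)))) ⟩
        ev (∂xE -ᴸ t · x∂E +ᴸ swapCoefficient · E ⌜ μ ⌝) y
          ≈⟨ evaluate-++ (points y) (∂xE -ᴸ t · x∂E) (swapCoefficient · E ⌜ μ ⌝) ⟩
        ev (∂xE -ᴸ t · x∂E) y + ev (swapCoefficient · E ⌜ μ ⌝) y
          ≈⟨ +-cong (evaluate-minus (points y) ∂xE (t · x∂E)) (evaluate-· (points y) swapCoefficient (E ⌜ μ ⌝)) ⟩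
        ev ∂xE y - ev (t · x∂E) y + swapCoefficient * F μ y
          ≈⟨ +-congʳ (+-congˡ (-‿cong (trans (evaluate-· (points y) t x∂E)
               (*-congˡ (trans (ev-*ᴸ (x (inject₁ i)) ∂E y) (*-congʳ (ev-x (inject₁ i) y))))))) ⟩
        ev ∂xE y - t * (val (lookup y (inject₁ i)) * ev ∂E y) + swapCoefficient * F μ y
          ≈⟨ +-congʳ (ev-T ∂xE ∂E (proj₁ (proj₂ (proj₂ e2))) (proj₁ (proj₂ (proj₂ (proj₂ e2)))) d) ⟩
        (T i (F μ) ⊕ swapCoefficient ⊛ F μ) y ∎
        where
        e2 = E2 μ i μᵢ>μᵢ₊₁
        ∂xE ∂E x∂E : Laurent
        ∂xE = proj₁ e2
        ∂E = proj₁ (proj₂ e2)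
        x∂E = x (inject₁ i) *ᴸ ∂E

-- The product formula under the two recursions

module Formula
  {c ℓ₁ ℓ₂ c′ ℓ₁′ ℓ₂′} {k : HeytingField c ℓ₁ ℓ₂} (K : RationalFunctionField k c′ ℓ₁′ ℓ₂′) where

  open RationalFunctionField K using (heytingField; commutativeRing; q)
  open HeytingField heytingField using (_#_)
  open CommutativeRing commutativeRing hiding (zero)
  open FieldOperations K
  open Exp semiring using (_^_)
  open FieldLemmas K
  open IntegerRingSolver commutativeRing
  open SetoidReasoning setoid
  open BigOperator *-commutativeMonoid using () renaming (sum-cong-≋ to prod-cong)
  open BigOperator *-commutativeMonoid using () renaming (∑-distrib-+ to prod-distrib-*; sum-init-last to prod-init-last)

  -- The quotient y / x of the changed factors is kept cross-multiplied, so that no division by x is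
  -- involved.
  prod-change : ∀ {n} (f f′ : Fin n → Carrier) i {x y} → (∀ r → r ≢ i → f′ r ≈ f r) →
                f′ i * x ≈ f i * y → prod f′ * x ≈ prod f * y
  prod-change f f′ zero {x} {y} same changed = begin
    f′ zero * prod (f′ ∘ suc) * x
      ≈⟨ *-congʳ (*-congˡ (prod-cong λ r → same (suc r) λ ())) ⟩
    f′ zero * prod (f ∘ suc) * x
      ≈⟨ modulo changed (solve 5 (λ a b x y p → b :* p :* x := a :* p :* y :+ p :* (b :* x :- a :* y)) refl
           (f zero) (f′ zero) x y (prod (f ∘ suc))) ⟩
    f zero * prod (f ∘ suc) * y ∎
  prod-change f f′ (suc i) {x} {y} same changed = begin
    f′ zero * prod (f′ ∘ suc) * x    ≈⟨ *-assoc _ _ _ ⟩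
    f′ zero * (prod (f′ ∘ suc) * x)
      ≈⟨ *-cong (same zero λ ()) (prod-change (f ∘ suc) (f′ ∘ suc) i
        (λ r r≢i → same (suc r) (r≢i ∘ Fin.suc-injective)) changed) ⟩
    f zero * (prod (f ∘ suc) * y)    ≈⟨ *-assoc _ _ _ ⟨
    f zero * prod (f ∘ suc) * y      ∎

  prod-swap : ∀ {n} (f f′ : Fin (suc n) → Carrier) j {x y} →
              (∀ r → r ≢ inject₁ j → r ≢ suc j → f′ r ≈ f r) →
              f′ (inject₁ j) ≈ f (suc j) → f′ (suc j) * x ≈ f (inject₁ j) * y → prod f′ * x ≈ prod f * y
  prod-swap f f′ zero {x} {y} same small large = begin
    f′ zero * (f′ (suc zero) * prod (λ r → f′ (suc (suc r)))) * x
      ≈⟨ *-congʳ (*-cong small (*-congˡ (prod-cong λ r → same (suc (suc r)) (λ ()) (λ ())))) ⟩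
    f (suc zero) * (f′ (suc zero) * p) * x
      ≈⟨ modulo large (solve 6 (λ a a′ b x y p → b :* (a′ :* p) :* x
           := a :* (b :* p) :* y :+ b :* p :* (a′ :* x :- a :* y)) refl
           (f zero) (f′ (suc zero)) (f (suc zero)) x y p) ⟩
    f zero * (f (suc zero) * p) * y ∎
    where p = prod (λ r → f (suc (suc r)))
  prod-swap f f′ (suc j) {x} {y} same small large = begin
    f′ zero * prod (f′ ∘ suc) * x    ≈⟨ *-assoc _ _ _ ⟩
    f′ zero * (prod (f′ ∘ suc) * x)
      ≈⟨ *-cong (same zero (λ ()) (λ ())) (prod-swap (f ∘ suc) (f′ ∘ suc) j
           (λ r r≢ r≢′ → same (suc r) (r≢ ∘ Fin.suc-injective) (r≢′ ∘ Fin.suc-injective)) small large) ⟩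
    f zero * (prod (f ∘ suc) * y)    ≈⟨ *-assoc _ _ _ ⟨
    f zero * prod (f ∘ suc) * y      ∎

  numerator : ℕ → ℕ → Carrier
  numerator v j = 1# - q ^ suc j * t ^ v

  -- Left unsimplified so that `box` agrees definitionally with the factor in the theorem, with c =
  -- j + 1.
  arm : ℕ → ℕ → ℤ
  arm l j = + l ℤ.- + suc j ℤ.+ 1ℤ

  denominator : (l v u j : ℕ) → Carrier
  denominator l v u j = 1# - qt (arm l j) (+ v ℤ.- + u)

  denominator#0 : ∀ {l} v u {j} → j ℕ.< l → denominator l v u j # 0#
  denominator#0 v u j<l = 1-qt#0 (+ v ℤ.- + u) (c≤m⇒0<m-c+1 j<l)

  box : (l v u j : ℕ) → j ℕ.< l → Carrier
  box l v u j j<l = numerator v j / denominator l v u j by denominator#0 v u j<l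

  row : (l v : ℕ) → (ℕ → ℕ) → Carrier
  row l v U = prod {l} λ j → box l v (U (toℕ j)) (toℕ j) (Fin.toℕ<n j)

  formula : ∀ {n} → Vec ℕ n → Carrier
  formula μ = prod λ r → row (lookup μ r) (suc (rank (lookup μ r) μ r)) (λ z → rank z μ r)

  box-cancel : ∀ l v u j j<l → box l v u j j<l * denominator l v u j ≈ numerator v j
  box-cancel l v u j j<l = trans (*-assoc _ _ _) (trans (*-congˡ (*-inverseˡ (denominator#0 v u j<l)))
    (*-identityʳ _))

  row-cong : ∀ l v {U U′} → (∀ {z} → z ℕ.< l → U z ≡ U′ z) → row l v U ≈ row l v U′
  row-cong l v U≡U′ = prod-cong λ j → reflexive (≡.cong (λ u → box l v u (toℕ j) (Fin.toℕ<n j))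
    (U≡U′ (Fin.toℕ<n j)))

  arm-suc : ∀ l j → arm (suc l) (suc j) ≡ arm l j
  arm-suc l j = ≡.cong (ℤ._+ 1ℤ) (≡.trans (ℤ.[+m]-[+n]≡m⊖n (suc l) (suc (suc j)))
    (≡.trans (ℤ.[1+m]⊖[1+n]≡m⊖n l (suc j)) (≡.sym (ℤ.[+m]-[+n]≡m⊖n l (suc j)))))

  arm-leg : ∀ l j → arm l j ≡ + l ℤ.- + j
  arm-leg l j = ≡.trans (≡.cong (λ i → + l ℤ.- i ℤ.+ 1ℤ) (ℤ.pos-+ 1 j))
    (ℤS.solve 2 (λ l j → l ℤS.:- (ℤS.con 1ℤ ℤS.:+ j) ℤS.:+ ℤS.con 1ℤ ℤS.:= l ℤS.:- j) ≡.refl (+ l) (+ j))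
    where module ℤS = ℤ-Solver

  -- Adding a box in column 1 and moving the others to the right creates the factor
  -- (1 - qˡ⁺¹tᵛ) / (1 - qˡ⁺¹tᵛ).
  row-suc : ∀ l v {U U′} → (∀ z → U′ (suc z) ≡ U z) → U′ 0 ≡ 0 → row (suc l) v U′ ≈ row l v U
  row-suc l v {U} {U′} U′-suc U′-zero = begin
    row (suc l) v U′
      ≈⟨ prod-distrib-* (λ j → numerator v (toℕ j)) inv′ ⟩
    prod {suc l} (λ j → numerator v (toℕ j)) * (inv′ zero * prod (inv′ ∘ suc))
      -- Numerators depend on the column, so the additional one is the last; denominators depend on
      -- the distance to the end of the row, so the additional one is the first.
      ≈⟨ *-cong (prod-init-last (λ (j : Fin (suc l)) → numerator v (toℕ j)))
           (*-congˡ (prod-cong {l} λ j → inverse-cong (denominator#0 v (U′ (suc (toℕ j))) (Fin.toℕ<n (suc j)))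
             (denominator#0 v (U (toℕ j)) (Fin.toℕ<n j)) (reflexive (≡.cong₂ (λ e u → 1# - qt e (+ v ℤ.- + u))
             (arm-suc l (toℕ j)) (U′-suc (toℕ j)))))) ⟩
    prod {l} (λ j → numerator v (toℕ (inject₁ j))) * numerator v (toℕ (fromℕ l)) * (inv′ zero * prod inv)
      ≈⟨ *-congʳ (*-cong (prod-cong {l} λ j → reflexive (≡.cong (numerator v) (Fin.toℕ-inject₁ j))) first) ⟩
    prod {l} (λ j → numerator v (toℕ j)) * denominator (suc l) v (U′ 0) 0 * (inv′ zero * prod inv)
      ≈⟨ modulo (*-inverseʳ (denominator#0 v (U′ 0) (s≤s z≤n))) (solve 4 (λ a d i b →
           a :* d :* (i :* b) := a :* b :+ a :* b :* (d :* i :- 1:)) refl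
           (prod {l} (λ j → numerator v (toℕ j))) (denominator (suc l) v (U′ 0) 0) (inv′ zero) (prod inv)) ⟩
    prod {l} (λ j → numerator v (toℕ j)) * prod inv
      ≈⟨ prod-distrib-* (λ j → numerator v (toℕ j)) inv ⟨
    row l v U ∎
    where
    inv′ : Fin (suc l) → Carrier
    inv′ j = inverse (denominator#0 v (U′ (toℕ j)) (Fin.toℕ<n j))
    inv : Fin l → Carrier
    inv j = inverse (denominator#0 v (U (toℕ j)) (Fin.toℕ<n j))
    first : numerator v (toℕ (fromℕ l)) ≈ denominator (suc l) v (U′ 0) 0
    first = reflexive (≡.trans (≡.cong (numerator v) (Fin.toℕ-fromℕ l))
      (≡.sym (≡.cong₂ (λ e f → 1# - qt e f) (≡.trans (arm-leg (suc l) 0) (ℤ.+-identityʳ (+ suc l)))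
        (≡.trans (≡.cong (λ u → + v ℤ.- + u) U′-zero) (ℤ.+-identityʳ (+ v))))))

  formula-zero : ∀ n → formula (Vec.replicate n 0) ≈ 1#
  formula-zero n = trans
    (prod-cong {n} λ r → empty (lookup (Vec.replicate n 0) r) _ (λ z → rank z (Vec.replicate n 0) r)
      (Vec.lookup-replicate r 0))
    (ones n)
    where
    empty : ∀ l v U → l ≡ 0 → row l v U ≈ 1#
    empty _ v U ≡.refl = refl
    ones : ∀ n → prod {n} (λ _ → 1#) ≈ 1#
    ones zero    = refl
    ones (suc n) = trans (*-identityˡ _) (ones n)

  -- Moving the last row to the front changes no v and, in the other rows, no u. In the moved row u
  -- shifts by one column, as x < z + 1 means x ≤ z, and `row-suc` absorbs the additional box.
  formula-rotate : ∀ {n} (μ : Vec ℕ n) l → formula (suc l ∷ μ) ≈ formula (μ ∷ʳ l)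
  formula-rotate {n} μ l = begin
    row (suc l) (suc (#< (suc l) μ)) (λ z → #< z μ)
        * prod (λ r → row (lookup μ r) (suc (rank (lookup μ r) (suc l ∷ μ) (suc r)))
          (λ z → rank z (suc l ∷ μ) (suc r)))
      ≈⟨ *-cong first (prod-cong λ r → others r) ⟩
    R (fromℕ n) * prod (R ∘ inject₁)
      ≈⟨ *-comm _ _ ⟩
    prod (R ∘ inject₁) * R (fromℕ n)
      ≈⟨ prod-init-last R ⟨
    formula (μ ∷ʳ l) ∎
    where
    R : Fin (suc n) → Carrier
    R r = row (lookup (μ ∷ʳ l) r) (suc (rank (lookup (μ ∷ʳ l) r) (μ ∷ʳ l) r)) (λ z → rank z (μ ∷ʳ l) r)
    first : row (suc l) (suc (#< (suc l) μ)) (λ z → #< z μ) ≈ R (fromℕ n)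
    first = trans (row-suc l (suc (#< (suc l) μ)) {λ z → rank z (μ ∷ʳ l) (fromℕ n)} {λ z → #< z μ}
      (λ z → ≡.trans (#<-suc z μ) (≡.sym (rank-∷ʳ-last z μ l))) (#<-zero μ))
      (reflexive (≡.trans (≡.cong (λ r → row l (suc r) (λ z → rank z (μ ∷ʳ l) (fromℕ n)))
        (≡.trans (#<-suc l μ) (≡.sym (rank-∷ʳ-last l μ l))))
        (≡.cong (λ l′ → row l′ (suc (rank l′ (μ ∷ʳ l) (fromℕ n))) (λ z → rank z (μ ∷ʳ l) (fromℕ n)))
          (≡.sym (lookup-∷ʳ-last μ l)))))
    others : ∀ r → row (lookup μ r) (suc (rank (lookup μ r) (suc l ∷ μ) (suc r)))
      (λ z → rank z (suc l ∷ μ) (suc r)) ≈ R (inject₁ r)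
    others r = trans (row-cong (lookup μ r) _ (λ {z} _ → ≡.sym (rank-∷ʳ-inject₁ z μ l r)))
      (reflexive (≡.trans (≡.cong (λ v → row (lookup μ r) (suc v) (λ z → rank z (μ ∷ʳ l) (inject₁ r)))
          (≡.sym (rank-∷ʳ-inject₁ (lookup μ r) μ l r)))
        (≡.cong (λ l′ → row l′ (suc (rank l′ (μ ∷ʳ l) (inject₁ r))) (λ z → rank z (μ ∷ʳ l) (inject₁ r)))
          (≡.sym (lookup-∷ʳ-inject₁ μ l r)))))

  module _ {n} (μ : Vec ℕ (suc n)) (j : Fin n) (μⱼ>μⱼ₊₁ : lookup μ (inject₁ j) ℕ.> lookup μ (suc j)) where
    private
      a = lookup μ (inject₁ j)
      b = lookup μ (suc j)
      ρ = qt (+ a ℤ.- + b) (+ v ⌜ μ ⌝ (inject₁ j) ℤ.- + v ⌜ μ ⌝ (suc j))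
      h = λ z → rank z μ (inject₁ j)
      h′ = λ z → rank z (swap j μ) (suc j)

      rowOf : Vec ℕ (suc n) → Fin (suc n) → ℕ → Carrier
      rowOf μ r l = row l (suc (rank l μ r)) (λ z → rank z μ r)

    -- The two rows trade places together with their v and u, except that u grows by 1 at the box in
    -- column b + 1 of the longer row. The denominator of that box is 1 - tρ before and 1 - ρ after.
    formula-swap : formula (swap j μ) * (1# - ρ) ≈ formula μ * (1# - t * ρ)
    formula-swap = prod-swap (λ r → rowOf μ r (lookup μ r)) (λ r → rowOf (swap j μ) r (lookup (swap j μ) r)) j
        other small large
      where
      other : ∀ r → r ≢ inject₁ j → r ≢ suc j → rowOf (swap j μ) r (lookup (swap j μ) r) ≈ rowOf μ r (lookup μ r)
      other r r≢ r≢′ = trans (reflexive (≡.cong (rowOf (swap j μ) r) (lookup-swap-other j μ r r≢ r≢′)))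
        (trans (row-cong (lookup μ r) _ (λ {z} _ → rank-swap-other z j μ r r≢ r≢′))
          (reflexive (≡.cong (λ v → row (lookup μ r) (suc v) (λ z → rank z μ r))
            (rank-swap-other (lookup μ r) j μ r r≢ r≢′))))
      small : rowOf (swap j μ) (inject₁ j) (lookup (swap j μ) (inject₁ j)) ≈ rowOf μ (suc j) b
      small = trans (reflexive (≡.cong (rowOf (swap j μ) (inject₁ j)) (lookup-swap-inject₁ j μ)))
        (trans (row-cong b _ (λ z<b → rank-swap-small μ j μⱼ>μⱼ₊₁ (ℕ.<-trans z<b μⱼ>μⱼ₊₁)))
          (reflexive (≡.cong (λ v → row b (suc v) (λ z → rank z μ (suc j)))
            (rank-swap-small μ j μⱼ>μⱼ₊₁ μⱼ>μⱼ₊₁))))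
      va = suc (h a)
      denominator-new : denominator a va (h′ b) b ≡ 1# - ρ
      denominator-new = ≡.cong₂ (λ e f → 1# - qt e f) (arm-leg a b) (≡.cong₂ (λ v v′ → + v ℤ.- + v′)
        (≡.sym (v-rank μ (inject₁ j)))
        (≡.trans (rank-swap-critical μ j μⱼ>μⱼ₊₁) (≡.sym
          (≡.trans (v-rank μ (suc j)) (≡.cong suc (rank-critical μ j μⱼ>μⱼ₊₁))))))
      denominator-old : denominator a va (h b) b ≈ 1# - t * ρ
      denominator-old = +-congˡ (-‿cong (trans (reflexive (≡.cong₂ qt
          (≡.trans (arm-leg a b) (≡.sym (ℤ.+-identityˡ _)))
          (≡.trans (leg va (h b)) (≡.cong₂ (λ v v′ → + 1 ℤ.+ (+ v ℤ.- + v′)) (≡.sym (v-rank μ (inject₁ j)))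
             (≡.trans (≡.cong suc (≡.sym (rank-critical μ j μⱼ>μⱼ₊₁))) (≡.sym (v-rank μ (suc j))))))))
        (trans (qt-homo 0ℤ (+ 1) (+ a ℤ.- + b) (+ v ⌜ μ ⌝ (inject₁ j) ℤ.- + v ⌜ μ ⌝ (suc j)))
          (*-congʳ (trans (*-identityˡ _) (*-identityʳ t))))))
        where
        module ℤS = ℤ-Solver
        leg : ∀ v u → + v ℤ.- + u ≡ + 1 ℤ.+ (+ v ℤ.- + suc u)
        leg v u = ≡.trans (ℤS.solve 2 (λ v u → v ℤS.:- u ℤS.:= ℤS.con 1ℤ ℤS.:+ (v ℤS.:- (ℤS.con 1ℤ ℤS.:+ u)))
          ≡.refl (+ v) (+ u))
          (≡.cong (λ i → + 1 ℤ.+ (+ v ℤ.- i)) (≡.sym (ℤ.pos-+ 1 u)))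
      large : rowOf (swap j μ) (suc j) (lookup (swap j μ) (suc j)) * (1# - ρ) ≈ rowOf μ (inject₁ j) a *
        (1# - t * ρ)
      large = trans (*-congʳ (reflexive (≡.trans (≡.cong (rowOf (swap j μ) (suc j)) (lookup-swap-suc j μ))
          (≡.cong (λ v → row a (suc v) h′) (rank-swap-large μ j μⱼ>μⱼ₊₁ (ℕ.>⇒≢ μⱼ>μⱼ₊₁))))))
        (prod-change (λ i → box a va (h (toℕ i)) (toℕ i) (Fin.toℕ<n i))
          (λ i → box a va (h′ (toℕ i)) (toℕ i) (Fin.toℕ<n i))
          (Fin.fromℕ< μⱼ>μⱼ₊₁) unchanged critical)
        where
        unchanged : ∀ i → i ≢ Fin.fromℕ< μⱼ>μⱼ₊₁ → box a va (h′ (toℕ i)) (toℕ i) (Fin.toℕ<n i) ≈ box a va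
          (h (toℕ i)) (toℕ i) (Fin.toℕ<n i)
        unchanged i i≢ = reflexive (≡.cong (λ u → box a va u (toℕ i) (Fin.toℕ<n i))
          (rank-swap-large μ j μⱼ>μⱼ₊₁ (λ i≡b → i≢ (Fin.toℕ-injective
            (≡.trans i≡b (≡.sym (Fin.toℕ-fromℕ< μⱼ>μⱼ₊₁)))))))
        -- The column is a variable because `toℕ (Fin.fromℕ< …)` equals b only propositionally and
        -- also occurs in the type of the bound `i<a`.
        critical-box : ∀ i → i ≡ b → ∀ i<a → box a va (h′ i) i i<a * (1# - ρ) ≈ box a va (h i) i i<a * (1# - t * ρ)
        critical-box i ≡.refl i<a = trans (*-congˡ (reflexive (≡.sym denominator-new)))
          (trans (box-cancel a va (h′ i) i i<a)
          (sym (trans (*-congˡ (sym denominator-old)) (box-cancel a va (h i) i i<a))))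
        critical = critical-box (toℕ (Fin.fromℕ< μⱼ>μⱼ₊₁)) (Fin.toℕ-fromℕ< μⱼ>μⱼ₊₁)
          (Fin.toℕ<n (Fin.fromℕ< μⱼ>μⱼ₊₁))

-- Eigenvectors and the value at ρ

module PrincipalSpecialization
  {c ℓ₁ ℓ₂ c′ ℓ₁′ ℓ₂′} {k : HeytingField c ℓ₁ ℓ₂} (K : RationalFunctionField k c′ ℓ₁′ ℓ₂′) (m : ℕ) where

  open RationalFunctionField K using (heytingField; commutativeRing; q)
  open CommutativeRing commutativeRing hiding (zero; Carrier; _≈_; _+_; _*_; _-_; -_; 0#; 1#)
  open Macdonald K m
  open FieldLemmas K
  open IntegerRingSolver commutativeRing
  open Hecke commutativeRing heckeData
  open Formula K
  open Evaluation K m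
  open BigOperator *-commutativeMonoid using () renaming (sum-cong-≋ to prod-cong)

  ρ : Vec Point (suc m)
  ρ = tabulate λ i → 0 , toℕ i

  ρ-distinct : Distinct ρ
  ρ-distinct = AllPairs.tabulate⁺ {f = λ i → 0 , toℕ i} λ i≢j → i≢j ∘ Fin.toℕ-injective

  -- Consecutive coordinates are x and tx, and (1 - t)x / (x - tx) = 1.
  coef-ρ : ∀ i → coef i ρ ≈ 1#
  coef-ρ i = *-cancelˡ (separated {x₀} {y₀} (lookup-distinct i ρ-distinct))
    (trans (*-congˡ (reflexive (coef-lookup i ρ))) (trans (*-comm _ _)
      (trans (A-val {x₀} {y₀} (lookup-distinct i ρ-distinct))
      (trans (modulo y≈tx (solve 3 (λ t x y → (1: :- t) :* x := (x :- y) :* 1: :+ 1: :* (y :- t :* x)) refl t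
        (val x₀) (val y₀))) refl))))
    where
    x₀ = lookup ρ (inject₁ i)
    y₀ = lookup ρ (suc i)
    y≈tx : val y₀ ≈ t * val x₀
    y≈tx = trans (reflexive (≡.cong val (Vec.lookup∘tabulate (λ i → 0 , toℕ i) (suc i))))
      (trans (solve 2 (λ t u → 1: :* (t :* u) := t :* (1: :* u)) refl t (t ^ toℕ i))
        (*-congˡ (reflexive (≡.trans (≡.cong (λ k → 1# * t ^ k) (≡.sym (Fin.toℕ-inject₁ i)))
          (≡.cong val (≡.sym (Vec.lookup∘tabulate (λ i → 0 , toℕ i) (inject₁ i))))))))

  formula-∏□ : ∀ μ → formula μ ≈ ∏□ μ (λ r c c≤μᵣ →
    (1# - q ^ c * t ^ v ⌜ μ ⌝ r)
      / (1# - qt (+ lookup μ r ℤ.- + c ℤ.+ 1ℤ) (+ v ⌜ μ ⌝ r ℤ.- + u μ r c))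
      by 1-qt#0 (+ v ⌜ μ ⌝ r ℤ.- + u μ r c) (c≤m⇒0<m-c+1 c≤μᵣ))
  formula-∏□ μ = prod-cong λ r → prod-cong {lookup μ r} λ j → reflexive
    (≡.cong₂ (λ v u → box (lookup μ r) v u (toℕ j) (Fin.toℕ<n j)) (≡.sym (v-rank μ r))
      (≡.sym (u-rank μ r (toℕ j))))

  module _ (E : Vec ℤ (suc m) → Laurent) (isFamily : IsMacdonaldFamily E) where
    open Family E isFamily

    -- The exponent of t is n - v_μ(i), because n = m + 1 and v is 1 + `rank`.
    eigenvalue : Vec ℕ (suc m) → Fin (suc m) → Carrier
    eigenvalue μ i = qt (ℤ.- + lookup μ i) (+ m ℤ.- + rank (lookup μ i) μ i)

    Eigenvector : Vec ℕ (suc m) → Set _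
    Eigenvector μ = ∀ i → Y i (F μ) ≋ eigenvalue μ i ⊛ F μ

    Y-eigen-cong : ∀ (i : Fin (suc m)) (G G′ : V (suc m)) {η η′} → G ≋ G′ → η ≈ η′ → Y i G′ ≋ η′ ⊛ G′ → Y i G ≋
      η ⊛ G
    Y-eigen-cong i G G′ G≋G′ η≈η′ eigen d =
      trans (Y-cong i {G} {G′} G≋G′ d) (trans (eigen d) (*-cong (sym η≈η′) (sym (G≋G′ d))))

    eigenvector-zero : Eigenvector (Vec.replicate (suc m) 0)
    eigenvector-zero i = Y-eigen-cong i (F (Vec.replicate (suc m) 0)) one (λ {y} _ → F-zero y) value (Y-one i)
      where
      value : eigenvalue (Vec.replicate (suc m) 0) i ≈ t ^ List.length (up i)
      value = trans (reflexive (≡.cong₂ qt (≡.cong (λ l → ℤ.- + l) (Vec.lookup-replicate i 0)) (≡.trans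
          (≡.cong (λ r → + m ℤ.- + r) (≡.trans (≡.cong (λ l → rank l (Vec.replicate (suc m) 0) i)
            (Vec.lookup-replicate i 0)) (rank-replicate i)))
          (≡.trans (≡.cong (λ k → + k ℤ.- + toℕ i) (≡.sym (length-up i)))
            (≡.trans (≡.cong (ℤ._- + toℕ i) (ℤ.+-comm (+ toℕ i) (+ List.length (up i))))
              (difference (+ List.length (up i)) (+ toℕ i)))))))
        (*-identityˡ _)
        where
        difference : ∀ x y → x ℤ.+ y ℤ.- y ≡ x
        difference = ℤ-Solver.solve 2 (λ x y → x ℤ-Solver.:+ y ℤ-Solver.:- y ℤ-Solver.:= x) ≡.refl

    -- `Y-τ-suc` moves each eigenvalue to the next index; `Y-τ-zero` brings the last one to the
    -- front with a factor q⁻¹, as befits the entry l + 1 there.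
    eigenvector-rotate : ∀ μ l → Eigenvector (μ ∷ʳ l) → Eigenvector (suc l ∷ μ)
    eigenvector-rotate μ l eigen i = Y-eigen-cong i (F (suc l ∷ μ)) ((q ^ l) ⊛ τ F′) {eigenvalue (suc l ∷ μ) i}
      (λ {y} _ → F-rotate μ l y) refl
      λ {y} d → trans (Y-scale i (q ^ l) (τ F′) y) (trans (*-congˡ (shifted i d))
        (solve 3 (λ a b c → a :* (b :* c) := b :* (a :* c)) refl (q ^ l) (eigenvalue (suc l ∷ μ) i) (τ F′ y)))
      where
      F′ = F (μ ∷ʳ l)
      pull : ∀ {G η} → G ≋ η ⊛ F′ → τ G ≋ η ⊛ τ F′
      pull {G} {η} G≋ {y} d = trans (τ-cong {F = G} {G = η ⊛ F′} G≋ d)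
        (solve 3 (λ a b c → a :* (b :* c) := b :* (a :* c)) refl (val (Vec.head y)) η (g F′ y))
      shifted : ∀ i → Y i (τ F′) ≋ eigenvalue (suc l ∷ μ) i ⊛ τ F′
      shifted zero {y} d = trans (Y-τ-zero F′ d) (trans (*-congˡ (pull (eigen (fromℕ m)) d))
        (trans (sym (*-assoc _ _ _)) (*-congʳ value)))
        where
        value : q⁻¹ * eigenvalue (μ ∷ʳ l) (fromℕ m) ≈ eigenvalue (suc l ∷ μ) zero
        value = sym (trans
          (reflexive (≡.cong₂ qt (ℤ.neg-distrib-+ (+ 1) (+ l)) (≡.trans
            (≡.cong (λ r → + m ℤ.- + r) (≡.trans (#<-suc l μ) (≡.sym (rank-∷ʳ-last l μ l))))
              (≡.sym (ℤ.+-identityˡ _)))))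
          (trans (qt-homo (ℤ.- + 1) 0ℤ (ℤ.- + l) (+ m ℤ.- + rank l (μ ∷ʳ l) (fromℕ m)))
            (*-cong (trans (*-identityʳ _) (*-identityʳ _))
              (reflexive (≡.cong (λ l′ → qt (ℤ.- + l′) (+ m ℤ.- + rank l′ (μ ∷ʳ l) (fromℕ m)))
                (≡.sym (lookup-∷ʳ-last μ l)))))))
      shifted (suc i) {y} d = trans (Y-τ-suc i F′ d)
        (trans (pull (eigen (inject₁ i)) d) (*-congʳ (reflexive value)))
        where
        value : eigenvalue (μ ∷ʳ l) (inject₁ i) ≡ eigenvalue (suc l ∷ μ) (suc i)
        value = ≡.trans (≡.cong (λ l′ → qt (ℤ.- + l′) (+ m ℤ.- + rank l′ (μ ∷ʳ l) (inject₁ i)))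
          (lookup-∷ʳ-inject₁ μ l i))
          (≡.cong (λ r → qt (ℤ.- + lookup μ i) (+ m ℤ.- + r)) (rank-∷ʳ-inject₁ (lookup μ i) μ l i))

    module _ (μ : Vec ℕ (suc m)) (j : Fin m) (μⱼ>μⱼ₊₁ : lookup μ (inject₁ j) ℕ.> lookup μ (suc j)) where
      private
        e = swapCoefficient μ j μⱼ>μⱼ₊₁
        a = ratio μ j

      swapCoefficient-denominator : e * (1# - a) ≈ (1# - t) * a
      swapCoefficient-denominator = trans (*-assoc _ _ _)
        (trans (*-congˡ (*-inverseˡ (1-ratio#0 μ j μⱼ>μⱼ₊₁))) (*-identityʳ _))

      -- The a of E2 is thus a quotient η′ / η of eigenvalues, and (1 - t)a / (1 - a) is the
      -- solution e of e(η - η′) = (1 - t)η′ that the intertwiner requires.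
      ratio-eigenvalue : a * eigenvalue μ (inject₁ j) ≈ eigenvalue μ (suc j)
      ratio-eigenvalue = trans (sym (qt-homo (+ lookup μ (inject₁ j) ℤ.- + lookup μ (suc j))
        (+ v ⌜ μ ⌝ (inject₁ j) ℤ.- + v ⌜ μ ⌝ (suc j)) (ℤ.- + lookup μ (inject₁ j)) (+ m ℤ.- + r)))
        (reflexive (≡.cong₂ qt (difference (+ lookup μ (inject₁ j)) (+ lookup μ (suc j)))
          (≡.trans (≡.cong₂ (λ x y → + x ℤ.- + y ℤ.+ (+ m ℤ.- + r)) (v-rank μ (inject₁ j)) (v-rank μ (suc j)))
            (≡.trans (≡.cong₂ (λ x y → x ℤ.- y ℤ.+ (+ m ℤ.- + r)) (ℤ.pos-+ 1 r) (ℤ.pos-+ 1 r′))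
              (difference′ (+ r) (+ r′) (+ m))))))
        where
        r = rank (lookup μ (inject₁ j)) μ (inject₁ j)
        r′ = rank (lookup μ (suc j)) μ (suc j)
        module ℤS = ℤ-Solver
        difference : ∀ x y → x ℤ.- y ℤ.+ ℤ.- x ≡ ℤ.- y
        difference = ℤS.solve 2 (λ x y → x ℤS.:- y ℤS.:+ ℤS.:- x ℤS.:= ℤS.:- y) ≡.refl
        difference′ : ∀ r r′ m → (+ 1 ℤ.+ r) ℤ.- (+ 1 ℤ.+ r′) ℤ.+ (m ℤ.- r) ≡ m ℤ.- r′
        difference′ = ℤS.solve 3 (λ r r′ m →
          (ℤS.con 1ℤ ℤS.:+ r) ℤS.:- (ℤS.con 1ℤ ℤS.:+ r′) ℤS.:+ (m ℤS.:- r) ℤS.:= m ℤS.:- r′) ≡.refl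

      swapCoefficient-eigenvalue : e * (eigenvalue μ (inject₁ j) - eigenvalue μ (suc j)) ≈ (1# - t) * eigenvalue
        μ (suc j)
      swapCoefficient-eigenvalue = modulo swapCoefficient-denominator (modulo ratio-eigenvalue
        (solve 5 (λ e a t η η′ → e :* (η :- η′) := (1: :- t) :* η′ :+ η :* (e :* (1: :- a) :- (1: :- t) :* a)
          :+ (e :+ (1: :- t)) :* (a :* η :- η′)) refl e a t (eigenvalue μ (inject₁ j)) (eigenvalue μ (suc j))))

      -- The intertwiner exchanges the eigenvalues at j and j + 1, just as the two entries exchange
      -- places and take along their ranks; every other Yᵢ commutes with it.
      eigenvector-swap : Eigenvector μ → Eigenvector (swap j μ)
      eigenvector-swap eigen i = cases i (i Fin.≟ inject₁ j) (i Fin.≟ suc j)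
       where
       cases : ∀ i → Dec (i ≡ inject₁ j) → Dec (i ≡ suc j) → Y i (F (swap j μ)) ≋ eigenvalue (swap j μ) i ⊛ F
         (swap j μ)
       cases i (yes ≡.refl) _ = Y-eigen-cong (inject₁ j) (F (swap j μ)) (T j (F μ) ⊕ e ⊛ F μ)
         {eigenvalue (swap j μ) (inject₁ j)} (F-swap μ j μⱼ>μⱼ₊₁)
        (reflexive (≡.trans (≡.cong (λ l → qt (ℤ.- + l) (+ m ℤ.- + rank l (swap j μ) (inject₁ j)))
          (lookup-swap-inject₁ j μ))
          (≡.cong (λ r → qt (ℤ.- + lookup μ (suc j)) (+ m ℤ.- + r)) (rank-swap-small μ j μⱼ>μⱼ₊₁ μⱼ>μⱼ₊₁))))
        (intertwine-inject₁ j (F μ) (eigen (inject₁ j)) (eigen (suc j)) swapCoefficient-eigenvalue)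
       cases i (no _) (yes ≡.refl) = Y-eigen-cong (suc j) (F (swap j μ)) (T j (F μ) ⊕ e ⊛ F μ)
         {eigenvalue (swap j μ) (suc j)} (F-swap μ j μⱼ>μⱼ₊₁)
        (reflexive (≡.trans (≡.cong (λ l → qt (ℤ.- + l) (+ m ℤ.- + rank l (swap j μ) (suc j)))
          (lookup-swap-suc j μ))
          (≡.cong (λ r → qt (ℤ.- + lookup μ (inject₁ j)) (+ m ℤ.- + r))
            (rank-swap-large μ j μⱼ>μⱼ₊₁ (ℕ.>⇒≢ μⱼ>μⱼ₊₁)))))
        (intertwine-suc j (F μ) (eigen (inject₁ j)) (eigen (suc j)) swapCoefficient-eigenvalue)
       cases i (no i≢) (no i≢′) = Y-eigen-cong i (F (swap j μ)) (T j (F μ) ⊕ e ⊛ F μ) {eigenvalue (swap j μ) i}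
         (F-swap μ j μⱼ>μⱼ₊₁)
        (reflexive (≡.trans (≡.cong (λ l → qt (ℤ.- + l) (+ m ℤ.- + rank l (swap j μ) i))
          (lookup-swap-other j μ i i≢ i≢′))
          (≡.cong (λ r → qt (ℤ.- + lookup μ i) (+ m ℤ.- + r)) (rank-swap-other (lookup μ i) j μ i i≢ i≢′))))
        λ {y} d → trans (Y-linear i e (T j (F μ)) (F μ) y) (trans
          (+-cong (trans (Y-T-far i j (F μ) i≢ i≢′ d)
            (trans (H-cong 0# j (eigen i) d) (H-scale 0# j η (F μ) y))) (*-congˡ (eigen i d)))
          (solve 4 (λ η e f h → η :* h :+ e :* (η :* f) := η :* (h :+ e :* f)) refl η e (F μ y) (T j (F μ) y)))
         where η = eigenvalue μ i

    Specialization : Vec ℕ (suc m) → Set _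
    Specialization μ = F μ ρ ≈ t ^ minSum (Vec.toList μ) * formula μ

    specialization-zero : Specialization (Vec.replicate (suc m) 0)
    specialization-zero = trans (F-zero ρ) (sym (trans
      (*-cong (reflexive (≡.cong (t ^_) (minSum-replicate (suc m)))) (formula-zero (suc m))) (*-identityˡ 1#)))

    specialization-rotate : ∀ μ l → Eigenvector (μ ∷ʳ l) → Specialization (μ ∷ʳ l) → Specialization (suc l ∷ μ)
    specialization-rotate μ l eigen special = begin
      F (suc l ∷ μ) ρ
        ≈⟨ F-rotate μ l ρ ⟩
      -- `1# * 1#` is the first coordinate of ρ.
      q ^ l * (1# * 1# * F′ (rotatePoint ρ))
        ≈⟨ *-congˡ (trans (*-congʳ (*-identityˡ 1#)) (*-identityˡ _)) ⟩
      q ^ l * F′ (rotatePoint ρ)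
        ≡⟨ ≡.cong (λ w → q ^ l * foldr S F′ w (rotatePoint ρ)) (up-fromℕ m) ⟨
      q ^ l * foldr S F′ (up (fromℕ m)) (rotatePoint ρ)
        -- Read from right to left: the T are inserted, at no cost at ρ, to complete g to the last
        -- Cherednik operator, whose `up` word is empty.
        ≈⟨ *-congˡ (word-T-invariant coef-ρ (down (fromℕ m)) (g (foldr S F′ (up (fromℕ m))))) ⟨
      q ^ l * Y (fromℕ m) F′ ρ
        ≈⟨ *-congˡ (trans (eigen (fromℕ m) ρ-distinct) (*-cong value special)) ⟩
      q ^ l * (q* ^ᶻ (ℤ.- + l) * t ^ #> l μ * (t ^ minSum (Vec.toList (μ ∷ʳ l)) * formula (μ ∷ʳ l)))
        ≈⟨ modulo q^l (solve 5 (λ a b c d e → a :* (b :* c :* (d :* e)) := c :* d :* e :+ c :* d :* e :*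
          (a :* b :- 1:)) refl
             (q ^ l) (q* ^ᶻ (ℤ.- + l)) (t ^ #> l μ) (t ^ minSum (Vec.toList (μ ∷ʳ l))) (formula (μ ∷ʳ l))) ⟩
      t ^ #> l μ * t ^ minSum (Vec.toList (μ ∷ʳ l)) * formula (μ ∷ʳ l)
        ≈⟨ *-cong (sym (^ᶻ-homo-+ t* (+ #> l μ) (+ minSum (Vec.toList (μ ∷ʳ l))))) (sym (formula-rotate μ l)) ⟩
      t ^ (#> l μ ℕ.+ minSum (Vec.toList (μ ∷ʳ l))) * formula (suc l ∷ μ)
        ≡⟨ ≡.cong (λ e → t ^ e * formula (suc l ∷ μ)) (minSum-rotate μ l) ⟨
      t ^ minSum (Vec.toList (suc l ∷ μ)) * formula (suc l ∷ μ) ∎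
      where
      open SetoidReasoning setoid
      F′ = F (μ ∷ʳ l)
      q^l : q ^ l * q* ^ᶻ (ℤ.- + l) ≈ 1#
      q^l = trans (sym (^ᶻ-homo-+ q* (+ l) (ℤ.- + l))) (reflexive (≡.cong (q* ^ᶻ_) (ℤ.+-inverseʳ (+ l))))
      difference : ∀ x y → x ℤ.+ y ℤ.- x ≡ y
      difference = ℤ-Solver.solve 2 (λ x y → x ℤ-Solver.:+ y ℤ-Solver.:- x ℤ-Solver.:= y) ≡.refl
      -- At the last position the rank counts those of the m entries of μ that are at most l, so its
      -- complement in m counts the entries above l. This matches the growth of the exponent in
      -- `minSum-rotate`.
      value : eigenvalue (μ ∷ʳ l) (fromℕ m) ≈ q* ^ᶻ (ℤ.- + l) * t ^ #> l μ
      value = reflexive (≡.trans (≡.cong (λ l′ → qt (ℤ.- + l′) (+ m ℤ.- + rank l′ (μ ∷ʳ l) (fromℕ m)))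
        (lookup-∷ʳ-last μ l))
        (≡.cong (qt (ℤ.- + l)) (≡.trans (≡.cong₂ (λ n r → + n ℤ.- + r) (≡.sym (#≤+#> l μ)) (rank-∷ʳ-last l μ l))
          (≡.trans (≡.cong (ℤ._- + #≤ l μ) (ℤ.pos-+ (#≤ l μ) (#> l μ))) (difference (+ #≤ l μ) (+ #> l μ))))))

    -- At ρ the intertwiner is multiplication by 1 + e, and (1 - a)(1 + e) = 1 - ta.
    specialization-swap : ∀ μ j → lookup μ (inject₁ j) ℕ.> lookup μ (suc j) → Specialization μ → Specialization
      (swap j μ)
    specialization-swap μ j μⱼ>μⱼ₊₁ special = *-cancelˡ (1-ratio#0 μ j μⱼ>μⱼ₊₁) (begin
      (1# - a) * F (swap j μ) ρ
        ≈⟨ *-congˡ (F-swap μ j μⱼ>μⱼ₊₁ ρ-distinct) ⟩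
      (1# - a) * (T j (F μ) ρ + e * F μ ρ)
        ≈⟨ *-congˡ (+-cong (word-T-invariant coef-ρ (j ∷ []) (F μ)) refl) ⟩
      (1# - a) * (F μ ρ + e * F μ ρ)
        ≈⟨ modulo (swapCoefficient-denominator μ j μⱼ>μⱼ₊₁) (solve 4 (λ a e t f → (1: :- a) :* (f :+ e :* f)
             := (1: :- t :* a) :* f :+ f :* (e :* (1: :- a) :- (1: :- t) :* a)) refl a e t (F μ ρ)) ⟩
      (1# - t * a) * F μ ρ
        ≈⟨ *-congˡ special ⟩
      (1# - t * a) * (t ^ minSum (Vec.toList μ) * formula μ)
        ≈⟨ modulo (formula-swap μ j μⱼ>μⱼ₊₁) (solve 5 (λ b c p f f′ → c :* (p :* f)
             := b :* (p :* f′) :+ (:- p) :* (f′ :* b :- f :* c)) refl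
             (1# - a) (1# - t * a) (t ^ minSum (Vec.toList μ)) (formula μ) (formula (swap j μ))) ⟩
      (1# - a) * (t ^ minSum (Vec.toList μ) * formula (swap j μ))
        ≡⟨ ≡.cong (λ s → (1# - a) * (t ^ s * formula (swap j μ))) (minSum-↭ (toList-swap j μ)) ⟨
      (1# - a) * (t ^ minSum (Vec.toList (swap j μ)) * formula (swap j μ)) ∎)
      where
      open SetoidReasoning setoid
      a = ratio μ j
      e = swapCoefficient μ j μⱼ>μⱼ₊₁

    specialization : ∀ μ → Specialization μ
    specialization μ = proj₂ (composition-induction (λ μ → Eigenvector μ × Specialization μ)
      (eigenvector-zero , specialization-zero)
      (λ μ l (eigen , special) → eigenvector-rotate μ l eigen , specialization-rotate μ l eigen special)
      (λ μ j μⱼ>μⱼ₊₁ (eigen , special) →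
        eigenvector-swap μ j μⱼ>μⱼ₊₁ eigen , specialization-swap μ j μⱼ>μⱼ₊₁ special)
      μ)

theorem5p4 : ∀ {c ℓ₁ ℓ₂ c′ ℓ₁′ ℓ₂′} (k : HeytingField c ℓ₁ ℓ₂) (K : RationalFunctionField k c′ ℓ₁′ ℓ₂′)
    (m : ℕ) →
    let open Macdonald K m
        open RationalFunctionField K using (q)
        n = suc m
    in (E : Vec ℤ n → Laurent) → IsMacdonaldFamily E →
    (μ ν : Vec ℕ n) → ν IsDecreasingRearrangementOf μ →
    evaluate (λ i → t* ^* toℕ i) (E ⌜ μ ⌝)
    ≈ t ^ n⟨ ν ⟩ * ∏□ μ (λ r c c≤μᵣ →
    (1# - q ^ c * t ^ v ⌜ μ ⌝ r)
    / (1# - qt (+ lookup μ r ℤ.- + c ℤ.+ 1ℤ) (+ v ⌜ μ ⌝ r ℤ.- + u μ r c))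
    by 1-qt#0 (+ v ⌜ μ ⌝ r ℤ.- + u μ r c) (c≤m⇒0<m-c+1 c≤μᵣ))
theorem5p4 k K m E isFamily μ ν ν-rearranges-μ = begin
  evaluate (λ i → t* ^* toℕ i) (E ⌜ μ ⌝)
    -- The coordinates differ by a factor `1#`, and as elements of `K*` they carry different proofs
    -- of invertibility, so only their values are compared.
    ≈⟨ evaluate-pointwise (λ i → t* ^* toℕ i) (points ρ) (E ⌜ μ ⌝) (λ i → trans (sym (*-identityˡ (t ^ toℕ i)))
         (reflexive (≡.cong val (≡.sym (Vec.lookup∘tabulate (λ i → 0 , toℕ i) i))))) ⟩
  evaluate (points ρ) (E ⌜ μ ⌝)
    ≈⟨ specialization E isFamily μ ⟩
  t ^ minSum (Vec.toList μ) * formula μ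
    ≈⟨ *-cong (reflexive (≡.cong (t ^_) (≡.sym n⟨ν⟩))) (formula-∏□ μ) ⟩
  _ ∎
  where
  open RationalFunctionField K using (commutativeRing)
  open CommutativeRing commutativeRing using (setoid; sym; trans; reflexive; *-cong; *-identityˡ)
  open Macdonald K m
  open FieldLemmas K using (val)
  open Formula K
  open Evaluation K m
  open PrincipalSpecialization K m
  open SetoidReasoning setoid
  open _IsDecreasingRearrangementOf_ ν-rearranges-μ
  n⟨ν⟩ : n⟨ ν ⟩ ≡ minSum (Vec.toList μ)
  n⟨ν⟩ = ≡.trans (n⟨⟩-minSum ν decreasing) (minSum-↭ permutation)
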